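{- For all formulas $F,G$ of the language $F::=X\mid F\otimes F\mid 1\mid F\multimap F\mid\bot\mid F\&F\mid\top$, $F=_{\mathcal{D}}G$ holds if and only if, in every $\star$-autonomous category with finite products and for every interpretation of the atoms as objects, the interpretations of $F$ and $G$ are isomorphic. (That is, $\mathcal{D}$ is sound and complete for isomorphisms in $\star$-autonomous categories with finite products.)
   Context: Formulas are interpreted in a $\star$-autonomous category with finite products by interpreting $\otimes$ as the monoidal product, $1$ as its unit, $F\multimap G$ as the internal hom, $\bot$ as the dualizing object, $\&$ as the binary product and $\top$ as the terminal object; atoms $X$ are interpreted as arbitrary objects. The equational theory $\mathcal{D}$ is the congruence generated by: $F\otimes(G\otimes H)=(F\otimes G)\otimes H$; $F\otimes G=G\otimes F$; $F\otimes1=F$; $(F\otimes G)\multimap H=F\multimap(G\multimap H)$; $1\multimap F=F$; $F\&(G\&H)=(F\&G)\&H$; $F\&G=G\&F$; $F\&\top=F$; $F\multimap(G\&H)=(F\multimap G)\&(F\multimap H)$; $F\multimap\top=\top$; $(F\multimap\bot)\multimap\bot=F$. -}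

module Defs where

open import Level using (Level; _⊔_; suc)
open import Data.Nat using (ℕ)
open import Relation.Binary using (Rel; IsEquivalence)

infixr 7 _⊗_
infixr 6 _&_
infixr 5 _⊸_

data Formula : Set where
  atom : ℕ → Formula
  _⊗_  : Formula → Formula → Formula
  𝟏    : Formula
  _⊸_  : Formula → Formula → Formula
  ⊥'   : Formula
  _&_  : Formula → Formula → Formula
  ⊤'   : Formula

infix 4 _=D_

data _=D_ : Formula → Formula → Set where
  refl  : ∀ {F} → F =D F
  sym   : ∀ {F G} → F =D G → G =D F
  trans : ∀ {F G H} → F =D G → G =D H → F =D H
  ⊗-cong : ∀ {F F' G G'} → F =D F' → G =D G' → (F ⊗ G) =D (F' ⊗ G')
  ⊸-cong : ∀ {F F' G G'} → F =D F' → G =D G' → (F ⊸ G) =D (F' ⊸ G')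
  &-cong : ∀ {F F' G G'} → F =D F' → G =D G' → (F & G) =D (F' & G')
  ⊗-assoc  : ∀ {F G H} → (F ⊗ (G ⊗ H)) =D ((F ⊗ G) ⊗ H)
  ⊗-comm   : ∀ {F G} → (F ⊗ G) =D (G ⊗ F)
  ⊗-unit   : ∀ {F} → (F ⊗ 𝟏) =D F
  curry    : ∀ {F G H} → ((F ⊗ G) ⊸ H) =D (F ⊸ (G ⊸ H))
  ⊸-unit   : ∀ {F} → (𝟏 ⊸ F) =D F
  &-assoc  : ∀ {F G H} → (F & (G & H)) =D ((F & G) & H)
  &-comm   : ∀ {F G} → (F & G) =D (G & F)
  &-unit   : ∀ {F} → (F & ⊤') =D F
  ⊸-&-dist : ∀ {F G H} → (F ⊸ (G & H)) =D ((F ⊸ G) & (F ⊸ H))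
  ⊸-⊤      : ∀ {F} → (F ⊸ ⊤') =D ⊤'
  dneg     : ∀ {F} → ((F ⊸ ⊥') ⊸ ⊥') =D F

record Category (o ℓ e : Level) : Set (suc (o ⊔ ℓ ⊔ e)) where
  infix  4 _≈_
  infixr 9 _∘_
  field
    Obj   : Set o
    _⇒_   : Obj → Obj → Set ℓ
    _≈_   : ∀ {A B} → Rel (A ⇒ B) e
    id    : ∀ {A} → A ⇒ A
    _∘_   : ∀ {A B C} → B ⇒ C → A ⇒ B → A ⇒ C
    ≈-equiv   : ∀ {A B} → IsEquivalence (_≈_ {A} {B})
    ∘-resp-≈  : ∀ {A B C} {f h : B ⇒ C} {g i : A ⇒ B} →
                f ≈ h → g ≈ i → f ∘ g ≈ h ∘ i
    identityˡ : ∀ {A B} {f : A ⇒ B} → id ∘ f ≈ f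
    identityʳ : ∀ {A B} {f : A ⇒ B} → f ∘ id ≈ f
    assoc     : ∀ {A B C D} {f : A ⇒ B} {g : B ⇒ C} {h : C ⇒ D} →
                (h ∘ g) ∘ f ≈ h ∘ (g ∘ f)

record Iso {o ℓ e} (C : Category o ℓ e) (A B : Category.Obj C) : Set (ℓ ⊔ e) where
  open Category C
  field
    from : A ⇒ B
    to   : B ⇒ A
    isoˡ : to ∘ from ≈ id
    isoʳ : from ∘ to ≈ id

record StarAutonomousWithProducts (o ℓ e : Level) : Set (suc (o ⊔ ℓ ⊔ e)) where
  field
    cat : Category o ℓ e
  open Category cat public
  infixr 7 _⊗₀_ _⊗₁_
  field
    _⊗₀_ : Obj → Obj → Obj
    _⊗₁_ : ∀ {A B C D} → A ⇒ B → C ⇒ D → (A ⊗₀ C) ⇒ (B ⊗₀ D)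
    ⊗-identity : ∀ {A B} → (id {A} ⊗₁ id {B}) ≈ id
    ⊗-homomorphism : ∀ {A B C D E F} {f : A ⇒ B} {g : B ⇒ C} {h : D ⇒ E} {i : E ⇒ F} →
                     ((g ∘ f) ⊗₁ (i ∘ h)) ≈ (g ⊗₁ i) ∘ (f ⊗₁ h)
    ⊗-resp-≈ : ∀ {A B C D} {f f' : A ⇒ B} {g g' : C ⇒ D} →
               f ≈ f' → g ≈ g' → (f ⊗₁ g) ≈ (f' ⊗₁ g')
    I : Obj
    α⇒ : ∀ {A B C} → ((A ⊗₀ B) ⊗₀ C) ⇒ (A ⊗₀ (B ⊗₀ C))
    α⇐ : ∀ {A B C} → (A ⊗₀ (B ⊗₀ C)) ⇒ ((A ⊗₀ B) ⊗₀ C)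
    α-isoˡ : ∀ {A B C} → α⇐ {A} {B} {C} ∘ α⇒ ≈ id
    α-isoʳ : ∀ {A B C} → α⇒ {A} {B} {C} ∘ α⇐ ≈ id
    λ⇒ : ∀ {A} → (I ⊗₀ A) ⇒ A
    λ⇐ : ∀ {A} → A ⇒ (I ⊗₀ A)
    λ-isoˡ : ∀ {A} → λ⇐ {A} ∘ λ⇒ ≈ id
    λ-isoʳ : ∀ {A} → λ⇒ {A} ∘ λ⇐ ≈ id
    ρ⇒ : ∀ {A} → (A ⊗₀ I) ⇒ A
    ρ⇐ : ∀ {A} → A ⇒ (A ⊗₀ I)
    ρ-isoˡ : ∀ {A} → ρ⇐ {A} ∘ ρ⇒ ≈ id
    ρ-isoʳ : ∀ {A} → ρ⇒ {A} ∘ ρ⇐ ≈ id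
    σ : ∀ {A B} → (A ⊗₀ B) ⇒ (B ⊗₀ A)
    α-natural : ∀ {A A' B B' C C'} {f : A ⇒ A'} {g : B ⇒ B'} {h : C ⇒ C'} →
                α⇒ ∘ ((f ⊗₁ g) ⊗₁ h) ≈ (f ⊗₁ (g ⊗₁ h)) ∘ α⇒
    λ-natural : ∀ {A B} {f : A ⇒ B} → λ⇒ ∘ (id ⊗₁ f) ≈ f ∘ λ⇒
    ρ-natural : ∀ {A B} {f : A ⇒ B} → ρ⇒ ∘ (f ⊗₁ id) ≈ f ∘ ρ⇒
    σ-natural : ∀ {A A' B B'} {f : A ⇒ A'} {g : B ⇒ B'} →
                σ ∘ (f ⊗₁ g) ≈ (g ⊗₁ f) ∘ σ
    pentagon : ∀ {A B C D} →
               α⇒ {A} {B} {C ⊗₀ D} ∘ α⇒ {A ⊗₀ B} {C} {D}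
                 ≈ (id ⊗₁ α⇒) ∘ (α⇒ {A} {B ⊗₀ C} {D} ∘ (α⇒ ⊗₁ id))
    triangle : ∀ {A B} → (id {A} ⊗₁ λ⇒ {B}) ∘ α⇒ ≈ (ρ⇒ ⊗₁ id)
    hexagon  : ∀ {A B C} →
               α⇒ {B} {C} {A} ∘ (σ {A} {B ⊗₀ C} ∘ α⇒)
                 ≈ (id ⊗₁ σ) ∘ (α⇒ {B} {A} {C} ∘ (σ ⊗₁ id))
    σ-involutive : ∀ {A B} → σ {B} {A} ∘ σ {A} {B} ≈ id
    [_,_] : Obj → Obj → Obj
    eval : ∀ {A B} → ([ A , B ] ⊗₀ A) ⇒ B
    λ-abs : ∀ {A B C} → (C ⊗₀ A) ⇒ B → C ⇒ [ A , B ]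
    λ-abs-resp-≈ : ∀ {A B C} {f g : (C ⊗₀ A) ⇒ B} → f ≈ g → λ-abs f ≈ λ-abs g
    eval-β : ∀ {A B C} {f : (C ⊗₀ A) ⇒ B} → eval ∘ (λ-abs f ⊗₁ id) ≈ f
    eval-η : ∀ {A B C} {g : C ⇒ [ A , B ]} → λ-abs (eval ∘ (g ⊗₁ id)) ≈ g
    -- dualizing object: the canonical map A ⇒ [[A , ⊥] , ⊥] is an isomorphism
    ⊥ : Obj
    dual⇐ : ∀ {A} → [ [ A , ⊥ ] , ⊥ ] ⇒ A
    dual-isoˡ : ∀ {A} → dual⇐ ∘ λ-abs (eval ∘ σ) ≈ id {A}
    dual-isoʳ : ∀ {A} → λ-abs (eval ∘ σ) ∘ dual⇐ ≈ id {[ [ A , ⊥ ] , ⊥ ]}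
    ⊤ : Obj
    ! : ∀ {A} → A ⇒ ⊤
    !-unique : ∀ {A} (f : A ⇒ ⊤) → ! ≈ f
    _×_ : Obj → Obj → Obj
    π₁ : ∀ {A B} → (A × B) ⇒ A
    π₂ : ∀ {A B} → (A × B) ⇒ B
    ⟨_,_⟩ : ∀ {A B C} → C ⇒ A → C ⇒ B → C ⇒ (A × B)
    project₁ : ∀ {A B C} {f : C ⇒ A} {g : C ⇒ B} → π₁ ∘ ⟨ f , g ⟩ ≈ f
    project₂ : ∀ {A B C} {f : C ⇒ A} {g : C ⇒ B} → π₂ ∘ ⟨ f , g ⟩ ≈ g
    ×-unique : ∀ {A B C} {h : C ⇒ (A × B)} {f : C ⇒ A} {g : C ⇒ B} →
               π₁ ∘ h ≈ f → π₂ ∘ h ≈ g → ⟨ f , g ⟩ ≈ h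

module _ {o ℓ e} (𝒞 : StarAutonomousWithProducts o ℓ e) where
  open StarAutonomousWithProducts 𝒞

  ⟦_⟧ : Formula → (ℕ → Obj) → Obj
  ⟦ atom x ⟧ ρ = ρ x
  ⟦ F ⊗ G ⟧ ρ = ⟦ F ⟧ ρ ⊗₀ ⟦ G ⟧ ρ
  ⟦ 𝟏 ⟧ ρ = I
  ⟦ F ⊸ G ⟧ ρ = [ ⟦ F ⟧ ρ , ⟦ G ⟧ ρ ]
  ⟦ ⊥' ⟧ ρ = ⊥
  ⟦ F & G ⟧ ρ = ⟦ F ⟧ ρ × ⟦ G ⟧ ρ
  ⟦ ⊤' ⟧ ρ = ⊤

ValidIso : ∀ (o ℓ e : Level) → Formula → Formula → Set (suc (o ⊔ ℓ ⊔ e))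
ValidIso o ℓ e F G =
  (𝒞 : StarAutonomousWithProducts o ℓ e)
  (ρ : ℕ → StarAutonomousWithProducts.Obj 𝒞) →
  Iso (StarAutonomousWithProducts.cat 𝒞) (⟦_⟧ 𝒞 F ρ) (⟦_⟧ 𝒞 G ρ)

{-# OPTIONS --safe #-}

-- Completeness needs a model in which isomorphisms are visible.  A validity in all models holds in the free one, so it
-- yields mutually inverse terms.  Terms denote relations between webs (additive resolutions, with a two-valued label on
-- every leaf), and phase semantics in the style of Okada turns each of them into a cut-free MALL proof realising its
-- relation.  Equal terms need not have equal relations, since units and ⊤ lose information; but one proof realises
-- both relations of an equation, and uniformity in the labels, totality and coherence then force every relation linked
-- to the identity of a distributed normal form to be the identity.  Hence mutually inverse terms between normal
-- forms denote inverse bijections.  Finally, when a bijection is realised by cut-free proofs in both directions, no premise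
-- can leave a coordinate unused and no ⊕ can be chosen twice; so last rules are principal, and they match the ⊗-factors
-- and ⊕-summands of the two formulas one to one, up to associativity and commutativity.
module Submission where

open import Defs
open import Level using (Level; Lift; lift; lower; _⊔_)
open import Data.Bool using (Bool; true; false; not)
open import Data.Bool.Properties using () renaming (_≟_ to _≟ᵇ_)
open import Data.Empty using (⊥; ⊥-elim)
open import Data.List using (List; []; _∷_; _++_)
open import Data.List.Relation.Unary.All using (All; []; _∷_) renaming (map to mapᴬ)
open import Data.List.Relation.Unary.All.Properties using (++⁺; ++⁻ˡ; ++⁻ʳ)
open import Data.Nat using (ℕ)
open import Data.Product using (Σ; _×_; _,_; proj₁; proj₂)
open import Data.Product.Properties using () renaming (≡-dec to ×-≡-dec; ,-injectiveˡ to ,-injˡ; ,-injectiveʳ to ,-injʳ)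
open import Data.Sum using (_⊎_; inj₁; inj₂) renaming (map to map⊎)
open import Data.Sum.Properties using (inj₁-injective; inj₂-injective) renaming (≡-dec to ⊎-≡-dec)
open import Data.Unit using (⊤; tt)
open import Relation.Binary using (Setoid)
open import Relation.Binary.Construct.Closure.Equivalence using (EqClosure; gmap; symmetric; transitive; return; reflexive)
open import Relation.Binary.Construct.Closure.ReflexiveTransitive using (ε; _◅_)
open import Relation.Binary.Construct.Closure.Symmetric using () renaming (fwd to onward; bwd to backward)
open import Relation.Binary.PropositionalEquality using (_≡_; _≢_; refl; subst; subst₂; cong; cong₂) renaming (sym to ≡-sym; trans to ≡-trans)
import Relation.Binary.Reasoning.Setoid as SetoidReasoning
open import Relation.Nullary using (¬_; Dec; yes; no)
open import Relation.Nullary.Decidable using (_×-dec_)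

-- Soundness

-- Two labels per leaf make the final matching possible: every web has two distinct points, so a
-- formula on which the rest does not depend breaks injectivity, whereas with one-point leaves it
-- would be invisible. The price is that a unit law must relate the label of a vanishing unit to
-- something, and `λ⁻ᵗ ∘ᵗ λᵗ` no longer denotes the identity. One induction (`Thm`) serves twice. On
-- a single normal form it shows that a relation sharing a proof with the identity is `Close` to it;
-- on two normal forms it yields `=D`. Closeness does not exclude an empty relation. A second phase
-- model, whose pole is nonemptiness, supplies a related pair with the resolution of any given
-- point; uniformity moves it to constant labellings and closeness back to the point itself. So the
-- diagonal is contained in the relation, and coherence excludes everything else.

module Soundness {o ℓ e} (𝒞 : StarAutonomousWithProducts o ℓ e) where
  open StarAutonomousWithProducts 𝒞 renaming (_×_ to _×₀_; ⊤ to ⊤₀; ⊥ to ⊥₀; α-isoˡ to αˡ; α-isoʳ to αʳ)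
  open Iso

  homs : Obj → Obj → Setoid ℓ e
  homs A B = record { Carrier = A ⇒ B ; _≈_ = _≈_ ; isEquivalence = ≈-equiv }

  module _ {A B : Obj} where
    open Setoid (homs A B) public using () renaming (refl to ≈-refl; sym to ≈-sym; trans to ≈-trans)
    open SetoidReasoning (homs A B) public

  ∘-cong₁ : ∀ {A B C} {f f' : B ⇒ C} {g : A ⇒ B} → f ≈ f' → f ∘ g ≈ f' ∘ g
  ∘-cong₁ p = ∘-resp-≈ p ≈-refl

  ∘-cong₂ : ∀ {A B C} {f : B ⇒ C} {g g' : A ⇒ B} → g ≈ g' → f ∘ g ≈ f ∘ g'
  ∘-cong₂ p = ∘-resp-≈ ≈-refl p

  cancel : ∀ {A B C} {f : B ⇒ C} {g : C ⇒ B} {h : A ⇒ B} → g ∘ f ≈ id → g ∘ (f ∘ h) ≈ h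
  cancel p = ≈-trans (≈-sym assoc) (≈-trans (∘-cong₁ p) identityˡ)

  cancelʳ : ∀ {A B C} {f : A ⇒ B} {g : B ⇒ A} {h : B ⇒ C} → f ∘ g ≈ id → (h ∘ f) ∘ g ≈ h
  cancelʳ p = ≈-trans assoc (≈-trans (∘-cong₂ p) identityʳ)

  -- The laws of `[_,_]` and `_×₀_` are universal properties, so they are most easily used on
  -- generalised elements `C ⇒ X`: each inverse law then reduces to β and η.
  record Natural (X Y : Obj) : Set (o ⊔ ℓ ⊔ e) where
    field
      φ : ∀ {C} → C ⇒ X → C ⇒ Y
      ψ : ∀ {C} → C ⇒ Y → C ⇒ X
      φ-resp : ∀ {C} {h h' : C ⇒ X} → h ≈ h' → φ h ≈ φ h'
      ψ-resp : ∀ {C} {h h' : C ⇒ Y} → h ≈ h' → ψ h ≈ ψ h'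
      ψφ : ∀ {C} (h : C ⇒ X) → ψ (φ h) ≈ h
      φψ : ∀ {C} (h : C ⇒ Y) → φ (ψ h) ≈ h
      natural : ∀ {C D} (h : C ⇒ X) (k : D ⇒ C) → φ (h ∘ k) ≈ φ h ∘ k

  yoneda : ∀ {X Y} → Natural X Y → Iso cat X Y
  yoneda n = record
    { from = φ id ; to = ψ id
    ; isoˡ = begin
        ψ id ∘ φ id ≈⟨ ≈-sym (ψφ _) ⟩
        ψ (φ (ψ id ∘ φ id)) ≈⟨ ψ-resp (natural _ _) ⟩
        ψ (φ (ψ id) ∘ φ id) ≈⟨ ψ-resp (≈-trans (∘-cong₁ (φψ id)) identityˡ) ⟩
        ψ (φ id) ≈⟨ ψφ id ⟩
        id ∎
    ; isoʳ = begin
        φ id ∘ ψ id ≈⟨ ≈-sym (natural _ _) ⟩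
        φ (id ∘ ψ id) ≈⟨ φ-resp identityˡ ⟩
        φ (ψ id) ≈⟨ φψ id ⟩
        id ∎ }
    where open Natural n

  unc : ∀ {A B C} → C ⇒ [ A , B ] → (C ⊗₀ A) ⇒ B
  unc h = eval ∘ (h ⊗₁ id)

  unc-resp : ∀ {A B C} {h h' : C ⇒ [ A , B ]} → h ≈ h' → unc h ≈ unc h'
  unc-resp p = ∘-cong₂ (⊗-resp-≈ p ≈-refl)

  ∘-⊗id : ∀ {A B C D} {h : C ⇒ D} {k : B ⇒ C} → (h ∘ k) ⊗₁ id {A} ≈ (h ⊗₁ id) ∘ (k ⊗₁ id)
  ∘-⊗id = ≈-trans (⊗-resp-≈ ≈-refl (≈-sym identityˡ)) ⊗-homomorphism

  unc-∘ : ∀ {A B C D} (h : C ⇒ [ A , B ]) (k : D ⇒ C) → unc (h ∘ k) ≈ unc h ∘ (k ⊗₁ id)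
  unc-∘ h k = ≈-trans (∘-cong₂ ∘-⊗id) (≈-sym assoc)

  cur-unc : ∀ {A B C} (h : C ⇒ [ A , B ]) → λ-abs (unc h) ≈ h
  cur-unc h = eval-η

  cur-∘ : ∀ {A B C D} (f : (C ⊗₀ A) ⇒ B) (k : D ⇒ C) → λ-abs (f ∘ (k ⊗₁ id)) ≈ λ-abs f ∘ k
  cur-∘ f k = begin
    λ-abs (f ∘ (k ⊗₁ id)) ≈⟨ λ-abs-resp-≈ (∘-cong₁ (≈-sym eval-β)) ⟩
    λ-abs (unc (λ-abs f) ∘ (k ⊗₁ id)) ≈⟨ λ-abs-resp-≈ (≈-sym (unc-∘ (λ-abs f) k)) ⟩
    λ-abs (unc (λ-abs f ∘ k)) ≈⟨ cur-unc _ ⟩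
    λ-abs f ∘ k ∎

  ⟨⟩-resp : ∀ {A B C} {f f' : C ⇒ A} {g g' : C ⇒ B} → f ≈ f' → g ≈ g' → ⟨ f , g ⟩ ≈ ⟨ f' , g' ⟩
  ⟨⟩-resp p q = ×-unique (≈-trans project₁ (≈-sym p)) (≈-trans project₂ (≈-sym q))

  ⟨⟩-∘ : ∀ {A B C D} {f : C ⇒ A} {g : C ⇒ B} {k : D ⇒ C} → ⟨ f ∘ k , g ∘ k ⟩ ≈ ⟨ f , g ⟩ ∘ k
  ⟨⟩-∘ = ×-unique (≈-trans (≈-sym assoc) (∘-cong₁ project₁)) (≈-trans (≈-sym assoc) (∘-cong₁ project₂))

  iso-refl : ∀ {A} → Iso cat A A
  iso-refl = record { from = id ; to = id ; isoˡ = identityˡ ; isoʳ = identityˡ }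

  iso-sym : ∀ {A B} → Iso cat A B → Iso cat B A
  iso-sym p = record { from = to p ; to = from p ; isoˡ = isoʳ p ; isoʳ = isoˡ p }

  iso-trans : ∀ {A B C} → Iso cat A B → Iso cat B C → Iso cat A C
  iso-trans p q = record
    { from = from q ∘ from p ; to = to p ∘ to q
    ; isoˡ = ≈-trans assoc (≈-trans (∘-cong₂ (cancel (isoˡ q))) (isoˡ p))
    ; isoʳ = ≈-trans assoc (≈-trans (∘-cong₂ (cancel (isoʳ p))) (isoʳ q)) }

  iso-⊗ : ∀ {A A' B B'} → Iso cat A A' → Iso cat B B' → Iso cat (A ⊗₀ B) (A' ⊗₀ B')
  iso-⊗ p q = record
    { from = from p ⊗₁ from q ; to = to p ⊗₁ to q
    ; isoˡ = ≈-trans (≈-sym ⊗-homomorphism) (≈-trans (⊗-resp-≈ (isoˡ p) (isoˡ q)) ⊗-identity)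
    ; isoʳ = ≈-trans (≈-sym ⊗-homomorphism) (≈-trans (⊗-resp-≈ (isoʳ p) (isoʳ q)) ⊗-identity) }

  id⊗-cancel : ∀ {A B C} {f : A ⇒ B} {g : B ⇒ A} → g ∘ f ≈ id → (id {C} ⊗₁ g) ∘ (id ⊗₁ f) ≈ id
  id⊗-cancel p = ≈-trans (≈-sym ⊗-homomorphism) (≈-trans (⊗-resp-≈ identityˡ p) ⊗-identity)

  iso-⊸ : ∀ {A A' B B'} → Iso cat A A' → Iso cat B B' → Iso cat [ A , B ] [ A' , B' ]
  iso-⊸ p q = yoneda record
    { φ = λ h → λ-abs (from q ∘ (unc h ∘ (id ⊗₁ to p)))
    ; ψ = λ h → λ-abs (to q ∘ (unc h ∘ (id ⊗₁ from p)))
    ; φ-resp = λ e → λ-abs-resp-≈ (∘-cong₂ (∘-cong₁ (unc-resp e)))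
    ; ψ-resp = λ e → λ-abs-resp-≈ (∘-cong₂ (∘-cong₁ (unc-resp e)))
    ; ψφ = λ h → ≈-trans (λ-abs-resp-≈ (≈-trans (∘-cong₂ (≈-trans (∘-cong₁ eval-β) assoc))
                   (≈-trans (cancel (isoˡ q)) (cancelʳ (id⊗-cancel (isoˡ p)))))) (cur-unc h)
    ; φψ = λ h → ≈-trans (λ-abs-resp-≈ (≈-trans (∘-cong₂ (≈-trans (∘-cong₁ eval-β) assoc))
                   (≈-trans (cancel (isoʳ q)) (cancelʳ (id⊗-cancel (isoʳ p)))))) (cur-unc h)
    ; natural = λ h k → ≈-trans (λ-abs-resp-≈ (≈-trans (∘-cong₂ (≈-trans (∘-cong₁ (unc-∘ h k))
                   (≈-trans assoc (≈-trans (∘-cong₂ (slide k)) (≈-sym assoc))))) (≈-sym assoc))) (cur-∘ _ k) }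
    where
    slide : ∀ {C D E F} (k : C ⇒ D) {f : E ⇒ F} → (k ⊗₁ id) ∘ (id ⊗₁ f) ≈ (id ⊗₁ f) ∘ (k ⊗₁ id)
    slide k = ≈-trans (≈-sym ⊗-homomorphism) (≈-trans (⊗-resp-≈ (≈-trans identityʳ (≈-sym identityˡ)) (≈-trans identityˡ (≈-sym identityʳ))) ⊗-homomorphism)

  ⟨⟩-η : ∀ {A B C} (h : C ⇒ (A ×₀ B)) → ⟨ π₁ ∘ h , π₂ ∘ h ⟩ ≈ h
  ⟨⟩-η h = ×-unique ≈-refl ≈-refl

  iso-× : ∀ {A A' B B'} → Iso cat A A' → Iso cat B B' → Iso cat (A ×₀ B) (A' ×₀ B')
  iso-× p q = yoneda record
    { φ = λ h → ⟨ from p ∘ (π₁ ∘ h) , from q ∘ (π₂ ∘ h) ⟩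
    ; ψ = λ h → ⟨ to p ∘ (π₁ ∘ h) , to q ∘ (π₂ ∘ h) ⟩
    ; φ-resp = λ e → ⟨⟩-resp (∘-cong₂ (∘-cong₂ e)) (∘-cong₂ (∘-cong₂ e))
    ; ψ-resp = λ e → ⟨⟩-resp (∘-cong₂ (∘-cong₂ e)) (∘-cong₂ (∘-cong₂ e))
    ; ψφ = λ h → ≈-trans (⟨⟩-resp (≈-trans (∘-cong₂ project₁) (cancel (isoˡ p))) (≈-trans (∘-cong₂ project₂) (cancel (isoˡ q)))) (⟨⟩-η h)
    ; φψ = λ h → ≈-trans (⟨⟩-resp (≈-trans (∘-cong₂ project₁) (cancel (isoʳ p))) (≈-trans (∘-cong₂ project₂) (cancel (isoʳ q)))) (⟨⟩-η h)
    ; natural = λ h k → ≈-trans (⟨⟩-resp (≈-trans (∘-cong₂ (≈-sym assoc)) (≈-sym assoc)) (≈-trans (∘-cong₂ (≈-sym assoc)) (≈-sym assoc))) ⟨⟩-∘ }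

  iso-curry : ∀ {A B C} → Iso cat [ A ⊗₀ B , C ] [ A , [ B , C ] ]
  iso-curry = yoneda record
    { φ = λ h → λ-abs (λ-abs (unc h ∘ α⇒))
    ; ψ = λ h → λ-abs (unc (unc h) ∘ α⇐)
    ; φ-resp = λ e → λ-abs-resp-≈ (λ-abs-resp-≈ (∘-cong₁ (unc-resp e)))
    ; ψ-resp = λ e → λ-abs-resp-≈ (∘-cong₁ (unc-resp (unc-resp e)))
    ; ψφ = λ h → ≈-trans (λ-abs-resp-≈ (≈-trans (∘-cong₁ (≈-trans (unc-resp eval-β) eval-β)) (cancelʳ αʳ))) (cur-unc h)
    ; φψ = λ h → ≈-trans (λ-abs-resp-≈ (≈-trans (λ-abs-resp-≈ (≈-trans (∘-cong₁ eval-β) (cancelʳ αˡ))) (cur-unc _))) (cur-unc h)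
    ; natural = λ h k → ≈-trans (λ-abs-resp-≈ (≈-trans (λ-abs-resp-≈ (≈-trans (∘-cong₁ (unc-∘ h k))
        -- The second `id` of `k ⊗₁ id` is seen as `id ⊗₁ id`, which brings naturality of the
        -- associator into play.
        (≈-trans assoc (≈-trans (∘-cong₂ (≈-trans (∘-cong₁ (⊗-resp-≈ ≈-refl (≈-sym ⊗-identity))) (≈-sym α-natural))) (≈-sym assoc))))) (cur-∘ _ (k ⊗₁ id)))) (cur-∘ _ k) }

  iso-⊸-unit : ∀ {A} → Iso cat A [ I , A ]
  iso-⊸-unit = yoneda record
    { φ = λ h → λ-abs (h ∘ ρ⇒)
    ; ψ = λ h → unc h ∘ ρ⇐
    ; φ-resp = λ e → λ-abs-resp-≈ (∘-cong₁ e)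
    ; ψ-resp = λ e → ∘-cong₁ (unc-resp e)
    ; ψφ = λ h → ≈-trans (∘-cong₁ eval-β) (cancelʳ ρ-isoʳ)
    ; φψ = λ h → ≈-trans (λ-abs-resp-≈ (cancelʳ ρ-isoˡ)) (cur-unc h)
    ; natural = λ h k → ≈-trans (λ-abs-resp-≈ (≈-trans assoc (≈-trans (∘-cong₂ (≈-sym ρ-natural)) (≈-sym assoc)))) (cur-∘ _ k) }

  iso-dist : ∀ {A B C} → Iso cat [ A , B ×₀ C ] ([ A , B ] ×₀ [ A , C ])
  iso-dist = yoneda record
    { φ = λ h → ⟨ λ-abs (π₁ ∘ unc h) , λ-abs (π₂ ∘ unc h) ⟩
    ; ψ = λ h → λ-abs ⟨ unc (π₁ ∘ h) , unc (π₂ ∘ h) ⟩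
    ; φ-resp = λ e → ⟨⟩-resp (λ-abs-resp-≈ (∘-cong₂ (unc-resp e))) (λ-abs-resp-≈ (∘-cong₂ (unc-resp e)))
    ; ψ-resp = λ e → λ-abs-resp-≈ (⟨⟩-resp (unc-resp (∘-cong₂ e)) (unc-resp (∘-cong₂ e)))
    ; ψφ = λ h → ≈-trans (λ-abs-resp-≈ (≈-trans (⟨⟩-resp (≈-trans (unc-resp project₁) eval-β) (≈-trans (unc-resp project₂) eval-β)) (⟨⟩-η _))) (cur-unc h)
    ; φψ = λ h → ≈-trans (⟨⟩-resp (≈-trans (λ-abs-resp-≈ (≈-trans (∘-cong₂ eval-β) project₁)) (cur-unc _))
                                  (≈-trans (λ-abs-resp-≈ (≈-trans (∘-cong₂ eval-β) project₂)) (cur-unc _))) (⟨⟩-η h)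
    ; natural = λ h k → ≈-trans (⟨⟩-resp (≈-trans (λ-abs-resp-≈ (≈-trans (∘-cong₂ (unc-∘ h k)) (≈-sym assoc))) (cur-∘ _ k))
                                         (≈-trans (λ-abs-resp-≈ (≈-trans (∘-cong₂ (unc-∘ h k)) (≈-sym assoc))) (cur-∘ _ k))) ⟨⟩-∘ }

  to-⊤ : ∀ {A} {f g : A ⇒ ⊤₀} → f ≈ g
  to-⊤ {f = f} {g} = ≈-trans (≈-sym (!-unique f)) (!-unique g)

  iso-⊸-⊤ : ∀ {A} → Iso cat [ A , ⊤₀ ] ⊤₀
  iso-⊸-⊤ = record { from = ! ; to = λ-abs !
    ; isoˡ = ≈-trans (≈-sym (cur-unc _)) (≈-trans (λ-abs-resp-≈ to-⊤) (cur-unc _)) ; isoʳ = to-⊤ }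

  iso-×-assoc : ∀ {A B C} → Iso cat (A ×₀ (B ×₀ C)) ((A ×₀ B) ×₀ C)
  iso-×-assoc = yoneda record
    { φ = λ h → ⟨ ⟨ π₁ ∘ h , π₁ ∘ (π₂ ∘ h) ⟩ , π₂ ∘ (π₂ ∘ h) ⟩
    ; ψ = λ h → ⟨ π₁ ∘ (π₁ ∘ h) , ⟨ π₂ ∘ (π₁ ∘ h) , π₂ ∘ h ⟩ ⟩
    ; φ-resp = λ e → ⟨⟩-resp (⟨⟩-resp (∘-cong₂ e) (∘-cong₂ (∘-cong₂ e))) (∘-cong₂ (∘-cong₂ e))
    ; ψ-resp = λ e → ⟨⟩-resp (∘-cong₂ (∘-cong₂ e)) (⟨⟩-resp (∘-cong₂ (∘-cong₂ e)) (∘-cong₂ e))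
    ; ψφ = λ h → ≈-trans (⟨⟩-resp (≈-trans (∘-cong₂ project₁) project₁)
        (≈-trans (⟨⟩-resp (≈-trans (∘-cong₂ project₁) project₂) project₂) (⟨⟩-η _))) (⟨⟩-η h)
    ; φψ = λ h → ≈-trans (⟨⟩-resp (≈-trans (⟨⟩-resp project₁ (≈-trans (∘-cong₂ project₂) project₁)) (⟨⟩-η _)) (≈-trans (∘-cong₂ project₂) project₂)) (⟨⟩-η h)
    ; natural = λ h k → ≈-trans (⟨⟩-resp (≈-trans (⟨⟩-resp (≈-sym assoc) (≈-trans (∘-cong₂ (≈-sym assoc)) (≈-sym assoc))) ⟨⟩-∘)
        (≈-trans (∘-cong₂ (≈-sym assoc)) (≈-sym assoc))) ⟨⟩-∘ }

  iso-×-comm : ∀ {A B} → Iso cat (A ×₀ B) (B ×₀ A)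
  iso-×-comm = record { from = ⟨ π₂ , π₁ ⟩ ; to = ⟨ π₂ , π₁ ⟩ ; isoˡ = flip² ; isoʳ = flip² }
    where
    flip² : ∀ {A B} → ⟨ π₂ , π₁ ⟩ ∘ ⟨ π₂ , π₁ ⟩ ≈ id {A ×₀ B}
    flip² = ≈-trans (≈-sym ⟨⟩-∘) (×-unique (≈-trans identityʳ (≈-sym project₂)) (≈-trans identityʳ (≈-sym project₁)))

  iso-×-unit : ∀ {A} → Iso cat (A ×₀ ⊤₀) A
  iso-×-unit = record { from = π₁ ; to = ⟨ id , ! ⟩
    ; isoˡ = ≈-trans (≈-sym ⟨⟩-∘) (×-unique (≈-trans identityʳ (≈-sym identityˡ)) to-⊤) ; isoʳ = project₁ }

  sound-D : ∀ {F G} → F =D G → ∀ ρ → Iso cat (⟦_⟧ 𝒞 F ρ) (⟦_⟧ 𝒞 G ρ)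
  sound-D refl ρ = iso-refl
  sound-D (sym p) ρ = iso-sym (sound-D p ρ)
  sound-D (trans p q) ρ = iso-trans (sound-D p ρ) (sound-D q ρ)
  sound-D (⊗-cong p q) ρ = iso-⊗ (sound-D p ρ) (sound-D q ρ)
  sound-D (⊸-cong p q) ρ = iso-⊸ (sound-D p ρ) (sound-D q ρ)
  sound-D (&-cong p q) ρ = iso-× (sound-D p ρ) (sound-D q ρ)
  sound-D ⊗-assoc ρ = record { from = α⇐ ; to = α⇒ ; isoˡ = αʳ ; isoʳ = αˡ }
  sound-D ⊗-comm ρ = record { from = σ ; to = σ ; isoˡ = σ-involutive ; isoʳ = σ-involutive }
  sound-D ⊗-unit ρ = record { from = ρ⇒ ; to = ρ⇐ ; isoˡ = ρ-isoˡ ; isoʳ = ρ-isoʳ }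
  sound-D curry ρ = iso-curry
  sound-D ⊸-unit ρ = iso-sym iso-⊸-unit
  sound-D &-assoc ρ = iso-×-assoc
  sound-D &-comm ρ = iso-×-comm
  sound-D &-unit ρ = iso-×-unit
  sound-D ⊸-&-dist ρ = iso-dist
  sound-D ⊸-⊤ ρ = iso-⊸-⊤
  sound-D dneg ρ = record { from = dual⇐ ; to = λ-abs (eval ∘ σ) ; isoˡ = dual-isoʳ ; isoʳ = dual-isoˡ }

-- Sequents, webs and splittings

data Sign : Set where
  ⊕ ⊖ : Sign

-- A signed skeleton is a formula in negation normal form: (⊖ , k) is the linear
-- negation of (⊕ , k), so ⅋, ⊥, &, ⊤ are the negative readings of tens, unit, plus, zero.
data Skeleton : Set

record Signed : Set where
  inductive
  eta-equality
  constructor _,_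
  field
    sign : Sign
    skel : Skeleton

open Signed

data Skeleton where
  lit  : ℕ → Skeleton
  unit zero : Skeleton
  tens plus : Signed → Signed → Skeleton

flip : Sign → Sign
flip ⊕ = ⊖
flip ⊖ = ⊕

dual : Signed → Signed
dual (s , k) = flip s , k

-- The web of a leaf is a two-element set of labels: a point of the web is an additive
-- resolution of the formula together with a label on each of its remaining leaves.
wk : Skeleton → Set
wk (lit n) = Bool
wk unit = Bool
wk zero = Bool
wk (tens (_ , k) (_ , l)) = wk k × wk l
wk (plus (_ , k) (_ , l)) = wk k ⊎ wk l

web : Signed → Set
web (_ , k) = wk k

Sequent : Set
Sequent = List Signed

W : Sequent → Set
W [] = ⊤
W (a ∷ Γ) = web a × W Γ

-- Relations come in pairs indexed by Ix: the two members are realised by one and the same proof.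
Ix : Set
Ix = Bool

infix 3 _≐_
_≐_ : {X : Set} → (Ix → X → Set) → (Ix → X → Set) → Set
R ≐ S = ∀ i x → (R i x → S i x) × (S i x → R i x)

≐-sym : {X : Set} {R S : Ix → X → Set} → R ≐ S → S ≐ R
≐-sym e i x = proj₂ (e i x) , proj₁ (e i x)

≐-trans : {X : Set} {R S T : Ix → X → Set} → R ≐ S → S ≐ T → R ≐ T
≐-trans e f i x = (λ r → proj₁ (f i x) (proj₁ (e i x) r)) , (λ t → proj₂ (e i x) (proj₂ (f i x) t))

data Sel (a : Signed) : Sequent → Sequent → Set where
  here  : ∀ {Δ} → Sel a (a ∷ Δ) Δ
  there : ∀ {b Γ Δ} → Sel a Γ Δ → Sel a (b ∷ Γ) (b ∷ Δ)

get : ∀ {a Γ Δ} → Sel a Γ Δ → W Γ → web a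
get here (x , _) = x
get (there s) (_ , γ) = get s γ

rem : ∀ {a Γ Δ} → Sel a Γ Δ → W Γ → W Δ
rem here (_ , γ) = γ
rem (there s) (y , γ) = y , rem s γ

ins : ∀ {a Γ Δ} → Sel a Γ Δ → web a → W Δ → W Γ
ins here x δ = x , δ
ins (there s) x (y , δ) = y , ins s x δ

get-ins : ∀ {a Γ Δ} (s : Sel a Γ Δ) x δ → get s (ins s x δ) ≡ x
get-ins here x δ = refl
get-ins (there s) x (y , δ) = get-ins s x δ

rem-ins : ∀ {a Γ Δ} (s : Sel a Γ Δ) x δ → rem s (ins s x δ) ≡ δ
rem-ins here x δ = refl
rem-ins (there s) x (y , δ) = cong (y ,_) (rem-ins s x δ)

ins-get-rem : ∀ {a Γ Δ} (s : Sel a Γ Δ) γ → ins s (get s γ) (rem s γ) ≡ γ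
ins-get-rem here γ = refl
ins-get-rem (there s) (y , γ) = cong (y ,_) (ins-get-rem s γ)

-- Splittings are interleavings rather than concatenations, and `Sel` picks a formula at any
-- position; so the sequent calculus below needs no exchange rule.
data Spl : Sequent → Sequent → Sequent → Set where
  []  : Spl [] [] []
  lft : ∀ {a Γ Γ₁ Γ₂} → Spl Γ Γ₁ Γ₂ → Spl (a ∷ Γ) (a ∷ Γ₁) Γ₂
  rgt : ∀ {a Γ Γ₁ Γ₂} → Spl Γ Γ₁ Γ₂ → Spl (a ∷ Γ) Γ₁ (a ∷ Γ₂)

left : ∀ {Γ Γ₁ Γ₂} → Spl Γ Γ₁ Γ₂ → W Γ → W Γ₁
left [] γ = γ
left (lft s) (x , γ) = x , left s γ
left (rgt s) (x , γ) = left s γ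

right : ∀ {Γ Γ₁ Γ₂} → Spl Γ Γ₁ Γ₂ → W Γ → W Γ₂
right [] γ = γ
right (lft s) (x , γ) = right s γ
right (rgt s) (x , γ) = x , right s γ

join : ∀ {Γ Γ₁ Γ₂} → Spl Γ Γ₁ Γ₂ → W Γ₁ → W Γ₂ → W Γ
join [] γ δ = γ
join (lft s) (x , γ) δ = x , join s γ δ
join (rgt s) γ (x , δ) = x , join s γ δ

left-join : ∀ {Γ Γ₁ Γ₂} (s : Spl Γ Γ₁ Γ₂) γ δ → left s (join s γ δ) ≡ γ
left-join [] γ δ = refl
left-join (lft s) (x , γ) δ = cong (x ,_) (left-join s γ δ)
left-join (rgt s) γ (x , δ) = left-join s γ δ

right-join : ∀ {Γ Γ₁ Γ₂} (s : Spl Γ Γ₁ Γ₂) γ δ → right s (join s γ δ) ≡ δ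
right-join [] γ δ = refl
right-join (lft s) (x , γ) δ = right-join s γ δ
right-join (rgt s) γ (x , δ) = cong (x ,_) (right-join s γ δ)

join-left-right : ∀ {Γ Γ₁ Γ₂} (s : Spl Γ Γ₁ Γ₂) γ → join s (left s γ) (right s γ) ≡ γ
join-left-right [] γ = refl
join-left-right (lft s) (x , γ) = cong (x ,_) (join-left-right s γ)
join-left-right (rgt s) (x , γ) = cong (x ,_) (join-left-right s γ)

swap : ∀ {Γ Γ₁ Γ₂} → Spl Γ Γ₁ Γ₂ → Spl Γ Γ₂ Γ₁
swap [] = []
swap (lft s) = rgt (swap s)
swap (rgt s) = lft (swap s)

left-swap : ∀ {Γ Γ₁ Γ₂} (s : Spl Γ Γ₁ Γ₂) γ → left (swap s) γ ≡ right s γ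
left-swap [] γ = refl
left-swap (lft s) (x , γ) = left-swap s γ
left-swap (rgt s) (x , γ) = cong (x ,_) (left-swap s γ)

right-swap : ∀ {Γ Γ₁ Γ₂} (s : Spl Γ Γ₁ Γ₂) γ → right (swap s) γ ≡ left s γ
right-swap [] γ = refl
right-swap (lft s) (x , γ) = cong (x ,_) (right-swap s γ)
right-swap (rgt s) (x , γ) = right-swap s γ

all-left : ∀ Γ → Spl Γ Γ []
all-left [] = []
all-left (a ∷ Γ) = lft (all-left Γ)

all-right : ∀ Γ → Spl Γ [] Γ
all-right Γ = swap (all-left Γ)

left-all : ∀ Γ γ → left (all-left Γ) γ ≡ γ
left-all [] γ = refl
left-all (a ∷ Γ) (x , γ) = cong (x ,_) (left-all Γ γ)

right-all : ∀ Γ γ → right (all-right Γ) γ ≡ γ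
right-all Γ γ = ≡-trans (right-swap (all-left Γ) γ) (left-all Γ γ)

canon : ∀ Γ Δ → Spl (Γ ++ Δ) Γ Δ
canon [] Δ = all-right Δ
canon (a ∷ Γ) Δ = lft (canon Γ Δ)

record Assocʳ {Γ Γ₁₂ Γ₁ Γ₂ Γ₃} (s : Spl Γ Γ₁₂ Γ₃) (t : Spl Γ₁₂ Γ₁ Γ₂) : Set where
  field
    {mid} : Sequent
    outer : Spl Γ Γ₁ mid
    inner : Spl mid Γ₂ Γ₃
    eq₁ : ∀ γ → left outer γ ≡ left t (left s γ)
    eq₂ : ∀ γ → left inner (right outer γ) ≡ right t (left s γ)
    eq₃ : ∀ γ → right inner (right outer γ) ≡ right s γ

assocʳ : ∀ {Γ Γ₁₂ Γ₁ Γ₂ Γ₃} (s : Spl Γ Γ₁₂ Γ₃) (t : Spl Γ₁₂ Γ₁ Γ₂) → Assocʳ s t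
assocʳ [] [] = record { outer = [] ; inner = [] ; eq₁ = λ _ → refl ; eq₂ = λ _ → refl ; eq₃ = λ _ → refl }
assocʳ (lft s) (lft t) = record
  { outer = lft outer ; inner = inner
  ; eq₁ = λ { (x , γ) → cong (x ,_) (eq₁ γ) } ; eq₂ = λ { (x , γ) → eq₂ γ } ; eq₃ = λ { (x , γ) → eq₃ γ } }
  where open Assocʳ (assocʳ s t)
assocʳ (lft s) (rgt t) = record
  { outer = rgt outer ; inner = lft inner
  ; eq₁ = λ { (x , γ) → eq₁ γ } ; eq₂ = λ { (x , γ) → cong (x ,_) (eq₂ γ) } ; eq₃ = λ { (x , γ) → eq₃ γ } }
  where open Assocʳ (assocʳ s t)
assocʳ (rgt s) t = record
  { outer = rgt outer ; inner = rgt inner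
  ; eq₁ = λ { (x , γ) → eq₁ γ } ; eq₂ = λ { (x , γ) → eq₂ γ } ; eq₃ = λ { (x , γ) → cong (x ,_) (eq₃ γ) } }
  where open Assocʳ (assocʳ s t)

-- An eliminator for splittings with empty left part; it avoids an equation between the sequents
-- that index them.
right-empty : ∀ {Γ Δ} (s : Spl Γ [] Δ) (R : ∀ {Γ} → Spl Γ [] Δ → Set₁) → R (all-right Δ) → R s
right-empty [] R r = r
right-empty (rgt s) R r = right-empty s (λ s → R (rgt s)) r

record Assocˡ {Γ Γ₁ Γ₂₃ Γ₂ Γ₃} (s : Spl Γ Γ₁ Γ₂₃) (t : Spl Γ₂₃ Γ₂ Γ₃) : Set where
  field
    {mid} : Sequent
    outer : Spl Γ mid Γ₃
    inner : Spl mid Γ₁ Γ₂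
    eq₁ : ∀ γ → left inner (left outer γ) ≡ left s γ
    eq₂ : ∀ γ → right inner (left outer γ) ≡ left t (right s γ)
    eq₃ : ∀ γ → right outer γ ≡ right t (right s γ)

assocˡ : ∀ {Γ Γ₁ Γ₂₃ Γ₂ Γ₃} (s : Spl Γ Γ₁ Γ₂₃) (t : Spl Γ₂₃ Γ₂ Γ₃) → Assocˡ s t
assocˡ [] [] = record { outer = [] ; inner = [] ; eq₁ = λ _ → refl ; eq₂ = λ _ → refl ; eq₃ = λ _ → refl }
assocˡ (rgt s) (rgt t) = record
  { outer = rgt outer ; inner = inner
  ; eq₁ = λ { (x , γ) → eq₁ γ } ; eq₂ = λ { (x , γ) → eq₂ γ } ; eq₃ = λ { (x , γ) → cong (x ,_) (eq₃ γ) } }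
  where open Assocˡ (assocˡ s t)
assocˡ (rgt s) (lft t) = record
  { outer = lft outer ; inner = rgt inner
  ; eq₁ = λ { (x , γ) → eq₁ γ } ; eq₂ = λ { (x , γ) → cong (x ,_) (eq₂ γ) } ; eq₃ = λ { (x , γ) → eq₃ γ } }
  where open Assocˡ (assocˡ s t)
assocˡ (lft s) t = record
  { outer = lft outer ; inner = lft inner
  ; eq₁ = λ { (x , γ) → cong (x ,_) (eq₁ γ) } ; eq₂ = λ { (x , γ) → eq₂ γ } ; eq₃ = λ { (x , γ) → eq₃ γ } }
  where open Assocˡ (assocˡ s t)

left-empty : ∀ {Γ Δ} (s : Spl Γ Δ []) (R : ∀ {Γ} → Spl Γ Δ [] → Set) → R (all-left Δ) → R s
left-empty [] R r = r
left-empty (lft s) R r = left-empty s (λ s → R (lft s)) r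

record Selected {a Ω Γ} (s : Spl Ω Γ (a ∷ [])) : Set where
  field
    sel : Sel a Ω Γ
    get-sel : ∀ ω → get sel ω ≡ proj₁ (right s ω)
    rem-sel : ∀ ω → rem sel ω ≡ left s ω
    right-ins : ∀ x δ → right s (ins sel x δ) ≡ (x , tt)
    left-ins : ∀ x δ → left s (ins sel x δ) ≡ δ

selected : ∀ {a Ω Γ} (s : Spl Ω Γ (a ∷ [])) → Selected s
selected {Γ = Γ} (rgt s) = left-empty s (λ s → Selected (rgt s)) record
  { sel = here ; get-sel = λ _ → refl ; rem-sel = λ { (x , γ) → ≡-sym (left-all Γ γ) }
  ; right-ins = λ _ _ → refl ; left-ins = λ _ δ → left-all Γ δ }
selected (lft s) = record
  { sel = there sel ; get-sel = λ { (y , ω) → get-sel ω } ; rem-sel = λ { (y , ω) → cong (y ,_) (rem-sel ω) }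
  ; right-ins = λ { x (y , δ) → right-ins x δ } ; left-ins = λ { x (y , δ) → cong (y ,_) (left-ins x δ) } }
  where open Selected (selected s)

spl-nil : ∀ {Γ Δ} (s : Spl Γ Δ []) → Σ (Γ ≡ Δ) λ e → ∀ γ → left s γ ≡ subst W e γ
spl-nil s = left-empty s (λ {Γ} s → Σ (Γ ≡ _) λ e → ∀ γ → left s γ ≡ subst W e γ) (refl , left-all _)

record Point {a Θ Δ Δ₁ Δ₂} (s : Sel a Θ Δ) (q : Spl Δ Δ₁ Δ₂) (p : web a) (θ₁ : W Δ₁) (θ₂ : W Δ₂) : Set where
  field
    point : W Θ
    at-sel : get s point ≡ p
    at-left : left q (rem s point) ≡ θ₁
    at-right : right q (rem s point) ≡ θ₂

mkPoint : ∀ {a Θ Δ Δ₁ Δ₂} (s : Sel a Θ Δ) (q : Spl Δ Δ₁ Δ₂) p θ₁ θ₂ → Point s q p θ₁ θ₂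
mkPoint s q p θ₁ θ₂ = record
  { point = ins s p (join q θ₁ θ₂)
  ; at-sel = get-ins s _ _
  ; at-left = ≡-trans (cong (left q) (rem-ins s _ _)) (left-join q θ₁ θ₂)
  ; at-right = ≡-trans (cong (right q) (rem-ins s _ _)) (right-join q θ₁ θ₂) }

-- Relational phase semantics

-- The unit laws give a vanishing unit the label of the leftmost remaining leaf of its neighbour. A
-- free label would break injectivity on coherent points (`Clique`), and a fixed label would break
-- `Uniform`.
lab : ∀ k → wk k → Bool
lab (lit n) x = x
lab unit x = x
lab zero x = x
lab (tens (_ , k) _) (p , _) = lab k p
lab (plus (_ , k) _) (inj₁ p) = lab k p
lab (plus _ (_ , l)) (inj₂ q) = lab l q

El : Set → Sequent → Set₁
El X Γ = Ix → X → W Γ → Set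

Fact : Set → Set₂
Fact X = (Γ : Sequent) → El X Γ → Set₁

cut : ∀ {X Ω Γ Δ} → Spl Ω Γ Δ → El X Γ → El X Δ → Ix → W Ω → Set
cut s u x i ω = Σ _ λ a → u i a (left s ω) × x i a (right s ω)

cut-swap : ∀ {X Ω Γ Δ} (s : Spl Ω Γ Δ) {u : El X Γ} {x : El X Δ} → cut (swap s) x u ≐ cut s u x
cut-swap s i ω rewrite left-swap s ω | right-swap s ω = (λ { (a , x , u) → a , u , x }) , (λ { (a , u , x) → a , x , u })

pair : ∀ {X Y Γ Γ₁ Γ₂} → Spl Γ Γ₁ Γ₂ → El X Γ₁ → El Y Γ₂ → El (X × Y) Γ
pair t u v i (p , q) γ = u i p (left t γ) × v i q (right t γ)

inl : ∀ {X Y Γ} → El X Γ → El (X ⊎ Y) Γ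
inl u i (inj₁ p) γ = u i p γ
inl u i (inj₂ _) γ = ⊥

inr : ∀ {X Y Γ} → El Y Γ → El (X ⊎ Y) Γ
inr u i (inj₁ _) γ = ⊥
inr u i (inj₂ q) γ = u i q γ

-- All labels of `𝟏` are realised at once, as in the rule `uni`.
data OneGen : Fact Bool where
  one : OneGen [] (λ _ _ _ → ⊤)

Fam : Signed → Signed → Set₁
Fam A B = Ix → web A → web B → Set

con : ∀ {I X Y : Set} → (X → Y → Set) → I → X → Y → Set
con R i = R

infixl 5 _⨾_
_⨾_ : ∀ {I X Y Z : Set} → (I → X → Y → Set) → (I → Y → Z → Set) → I → X → Z → Set
(R ⨾ S) i a c = Σ _ λ b → R i a b × S i b c

_ᵀ : ∀ {I X Y : Set} → (I → X → Y → Set) → I → Y → X → Set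
(R ᵀ) i b a = R i a b

_≗ᶠ_ : ∀ {X Y : Set} → (Ix → X → Y → Set) → (Ix → X → Y → Set) → Set
R ≗ᶠ S = ∀ i a b → (R i a b → S i a b) × (S i a b → R i a b)

_⊠_ : ∀ {I X Y X' Y' : Set} → (I → X → Y → Set) → (I → X' → Y' → Set) → I → X × X' → Y × Y' → Set
(R ⊠ S) i (a , b) (a' , b') = R i a a' × S i b b'

gr : ∀ {I X Y : Set} → (X → Y) → I → X → Y → Set
gr f i x y = f x ≡ y

assocᶠ : ∀ {X Y Z : Set} → (X × Y) × Z → X × (Y × Z)
assocᶠ ((x , y) , z) = x , y , z

unassocᶠ : ∀ {X Y Z : Set} → X × (Y × Z) → (X × Y) × Z
unassocᶠ (x , y , z) = (x , y) , z

swapᶠ : ∀ {X Y : Set} → X × Y → Y × X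
swapᶠ (x , y) = y , x

infixr 4 _⊸ˢ_
_⊗ˢ_ _⊸ˢ_ _&ˢ_ : Signed → Signed → Signed
A ⊗ˢ B = ⊕ , tens A B
A ⊸ˢ B = ⊖ , tens A (dual B)
A &ˢ B = ⊖ , plus (dual A) (dual B)

𝟏ˢ ⊥ˢ ⊤ˢ : Signed
𝟏ˢ = ⊕ , unit
⊥ˢ = ⊖ , unit
⊤ˢ = ⊖ , zero

infixr 6 _·_
_·_ : ∀ {X Y Δ} → (Ix → X → Y → Set) → El Y Δ → El X Δ
(R · y) i a δ = Σ _ λ b → R i a b × y i b δ

infixl 6 _∙_
_∙_ : ∀ {X Y Γ} → El X Γ → (Ix → X → Y → Set) → El Y Γ
(u ∙ R) i b γ = Σ _ λ a → u i a γ × R i a b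

lam⇒ : ∀ A → Ix → Bool × web A → web A → Set
lam⇒ A i (j , a) a' = a ≡ a' × j ≡ lab (Signed.skel A) a

lam⇐ : ∀ A → Ix → web A → Bool × web A → Set
lam⇐ A i a (_ , a') = a ≡ a'

evalʳ : ∀ {I X Y : Set} → I → (X × Y) × X → Y → Set
evalʳ i ((a , b) , a') b' = a ≡ a' × b ≡ b'

curʳ : ∀ {I X Y Z : Set} → (I → X × Y → Z → Set) → I → X → Y × Z → Set
curʳ R i a (b , c) = R i (a , b) c

π₁ʳ : ∀ {I X Y : Set} → I → X ⊎ Y → X → Set
π₁ʳ i c a = c ≡ inj₁ a

π₂ʳ : ∀ {I X Y : Set} → I → X ⊎ Y → Y → Set
π₂ʳ i c b = c ≡ inj₂ b

⟨_,_⟩ʳ : ∀ {I X Y Z : Set} → (I → Z → X → Set) → (I → Z → Y → Set) → I → Z → X ⊎ Y → Set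
⟨ R , S ⟩ʳ i c (inj₁ a) = R i c a
⟨ R , S ⟩ʳ i c (inj₂ b) = S i c b

_⊞_ : ∀ {I X Y X' Y' : Set} → (I → X → Y → Set) → (I → X' → Y' → Set) → I → X ⊎ X' → Y ⊎ Y' → Set
(R ⊞ S) i (inj₁ a) (inj₁ b) = R i a b
(R ⊞ S) i (inj₁ a) (inj₂ b) = ⊥
(R ⊞ S) i (inj₂ a) (inj₁ b) = ⊥
(R ⊞ S) i (inj₂ a) (inj₂ b) = S i a b

dualizeʳ : ∀ A → Ix → (web A × Bool) × Bool → web A → Set
dualizeʳ A i ((a , j) , j') a' = a ≡ a' × j ≡ lab (Signed.skel A) a

rho⇒ : ∀ A → Ix → web A × Bool → web A → Set
rho⇒ A i (a , j) a' = a ≡ a' × j ≡ lab (Signed.skel A) a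

rho⇐ : ∀ A → Ix → web A → web A × Bool → Set
rho⇐ A i a (a' , _) = a ≡ a'

-- The pole is a parameter because the model is used twice: with cut-free proofs, and with nonempty
-- relations. Each morphism below is thereby shown to be realised and to be total by the same
-- argument.
module Phase
  (pole : (Γ : Sequent) → (Ix → W Γ → Set) → Set₁)
  (pole-resp : ∀ {Γ} {R S : Ix → W Γ → Set} → R ≐ S → pole Γ R → pole Γ S)
  (LitGen : ℕ → Fact Bool) (ZeroGen : Fact Bool) where

  record Perp {X Ω Γ Δ} (s : Spl Ω Γ Δ) (u : El X Γ) (x : El X Δ) : Set₁ where
    constructor perp
    field holds : pole Ω (cut s u x)
  open Perp public

  by : ∀ {X Y Ω Γ Δ Γ' Δ'} {s : Spl Ω Γ Δ} {u : El X Γ} {x : El X Δ} {s' : Spl Ω Γ' Δ'} {v : El Y Γ'} {y : El Y Δ'} →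
    cut s u x ≐ cut s' v y → Perp s u x → Perp s' v y
  by e p = perp (pole-resp e (holds p))

  sym⊥ : ∀ {X Ω Γ Δ} {s : Spl Ω Γ Δ} {u : El X Γ} {x : El X Δ} → Perp (swap s) x u → Perp s u x
  sym⊥ {s = s} {u} {x} p = perp (pole-resp (cut-swap s {u} {x}) (holds p))

  orth : ∀ {X} → Fact X → Fact X
  orth G Δ x = ∀ {Γ u} → G Γ u → ∀ {Ω} (s : Spl Ω Γ Δ) → Perp s u x

  act : ∀ {X} → Sign → Fact X → Fact X
  act ⊖ G = G
  act ⊕ G = orth G

  -- Neg k interprets (⊖ , k).
  Neg : ∀ k → Fact (wk k)
  Neg (lit n) = orth (LitGen n)
  Neg unit = orth OneGen
  Neg zero = orth ZeroGen
  Neg (tens (r , k) (t , l)) Δ x =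
    ∀ {Γ₁ u} → act r (Neg k) Γ₁ u → ∀ {Γ₂ v} → act t (Neg l) Γ₂ v →
    ∀ {Γ} (q : Spl Γ Γ₁ Γ₂) {Ω} (s : Spl Ω Γ Δ) → Perp s (pair q u v) x
  Neg (plus (r , k) (t , l)) Δ x =
    act (flip r) (Neg k) Δ (λ i p → x i (inj₁ p)) × act (flip t) (Neg l) Δ (λ i p → x i (inj₂ p))

  record Val (A : Signed) (Γ : Sequent) (u : El (web A) Γ) : Set₁ where
    constructor val
    field raw : act (Signed.sign A) (Neg (Signed.skel A)) Γ u
  open Val public

  Dual : ∀ {X} → Fact X → (Γ : Sequent) → El X Γ → Set₁
  Dual G Γ u = ∀ {Δ x} → G Δ x → ∀ {Ω} (s : Spl Ω Γ Δ) → Perp s u x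

  flip-orth : ∀ {X} {G : Fact X} {Γ u} → Dual G Γ u → orth G Γ u
  flip-orth h x s = sym⊥ (h x (swap s))

  gen : ∀ {X} {G : Fact X} {Γ u} → G Γ u → orth (orth G) Γ u
  gen g y s = sym⊥ (y g (swap s))

  orth-closed : ∀ {X} {G : Fact X} {Γ u} → Dual (orth (orth G)) Γ u → orth G Γ u
  orth-closed {G = G} h g s = sym⊥ (h (gen {G = G} g) (swap s))

  pairing′ : ∀ r {X} {G : Fact X} {Γ u Δ x} → act r G Γ u → act (flip r) G Δ x → ∀ {Ω} (s : Spl Ω Γ Δ) → Perp s u x
  pairing′ ⊕ u x s = sym⊥ (u x (swap s))
  pairing′ ⊖ u x s = x u s

  -- Facts are closed under biorthogonality. At leaves this holds for every orthogonal; at a ⊗ it is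
  -- tested on pairs, at a ⊕ on the injections `inl` and `inr`, which lie in the dual of the fact
  -- tested.
  Neg-closed : ∀ k {Γ u} → Dual (orth (Neg k)) Γ u → Neg k Γ u
  act-closed : ∀ r k {Γ u} → Dual (act (flip r) (Neg k)) Γ u → act r (Neg k) Γ u

  act-closed ⊕ k h = flip-orth {G = Neg k} h
  act-closed ⊖ k h = Neg-closed k h

  Neg-closed (lit n) h = orth-closed {G = LitGen n} h
  Neg-closed unit h = orth-closed {G = OneGen} h
  Neg-closed zero h = orth-closed {G = ZeroGen} h
  Neg-closed (tens (r , k) (t , l)) h {u = u} U {v = v} V q s =
    sym⊥ (h {x = pair q u v} (λ x s' → sym⊥ (x U V q (swap s'))) (swap s))
  Neg-closed (plus (r , k) (t , l)) {u = u} h =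
      act-closed (flip r) k (λ {Δ} {x} X s → by
        (λ i ω → (λ { (inj₁ p , c , d) → p , c , d ; (inj₂ p , c , ()) }) , (λ { (p , c , d) → inj₁ p , c , d }))
        (h {x = inl x} (λ {Γ'} {y} Y s' → by {v = y} {y = inl x}
          (λ i ω → (λ { (p , c , d) → inj₁ p , c , d }) , (λ { (inj₁ p , c , d) → p , c , d ; (inj₂ p , c , ()) }))
          (pairing′ (flip r) (proj₁ Y) X s')) s))
    , act-closed (flip t) l (λ {Δ} {x} X s → by
        (λ i ω → (λ { (inj₂ p , c , d) → p , c , d ; (inj₁ p , c , ()) }) , (λ { (p , c , d) → inj₂ p , c , d }))
        (h {x = inr x} (λ {Γ'} {y} Y s' → by {v = y} {y = inr x}
          (λ i ω → (λ { (p , c , d) → inj₂ p , c , d }) , (λ { (inj₂ p , c , d) → p , c , d ; (inj₁ p , c , ()) }))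
          (pairing′ (flip t) (proj₂ Y) X s')) s))

  pairing : ∀ {A Γ u Δ x} → Val A Γ u → Val (dual A) Δ x → ∀ {Ω} (s : Spl Ω Γ Δ) → Perp s u x
  pairing {r , k} u x = pairing′ r {G = Neg k} (raw u) (raw x)

  intro : ∀ {A Γ u} → (∀ {Δ x} → Val (dual A) Δ x → ∀ {Ω} (s : Spl Ω Γ Δ) → Perp s u x) → Val A Γ u
  intro {r , k} h = val (act-closed r k (λ x → h (val x)))

  to-dd : ∀ {A Γ u} → Val A Γ u → Val (dual (dual A)) Γ u
  to-dd {⊕ , k} (val u) = val u
  to-dd {⊖ , k} (val u) = val u

  from-dd : ∀ {A Γ u} → Val (dual (dual A)) Γ u → Val A Γ u
  from-dd {⊕ , k} (val u) = val u
  from-dd {⊖ , k} (val u) = val u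

  Val-resp : ∀ {A Γ} {u v : El (web A) Γ} → (∀ i a γ → (u i a γ → v i a γ) × (v i a γ → u i a γ)) → Val A Γ u → Val A Γ v
  Val-resp e U = intro λ X s → by
    (λ i ω → (λ { (a , c , d) → a , proj₁ (e i a _) c , d }) , (λ { (a , c , d) → a , proj₂ (e i a _) c , d }))
    (pairing U X s)

  -- `R` is a matrix. The condition is symmetric in source and target: `push` reads it as a map of
  -- values, `pull` as a map of tests in the opposite direction.
  record Hom (A B : Signed) (R : Fam A B) : Set₁ where
    constructor hom
    field app : ∀ {Γ u} → Val A Γ u → ∀ {Δ y} → Val (dual B) Δ y → ∀ {Ω} (s : Spl Ω Γ Δ) → Perp s u (R · y)
  open Hom public

  Hom-resp : ∀ {A B} {R S : Fam A B} → R ≗ᶠ S → Hom A B R → Hom A B S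
  Hom-resp e h = hom λ U Y s → by
    (λ i ω → (λ { (a , c , b , r , d) → a , c , b , proj₁ (e i a b) r , d })
           , (λ { (a , c , b , r , d) → a , c , b , proj₂ (e i a b) r , d })) (app h U Y s)

  push : ∀ {A B} {R : Fam A B} → Hom A B R → ∀ {Γ u} → Val A Γ u → Val B Γ (u ∙ R)
  push h U = intro λ Y s → by
    (λ i ω → (λ { (a , c , b , r , d) → b , (a , c , r) , d }) , (λ { (b , (a , c , r) , d) → a , c , b , r , d })) (app h U Y s)

  pull : ∀ {A B} {R : Fam A B} → Hom A B R → ∀ {Δ y} → Val (dual B) Δ y → Val (dual A) Δ (R · y)
  pull h Y = intro λ U s → sym⊥ (app h (from-dd U) Y (swap s))

  hom-id : ∀ {A} → Hom A A (con _≡_)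
  hom-id = hom λ U Y s → by
    (λ i ω → (λ { (a , c , d) → a , c , a , refl , d }) , (λ { (a , c , .a , refl , d) → a , c , d })) (pairing U Y s)

  hom-comp : ∀ {A B C} {R : Fam A B} {S : Fam B C} → Hom A B R → Hom B C S → Hom A C (R ⨾ S)
  hom-comp f g = hom λ U Z s → by
    (λ i ω → (λ { (b , (a , u , r) , c , t , z) → a , u , c , (b , r , t) , z })
           , (λ { (a , u , c , (b , r , t) , z) → b , (a , u , r) , c , t , z })) (app g (push f U) Z s)

  hom-dualˡ : ∀ {A B} {R : Fam (dual A) B} → Hom (dual A) B R → Hom (dual B) A (R ᵀ)
  hom-dualˡ h = hom λ Y U s → by
    (λ i ω → (λ { (a , (b , r , y) , u) → b , y , a , r , u }) , (λ { (b , y , a , r , u) → a , (b , r , y) , u }))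
    (sym⊥ (app h U Y (swap s)))

  hom-dual : ∀ {A B} {R : Fam A B} → Hom A B R → Hom (dual B) (dual A) (R ᵀ)
  hom-dual h = hom λ Y U s → by
    (λ i ω → (λ { (a , (b , r , y) , u) → b , y , a , r , u }) , (λ { (b , y , a , r , u) → a , (b , r , y) , u }))
    (sym⊥ (app h (from-dd U) Y (swap s)))

  pairᵛ : ∀ {A B Γ₁ Γ₂ Γ u v} → Val A Γ₁ u → Val B Γ₂ v → (q : Spl Γ Γ₁ Γ₂) → Val (⊕ , tens A B) Γ (pair q u v)
  pairᵛ {u = u} {v} U V q = intro λ {Δ} {x} X s → raw X (raw U) (raw V) q s

  par : ∀ {A B Δ x} → (∀ {Γ₁ u} → Val A Γ₁ u → ∀ {Γ₂ v} → Val B Γ₂ v → ∀ {Γ} (q : Spl Γ Γ₁ Γ₂) {Ω} (s : Spl Ω Γ Δ) →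
    Perp s (pair q u v) x) → Val (⊖ , tens A B) Δ x
  par h = val λ U V q s → h (val U) (val V) q s

  unpar : ∀ {A B Δ x} → Val (⊖ , tens A B) Δ x → ∀ {Γ₁ u} → Val A Γ₁ u → ∀ {Γ₂ v} → Val B Γ₂ v →
    ∀ {Γ} (q : Spl Γ Γ₁ Γ₂) {Ω} (s : Spl Ω Γ Δ) → Perp s (pair q u v) x
  unpar X U V q s = raw X (raw U) (raw V) q s

  tensˡ : ∀ {A B C} {R : Fam (⊕ , tens A B) C} →
    (∀ {Γ₁ u} → Val A Γ₁ u → ∀ {Γ₂ v} → Val B Γ₂ v → ∀ {Γ} (q : Spl Γ Γ₁ Γ₂) {Δ y} → Val (dual C) Δ y →
       ∀ {Ω} (s : Spl Ω Γ Δ) → Perp s (pair q u v) (R · y)) → Hom (⊕ , tens A B) C R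
  tensˡ h = hom λ U Y s → pairing U (par λ A B q s' → h A B q Y s') s

  hom-tens : ∀ {A B A' B'} {R : Fam A A'} {S : Fam B B'} → Hom A A' R → Hom B B' S → Hom (A ⊗ˢ B) (A' ⊗ˢ B') (R ⊠ S)
  hom-tens f g = tensˡ λ U V q Y s → by
    (λ i ω → (λ { (_ , ((a , u , r) , b , v , t) , y) → (a , b) , (u , v) , _ , (r , t) , y })
           , (λ { ((a , b) , (u , v) , _ , (r , t) , y) → _ , ((a , u , r) , b , v , t) , y }))
    (unpar Y (push f U) (push g V) q s)

  hom-σ : ∀ {A B} → Hom (A ⊗ˢ B) (B ⊗ˢ A) (gr swapᶠ)
  hom-σ {A} {B} = tensˡ λ {_} {u} U {_} {v} V q {_} {y} Y s → by (e q s {u} {v} {y}) (unpar Y V U (swap q) s)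
    where
    e : ∀ {Γ Γ₁ Γ₂ Δ Ω} (q : Spl Γ Γ₁ Γ₂) (s : Spl Ω Γ Δ) {u : El (web A) Γ₁} {v : El (web B) Γ₂} {y} →
      cut s (pair (swap q) v u) y ≐ cut s (pair q u v) (gr swapᶠ · y)
    e q s i ω rewrite left-swap q (left s ω) | right-swap q (left s ω) =
      (λ { ((b , a) , (v , u) , y) → (a , b) , (u , v) , _ , refl , y }) , (λ { ((a , b) , (u , v) , _ , refl , y) → _ , (v , u) , y })

  -- The third component `c` and the test `y` are merged into one test `z` on the first two
  -- components; what remains is to rebracket the contexts.
  hom-α : ∀ {A B C} → Hom ((A ⊗ˢ B) ⊗ˢ C) (A ⊗ˢ (B ⊗ˢ C)) (gr assocᶠ)
  hom-α {A} {B} {C} = tensˡ λ {_} {w} X {_} {c} Z q {_} {y} Y s →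
    let module O = Assocʳ (assocʳ s q) in
    by (e₁ s q {w} {c} {y}) (pairing X (par {x = z O.inner c y} λ {_} {u} U {_} {v} V q' s' →
      let module P = Assocʳ (assocʳ s' q')
          module Q = Assocˡ (assocˡ P.inner O.inner)
          module R = Assocˡ (assocˡ P.outer Q.outer)
      in by (e₂ s' q' O.inner {u} {v} {c} {y}) (unpar Y U (pairᵛ V Z Q.inner) R.inner R.outer)) O.outer)
    where
    z : ∀ {mid Γ₃ Δ} → Spl mid Γ₃ Δ → El (web C) Γ₃ → El (web (A ⊗ˢ (B ⊗ˢ C))) Δ → El (web (A ⊗ˢ B)) mid
    z t c y i (a , b) μ = Σ _ λ d → c i d (left t μ) × y i (a , b , d) (right t μ)
    e₁ : ∀ {Ω Γ Δ Γ₁₂ Γ₃} (s : Spl Ω Γ Δ) (q : Spl Γ Γ₁₂ Γ₃) {w : El (web (A ⊗ˢ B)) Γ₁₂} {c : El (web C) Γ₃} {y} →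
      cut (Assocʳ.outer (assocʳ s q)) w (z (Assocʳ.inner (assocʳ s q)) c y) ≐ cut s (pair q w c) (gr assocᶠ · y)
    e₁ s q i ω rewrite Assocʳ.eq₁ (assocʳ s q) ω | Assocʳ.eq₂ (assocʳ s q) ω | Assocʳ.eq₃ (assocʳ s q) ω =
      (λ { (_ , w , d , c , y) → _ , (w , c) , _ , refl , y }) , (λ { (_ , (w , c) , _ , refl , y) → _ , w , _ , c , y })
    e₂ : ∀ {Ω Γ mid Γ₁ Γ₂ Γ₃ Δ} (s' : Spl Ω Γ mid) (q' : Spl Γ Γ₁ Γ₂) (t : Spl mid Γ₃ Δ)
      {u : El (web A) Γ₁} {v : El (web B) Γ₂} {c : El (web C) Γ₃} {y} →
      let module P = Assocʳ (assocʳ s' q')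
          module Q = Assocˡ (assocˡ P.inner t)
          module R = Assocˡ (assocˡ P.outer Q.outer)
      in cut R.outer (pair R.inner u (pair Q.inner v c)) y ≐ cut s' (pair q' u v) (z t c y)
    e₂ s' q' t i ω
      rewrite Assocˡ.eq₁ (assocˡ (Assocʳ.outer (assocʳ s' q')) (Assocˡ.outer (assocˡ (Assocʳ.inner (assocʳ s' q')) t))) ω
            | Assocˡ.eq₂ (assocˡ (Assocʳ.outer (assocʳ s' q')) (Assocˡ.outer (assocˡ (Assocʳ.inner (assocʳ s' q')) t))) ω
            | Assocˡ.eq₃ (assocˡ (Assocʳ.outer (assocʳ s' q')) (Assocˡ.outer (assocˡ (Assocʳ.inner (assocʳ s' q')) t))) ω
            | Assocˡ.eq₁ (assocˡ (Assocʳ.inner (assocʳ s' q')) t) (right (Assocʳ.outer (assocʳ s' q')) ω)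
            | Assocˡ.eq₂ (assocˡ (Assocʳ.inner (assocʳ s' q')) t) (right (Assocʳ.outer (assocʳ s' q')) ω)
            | Assocˡ.eq₃ (assocˡ (Assocʳ.inner (assocʳ s' q')) t) (right (Assocʳ.outer (assocʳ s' q')) ω)
            | Assocʳ.eq₁ (assocʳ s' q') ω | Assocʳ.eq₂ (assocʳ s' q') ω | Assocʳ.eq₃ (assocʳ s' q') ω =
      (λ { ((a , b , d) , (u , v , c) , y) → (a , b) , (u , v) , d , c , y })
      , (λ { ((a , b) , (u , v) , d , c , y) → (a , b , d) , (u , v , c) , y })

  -- Conjugating `hom-α` with symmetries reverses the bracketing, so the contexts are not rearranged
  -- a second time.
  hom-unα : ∀ {A B C} → Hom (A ⊗ˢ (B ⊗ˢ C)) ((A ⊗ˢ B) ⊗ˢ C) (gr unassocᶠ)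
  hom-unα {A} {B} {C} = Hom-resp
    (λ { i (a , b , c) d → (λ { (_ , (_ , (_ , (_ , refl , refl , refl) , refl) , refl , refl) , refl) → refl })
                         , (λ { refl → _ , (_ , (_ , (_ , refl , refl , refl) , refl) , refl , refl) , refl }) })
    (hom-comp (hom-comp (hom-comp (hom-comp hom-σ (hom-tens hom-σ (hom-id {A}))) (hom-α {C} {B} {A})) (hom-tens (hom-id {C}) hom-σ)) hom-σ)

  oneᵛ : Val 𝟏ˢ [] (λ _ _ _ → ⊤)
  oneᵛ = val (gen {G = OneGen} one)

  -- The label of the unit leaf of 𝟏 ⊗ A is invisible: R and Q agree once it is projected away.
  hom-unit : ∀ {A B} {R : Fam (𝟏ˢ ⊗ˢ A) B} {Q : Fam A B} →
    (∀ i a b → (Q i a b → Σ _ λ j → R i (j , a) b) × (∀ j → R i (j , a) b → Q i a b)) → Hom A B Q → Hom (𝟏ˢ ⊗ˢ A) B R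
  hom-unit {A} {B} {R} {Q} h f = tensˡ λ {_} {w} X {_} {u} U q {_} {y} Y s →
    let module O = Assocʳ (assocʳ s q) in
    by (e₁ s q {w} {u} {y}) (pairing X (val λ { one s' → right-empty s' (λ s' → Perp s' (λ _ _ _ → ⊤) (z O.inner u y))
      (perp (pole-resp (e₂ O.inner {u} {y}) (holds (app f U Y O.inner)))) }) O.outer)
    where
    z : ∀ {mid Γ Δ} → Spl mid Γ Δ → El (web A) Γ → El (web B) Δ → El Bool mid
    z t u y i j μ = Σ _ λ a → u i a (left t μ) × Σ _ λ b → R i (j , a) b × y i b (right t μ)
    e₁ : ∀ {Ω Γ Δ Γ₁ Γ₂} (s : Spl Ω Γ Δ) (q : Spl Γ Γ₁ Γ₂) {w : El Bool Γ₁} {u : El (web A) Γ₂} {y} →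
      cut (Assocʳ.outer (assocʳ s q)) w (z (Assocʳ.inner (assocʳ s q)) u y) ≐ cut s (pair q w u) (R · y)
    e₁ s q i ω rewrite Assocʳ.eq₁ (assocʳ s q) ω | Assocʳ.eq₂ (assocʳ s q) ω | Assocʳ.eq₃ (assocʳ s q) ω =
      (λ { (j , w , a , u , b , r , y) → (j , a) , (w , u) , b , r , y }) , (λ { ((j , a) , (w , u) , b , r , y) → j , w , a , u , b , r , y })
    e₂ : ∀ {mid Γ Δ} (t : Spl mid Γ Δ) {u : El (web A) Γ} {y : El (web B) Δ} →
      cut t u (Q · y) ≐ cut (all-right mid) (λ _ _ _ → ⊤) (z t u y)
    e₂ {mid} t i ω rewrite right-all mid ω =
      (λ { (a , u , b , r , y) → let (j , r') = proj₁ (h i a b) r in j , tt , a , u , b , r' , y })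
      , (λ { (j , _ , a , u , b , r , y) → a , u , b , proj₂ (h i a b) j r , y })

  hom-λ⇒ : ∀ {A} → Hom (𝟏ˢ ⊗ˢ A) A (lam⇒ A)
  hom-λ⇒ {A} = hom-unit {Q = con _≡_} (λ i a b → (λ { refl → _ , refl , refl }) , (λ { j (refl , _) → refl })) (hom-id {A})

  hom-λ⇐ : ∀ {A} → Hom A (𝟏ˢ ⊗ˢ A) (lam⇐ A)
  hom-λ⇐ {A} = hom λ {Γ} {u} U {_} {y} Y s → by (e s {u} {y}) (unpar Y oneᵛ U (all-right Γ) s)
    where
    e : ∀ {Ω Γ Δ} (s : Spl Ω Γ Δ) {u : El (web A) Γ} {y} →
      cut s (pair (all-right Γ) (λ _ _ _ → ⊤) u) y ≐ cut s u (lam⇐ A · y)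
    e {Γ = Γ} s i ω rewrite right-all Γ (left s ω) =
      (λ { ((j , a) , (_ , u) , y) → a , u , (j , a) , refl , y }) , (λ { (a , u , (j , .a) , refl , y) → (j , a) , (_ , u) , y })

  by-push : ∀ {A B} {R : Fam A B} → (∀ {Γ u} → Val A Γ u → Val B Γ (u ∙ R)) → Hom A B R
  by-push f = hom λ U Y s → by
    (λ i ω → (λ { (b , (a , u , r) , y) → a , u , b , r , y }) , (λ { (a , u , b , r , y) → b , (a , u , r) , y }))
    (pairing (f U) Y s)

  hom-cur : ∀ {A B C} {R : Fam (C ⊗ˢ A) B} → Hom (C ⊗ˢ A) B R → Hom C (A ⊸ˢ B) (curʳ R)
  hom-cur {A} {B} {C} {R} f = by-push {B = A ⊸ˢ B} λ {_} {u} U → par λ {_} {v} V {_} {y} Y q s →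
    let module O = Assocˡ (assocˡ (swap s) q)
    in by (e s q {u} {v} {y}) (app f (pairᵛ U V O.inner) Y O.outer)
    where
    e : ∀ {Ω Γ Γ' Γ₁ Γ₂} (s : Spl Ω Γ' Γ) (q : Spl Γ' Γ₁ Γ₂) {u : El (web C) Γ} {v : El (web A) Γ₁} {y : El (web B) Γ₂} →
      cut (Assocˡ.outer (assocˡ (swap s) q)) (pair (Assocˡ.inner (assocˡ (swap s) q)) u v) (R · y)
        ≐ cut s (pair q v y) (u ∙ curʳ R)
    e s q i ω rewrite Assocˡ.eq₁ (assocˡ (swap s) q) ω | Assocˡ.eq₂ (assocˡ (swap s) q) ω | Assocˡ.eq₃ (assocˡ (swap s) q) ω
                    | left-swap s ω | right-swap s ω =
      (λ { ((c , a) , (u , v) , b , r , y) → (a , b) , (v , y) , c , u , r })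
      , (λ { ((a , b) , (v , y) , c , u , r) → (c , a) , (u , v) , b , r , y })

  hom-eval : ∀ {A B} → Hom ((A ⊸ˢ B) ⊗ˢ A) B evalʳ
  hom-eval {A} {B} = tensˡ λ {_} {f} F {_} {v} V q {_} {y} Y s →
    let module O = Assocʳ (assocʳ s q)
    in by (e s q {f} {v} {y}) (unpar F V Y O.inner (swap O.outer))
    where
    e : ∀ {Ω Γ Δ Γ₁ Γ₂} (s : Spl Ω Γ Δ) (q : Spl Γ Γ₁ Γ₂) {f : El (web A × web B) Γ₁} {v : El (web A) Γ₂} {y : El (web B) Δ} →
      cut (swap (Assocʳ.outer (assocʳ s q))) (pair (Assocʳ.inner (assocʳ s q)) v y) f ≐ cut s (pair q f v) (evalʳ · y)
    e s q i ω rewrite left-swap (Assocʳ.outer (assocʳ s q)) ω | right-swap (Assocʳ.outer (assocʳ s q)) ω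
                    | Assocʳ.eq₁ (assocʳ s q) ω | Assocʳ.eq₂ (assocʳ s q) ω | Assocʳ.eq₃ (assocʳ s q) ω =
      (λ { ((a , b) , (v , y) , f) → ((a , b) , a) , (f , v) , b , (refl , refl) , y })
      , (λ { (((a , b) , .a) , (f , v) , .b , (refl , refl) , y) → (a , b) , (v , y) , f })

  hom-π₁ : ∀ {A B} → Hom (A &ˢ B) A π₁ʳ
  hom-π₁ = by-push λ { (val (a , b)) → Val-resp
    (λ i a γ → (λ u → inj₁ a , u , refl) , (λ { (_ , u , refl) → u })) (from-dd (val a)) }

  hom-π₂ : ∀ {A B} → Hom (A &ˢ B) B π₂ʳ
  hom-π₂ = by-push λ { (val (a , b)) → Val-resp
    (λ i a γ → (λ u → inj₂ a , u , refl) , (λ { (_ , u , refl) → u })) (from-dd (val b)) }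

  hom-⟨⟩ : ∀ {A B C} {R : Fam C A} {S : Fam C B} → Hom C A R → Hom C B S → Hom C (A &ˢ B) ⟨ R , S ⟩ʳ
  hom-⟨⟩ {A} {B} f g = by-push {B = A &ˢ B} λ U → val (raw (to-dd (push f U)) , raw (to-dd (push g U)))

  hom-plus : ∀ {A B A' B'} {R : Fam A A'} {S : Fam B B'} → Hom A A' R → Hom B B' S →
    Hom (⊕ , plus A B) (⊕ , plus A' B') (R ⊞ S)
  hom-plus {A} {B} {A'} {B'} {R} {S} f g = hom λ {_} {u} U {Δ} {y} Y s → pairing U (val
    ( raw (Val-resp (λ i a δ → (λ { (b , r , y) → inj₁ b , r , y }) , (λ { (inj₁ b , r , y) → b , r , y ; (inj₂ b , () , y) }))
        (pull f (val (proj₁ (raw Y)))))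
    , raw (Val-resp (λ i a δ → (λ { (b , r , y) → inj₂ b , r , y }) , (λ { (inj₂ b , r , y) → b , r , y ; (inj₁ b , () , y) }))
        (pull g (val (proj₂ (raw Y))))))) s

  hom-unitʳ : ∀ {A B} {R : Fam (A ⊗ˢ 𝟏ˢ) B} {Q : Fam A B} →
    (∀ i a b → (Q i a b → Σ _ λ j → R i (a , j) b) × (∀ j → R i (a , j) b → Q i a b)) → Hom A B Q → Hom (A ⊗ˢ 𝟏ˢ) B R
  hom-unitʳ {R = R} h f = Hom-resp
    (λ { i (a , j) b → (λ { (_ , refl , r) → r }) , (λ r → _ , refl , r) })
    (hom-comp hom-σ (hom-unit {R = λ { i (j , a) b → R i (a , j) b }} h f))

  hom-ρ⇒ : ∀ {A} → Hom (A ⊗ˢ 𝟏ˢ) A (rho⇒ A)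
  hom-ρ⇒ {A} = hom-unitʳ {Q = con _≡_} (λ i a b → (λ { refl → _ , refl , refl }) , (λ { j (refl , _) → refl })) hom-id

  hom-ρ⇐ : ∀ {A} → Hom A (A ⊗ˢ 𝟏ˢ) (rho⇐ A)
  hom-ρ⇐ {A} = Hom-resp (λ { i a (a' , j) → (λ { (_ , refl , refl) → refl }) , (λ { refl → (j , a) , refl , refl }) })
    (hom-comp hom-λ⇐ hom-σ)

  -- `A ⊸ˢ ⊥ˢ` is the dual of `A ⊗ˢ 𝟏ˢ`, so the double negation is `A` with two units added: one is
  -- removed under a dual by `hom-ρ⇒`, the other is added by `hom-ρ⇐` before transposing.
  hom-dualize : ∀ {A} → Hom ((A ⊸ˢ ⊥ˢ) ⊸ˢ ⊥ˢ) A (dualizeʳ A)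
  hom-dualize {A} = Hom-resp
    (λ { i ((a , j) , j') a' → (λ { ((_ , _) , (refl , r) , refl) → refl , r }) , (λ { (refl , r) → (a , j) , (refl , r) , refl }) })
    (hom-dualˡ {A = A} {B = (A ⊸ˢ ⊥ˢ) ⊗ˢ 𝟏ˢ} (hom-comp (hom-dual (hom-ρ⇒ {A})) (hom-ρ⇐ {A ⊸ˢ ⊥ˢ})))

-- Cut-free proofs and cut elimination

idE : ∀ {X : Set} → Ix → X → X × ⊤ → Set
idE i x (y , _) = x ≡ y

either : ∀ {X Y : Set} → (X → Set) → (Y → Set) → X ⊎ Y → Set
either P Q (inj₁ x) = P x
either P Q (inj₂ y) = Q y

module _ {a b : Signed} where
  tenᴿ : ∀ {Γ Δ Δ₁ Δ₂} → Sel (⊕ , tens a b) Γ Δ → Spl Δ Δ₁ Δ₂ → (Ix → W (a ∷ Δ₁) → Set) → (Ix → W (b ∷ Δ₂) → Set) → Ix → W Γ → Set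
  tenᴿ s q S T i γ = S i (proj₁ (get s γ) , left q (rem s γ)) × T i (proj₂ (get s γ) , right q (rem s γ))

  parᴿ : ∀ {Γ Δ} → Sel (⊖ , tens a b) Γ Δ → (Ix → W (dual a ∷ dual b ∷ Δ) → Set) → Ix → W Γ → Set
  parᴿ s S i γ = S i (proj₁ (get s γ) , proj₂ (get s γ) , rem s γ)

  plusᴿ₁ : ∀ {Γ Δ} → Sel (⊕ , plus a b) Γ Δ → (Ix → W (a ∷ Δ) → Set) → Ix → W Γ → Set
  plusᴿ₁ s S i γ = either (λ p → S i (p , rem s γ)) (λ _ → ⊥) (get s γ)

  plusᴿ₂ : ∀ {Γ Δ} → Sel (⊕ , plus a b) Γ Δ → (Ix → W (b ∷ Δ) → Set) → Ix → W Γ → Set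
  plusᴿ₂ s S i γ = either (λ _ → ⊥) (λ p → S i (p , rem s γ)) (get s γ)

  withᴿ : ∀ {Γ Δ} → Sel (⊖ , plus a b) Γ Δ → (Ix → W (dual a ∷ Δ) → Set) → (Ix → W (dual b ∷ Δ) → Set) → Ix → W Γ → Set
  withᴿ s S T i γ = either (λ p → S i (p , rem s γ)) (λ p → T i (p , rem s γ)) (get s γ)

axᴿ : Ix → Bool × Bool × ⊤ → Set
axᴿ i (x , y , _) = x ≡ y

-- Cut-free proofs of MALL, each carrying a pair of relations it realises.  A ⊤-rule realises every
-- relation, and a ⊥-rule any choice of labels above a relation realised by its premise.
data K : (Γ : Sequent) → (Ix → W Γ → Set) → Set₁ where
  ax₁ : ∀ {n R} → R ≐ axᴿ → K ((⊖ , lit n) ∷ (⊕ , lit n) ∷ []) R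
  ax₂ : ∀ {n R} → R ≐ axᴿ → K ((⊕ , lit n) ∷ (⊖ , lit n) ∷ []) R
  ten : ∀ {a b Γ Δ Δ₁ Δ₂ R S T} (s : Sel (⊕ , tens a b) Γ Δ) (q : Spl Δ Δ₁ Δ₂) →
        K (a ∷ Δ₁) S → K (b ∷ Δ₂) T → R ≐ tenᴿ s q S T → K Γ R
  prl : ∀ {a b Γ Δ R S} (s : Sel (⊖ , tens a b) Γ Δ) → K (dual a ∷ dual b ∷ Δ) S → R ≐ parᴿ s S → K Γ R
  pl₁ : ∀ {a b Γ Δ R S} (s : Sel (⊕ , plus a b) Γ Δ) → K (a ∷ Δ) S → R ≐ plusᴿ₁ s S → K Γ R
  pl₂ : ∀ {a b Γ Δ R S} (s : Sel (⊕ , plus a b) Γ Δ) → K (b ∷ Δ) S → R ≐ plusᴿ₂ s S → K Γ R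
  wth : ∀ {a b Γ Δ R S T} (s : Sel (⊖ , plus a b) Γ Δ) → K (dual a ∷ Δ) S → K (dual b ∷ Δ) T → R ≐ withᴿ s S T → K Γ R
  uni : ∀ {R} → R ≐ (λ _ _ → ⊤) → K ((⊕ , unit) ∷ []) R
  bot : ∀ {Γ Δ R} (s : Sel (⊖ , unit) Γ Δ) → K Δ (λ i δ → Σ Bool λ j → R i (ins s j δ)) → K Γ R
  top : ∀ {Γ Δ R} → Sel (⊖ , zero) Γ Δ → K Γ R

K-resp : ∀ {Γ} {R S : Ix → W Γ → Set} → R ≐ S → K Γ R → K Γ S
K-resp e (ax₁ d) = ax₁ (≐-trans (≐-sym e) d)
K-resp e (ax₂ d) = ax₂ (≐-trans (≐-sym e) d)
K-resp e (ten s q k l d) = ten s q k l (≐-trans (≐-sym e) d)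
K-resp e (prl s k d) = prl s k (≐-trans (≐-sym e) d)
K-resp e (pl₁ s k d) = pl₁ s k (≐-trans (≐-sym e) d)
K-resp e (pl₂ s k d) = pl₂ s k (≐-trans (≐-sym e) d)
K-resp e (wth s k l d) = wth s k l (≐-trans (≐-sym e) d)
K-resp e (uni d) = uni (≐-trans (≐-sym e) d)
K-resp e (bot s k) = bot s (K-resp (λ i δ → (λ { (j , r) → j , proj₁ (e i _) r }) , (λ { (j , r) → j , proj₂ (e i _) r })) k)
K-resp e (top s) = top s

-- The two relations of a pair are realised independently; they may be exchanged, or one of them
-- duplicated.
K-reindex : ∀ {Γ R} (f : Ix → Ix) → K Γ R → K Γ (λ i → R (f i))
K-reindex f (ax₁ d) = ax₁ (λ i → d (f i))
K-reindex f (ax₂ d) = ax₂ (λ i → d (f i))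
K-reindex f (ten s q k l d) = ten s q (K-reindex f k) (K-reindex f l) (λ i → d (f i))
K-reindex f (prl s k d) = prl s (K-reindex f k) (λ i → d (f i))
K-reindex f (pl₁ s k d) = pl₁ s (K-reindex f k) (λ i → d (f i))
K-reindex f (pl₂ s k d) = pl₂ s (K-reindex f k) (λ i → d (f i))
K-reindex f (wth s k l d) = wth s (K-reindex f k) (K-reindex f l) (λ i → d (f i))
K-reindex f (uni d) = uni (λ i → d (f i))
K-reindex f (bot s k) = bot s (K-reindex f k)
K-reindex f (top s) = top s

-- The usual interpretation of an atom in a phase-semantic completeness proof: its fact is generated
-- by the sequent consisting of its dual.
data LitGen (n : ℕ) : Fact Bool where
  litG : LitGen n ((⊖ , lit n) ∷ []) idE

-- With no generator for 0, every element belongs to the fact of ⊤, which matches the rule `top`.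
NoGen : Fact Bool
NoGen _ _ = Lift _ ⊥

module P = Phase K K-resp LitGen NoGen

module _ where
  open P

  -- Okada's lemma: the sequent `dual A` itself, with the identity relation, belongs to the fact of
  -- `A`. Each case ends with the rule of the connective, its premises being supplied by `K-of`.
  idᵛ⁺ : ∀ k → Val (⊕ , k) ((⊖ , k) ∷ []) idE
  idᵛ⁻ : ∀ k → Val (⊖ , k) ((⊕ , k) ∷ []) idE

  idᵛ : ∀ a → Val a (dual a ∷ []) idE
  idᵛ (⊕ , k) = idᵛ⁺ k
  idᵛ (⊖ , k) = idᵛ⁻ k

  idᵛᵈ : ∀ a → Val (dual a) (a ∷ []) idE
  idᵛᵈ (⊕ , k) = idᵛ⁻ k
  idᵛᵈ (⊖ , k) = idᵛ⁺ k

  -- Composing with the identity element changes nothing, and orthogonality to it is a cut-free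
  -- proof.
  K-of : ∀ {A Γ u} → Val A Γ u → Val (dual A) (A ∷ []) idE → K (A ∷ Γ) (λ i aγ → u i (proj₁ aγ) (proj₂ aγ))
  K-of {A} {Γ} {u} U I = K-resp e (holds (pairing U I (rgt (all-left Γ))))
    where
    e : cut (rgt {A} (all-left Γ)) u idE ≐ (λ i aγ → u i (proj₁ aγ) (proj₂ aγ))
    e i (a , γ) rewrite left-all Γ γ = (λ { (a , u , refl) → u }) , (λ u → a , u , refl)

  idᵛ⁺ (lit n) = val λ X s → sym⊥ (X litG (swap s))
  idᵛ⁺ unit = val λ {Γ} {x} X {Ω} s → let open Selected (selected s) in
    perp (bot sel (K-resp (λ i δ →
        (λ { (j , _ , r) → j , j , subst (x i j) (≡-trans (right-all Γ δ) (≡-sym (left-ins j δ))) r , cong proj₁ (≡-sym (right-ins j δ)) })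
      , (λ { (j , a , r , _) → a , tt , subst (x i a) (≡-trans (left-ins j δ) (≡-sym (right-all Γ δ))) r }))
      (holds (X one (all-right Γ)))))
  idᵛ⁺ zero = val λ X s → perp (top (Selected.sel (selected s)))
  idᵛ⁺ (tens a b) = val λ {Γ} {x} X {Ω} s → let open Selected (selected s) in
    perp (prl sel (holds (X (raw (idᵛ a)) (raw (idᵛ b)) (lft {dual a} (rgt {dual b} [])) (lft {dual a} (lft {dual b} (all-right Γ))))) (e s {x}))
    where
    e : ∀ {Ω Γ} (s : Spl Ω Γ ((⊖ , tens a b) ∷ [])) {x : El (web a × web b) Γ} →
      cut s x idE ≐ parᴿ (Selected.sel (selected s)) (cut (lft {dual a} (lft {dual b} (all-right Γ))) (pair {Γ₁ = dual a ∷ []} {dual b ∷ []} (lft (rgt [])) idE idE) x)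
    e {Γ = Γ} s i ω rewrite Selected.get-sel (selected s) ω | Selected.rem-sel (selected s) ω | right-all Γ (left s ω) =
      (λ { (_ , r , refl) → _ , (refl , refl) , r }) , (λ { (_ , (refl , refl) , r) → _ , r , refl })
  idᵛ⁺ (plus a b) = val λ {_} {x} XY s → let open Selected (selected s) in
    perp (wth sel (K-of {dual a} (val (proj₁ XY)) (to-dd (idᵛ a))) (K-of {dual b} (val (proj₂ XY)) (to-dd (idᵛ b))) (e s {x}))
    where
    e : ∀ {Ω Γ} (s : Spl Ω Γ ((⊖ , plus a b) ∷ [])) {x : El (web a ⊎ web b) Γ} →
      cut s x idE ≐ withᴿ (Selected.sel (selected s)) (λ i aγ → x i (inj₁ (proj₁ aγ)) (proj₂ aγ)) (λ i aγ → x i (inj₂ (proj₁ aγ)) (proj₂ aγ))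
    e s i ω rewrite Selected.get-sel (selected s) ω | Selected.rem-sel (selected s) ω with proj₁ (right s ω)
    ... | inj₁ p = (λ { (_ , r , refl) → r }) , (λ r → _ , r , refl)
    ... | inj₂ p = (λ { (_ , r , refl) → r }) , (λ r → _ , r , refl)
  idᵛ⁻ (lit n) = val λ
    { litG (lft (rgt [])) → perp (ax₁ (λ i _ → (λ { (_ , refl , refl) → refl }) , (λ { refl → _ , refl , refl })))
    ; litG (rgt (lft [])) → perp (ax₂ (λ i _ → (λ { (_ , refl , refl) → refl }) , (λ { refl → _ , refl , refl }))) }
  idᵛ⁻ unit = val λ { one (rgt []) → perp (uni (λ i _ → _ , (λ _ → _ , _ , refl))) }
  idᵛ⁻ zero = val λ { (lift ()) }
  idᵛ⁻ (tens a b) = val λ {_} {u} U {_} {v} V q s → let open Selected (selected s) in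
    perp (ten sel q (K-of {a} (val U) (idᵛᵈ a)) (K-of {b} (val V) (idᵛᵈ b)) (e q s {u} {v}))
    where
    e : ∀ {Ω Γ Γ₁ Γ₂} (q : Spl Γ Γ₁ Γ₂) (s : Spl Ω Γ ((⊕ , tens a b) ∷ [])) {u : El (web a) Γ₁} {v : El (web b) Γ₂} →
      cut s (pair q u v) idE ≐ tenᴿ (Selected.sel (selected s)) q (λ i aγ → u i (proj₁ aγ) (proj₂ aγ)) (λ i aγ → v i (proj₁ aγ) (proj₂ aγ))
    e q s i ω rewrite Selected.get-sel (selected s) ω | Selected.rem-sel (selected s) ω =
      (λ { (_ , r , refl) → r }) , (λ r → _ , r , refl)
  idᵛ⁻ (plus a b) = val
    ( raw (intro {dual a} λ {_} {y} Y s → let open Selected (selected (swap s)) in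
        perp (pl₁ sel (K-of (from-dd Y) (idᵛᵈ a)) (e₁ s {y})))
    , raw (intro {dual b} λ {_} {y} Y s → let open Selected (selected (swap s)) in
        perp (pl₂ sel (K-of (from-dd Y) (idᵛᵈ b)) (e₂ s {y}))))
    where
    e₁ : ∀ {Ω Γ} (s : Spl Ω ((⊕ , plus a b) ∷ []) Γ) {y : El (web a) Γ} →
      cut s (λ i p → idE i (inj₁ p)) y ≐ plusᴿ₁ (Selected.sel (selected (swap s))) (λ i aγ → y i (proj₁ aγ) (proj₂ aγ))
    e₁ s i ω rewrite Selected.get-sel (selected (swap s)) ω | Selected.rem-sel (selected (swap s)) ω | left-swap s ω | right-swap s ω
      with proj₁ (left s ω)
    ... | inj₁ p = (λ { (_ , refl , r) → r }) , (λ r → _ , refl , r)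
    ... | inj₂ p = (λ { (_ , () , r) }) , (λ ())
    e₂ : ∀ {Ω Γ} (s : Spl Ω ((⊕ , plus a b) ∷ []) Γ) {y : El (web b) Γ} →
      cut s (λ i p → idE i (inj₂ p)) y ≐ plusᴿ₂ (Selected.sel (selected (swap s))) (λ i aγ → y i (proj₁ aγ) (proj₂ aγ))
    e₂ s i ω rewrite Selected.get-sel (selected (swap s)) ω | Selected.rem-sel (selected (swap s)) ω | left-swap s ω | right-swap s ω
      with proj₁ (left s ω)
    ... | inj₂ p = (λ { (_ , refl , r) → r }) , (λ r → _ , refl , r)
    ... | inj₁ p = (λ { (_ , () , r) }) , (λ ())

  K-of′ : ∀ {A Γ u} → Val A Γ u → K (A ∷ Γ) (λ i aγ → u i (proj₁ aγ) (proj₂ aγ))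
  K-of′ {A} U = K-of U (idᵛᵈ A)

  -- An environment interprets every formula of Θ by an element of the fact of its dual.
  data Env : (Θ Γ : Sequent) → (Ix → W Θ → W Γ → Set) → Set₁ where
    []   : Env [] [] (λ _ _ _ → ⊤)
    cons : ∀ {A Θ Γ Γ₁ Γ₂ x ξ} (s : Spl Γ Γ₁ Γ₂) → Val (dual A) Γ₁ x → Env Θ Γ₂ ξ →
           Env (A ∷ Θ) Γ (λ i aθ γ → x i (proj₁ aθ) (left s γ) × ξ i (proj₂ aθ) (right s γ))

  record EnvSel {A Θ Δ} (s : Sel A Θ Δ) (Γ : Sequent) (ξ : Ix → W Θ → W Γ → Set) : Set₁ where
    field
      {Γ₁ Γ₂} : Sequent
      {x} : El (web A) Γ₁
      {ξ′} : Ix → W Δ → W Γ₂ → Set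
      spl : Spl Γ Γ₁ Γ₂
      value : Val (dual A) Γ₁ x
      env : Env Δ Γ₂ ξ′
      to : ∀ i θ γ → ξ i θ γ → x i (get s θ) (left spl γ) × ξ′ i (rem s θ) (right spl γ)
      from : ∀ i θ γ → x i (get s θ) (left spl γ) × ξ′ i (rem s θ) (right spl γ) → ξ i θ γ

  env-sel : ∀ {A Θ Δ Γ ξ} (s : Sel A Θ Δ) → Env Θ Γ ξ → EnvSel s Γ ξ
  env-sel here (cons t X E) = record { spl = t ; value = X ; env = E ; to = λ i θ γ r → r ; from = λ i θ γ r → r }
  env-sel (there s) (cons {x = y} t Y E) = record
    { spl = outer ; value = value ; env = cons (swap inner) Y env
    ; to = λ { i (b , θ) γ (p , r) → let (u , v) = to i θ (right t γ) r in
          subst (x i _) (≡-sym (eqA γ)) u , subst (y i b) (≡-sym (eqB γ)) p , subst (ξ′ i _) (≡-sym (eqC γ)) v }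
    ; from = λ { i (b , θ) γ (u , p , v) →
          subst (y i b) (eqB γ) p , from i θ (right t γ) (subst (x i _) (eqA γ) u , subst (ξ′ i _) (eqC γ) v) } }
    where
    open EnvSel (env-sel s E)
    open Assocʳ (assocʳ (swap t) spl)
    eqA : ∀ γ → left outer γ ≡ left spl (right t γ)
    eqA γ = ≡-trans (eq₁ γ) (cong (left spl) (left-swap t γ))
    eqB : ∀ γ → left (swap inner) (right outer γ) ≡ left t γ
    eqB γ = ≡-trans (left-swap inner _) (≡-trans (eq₃ γ) (right-swap t γ))
    eqC : ∀ γ → right (swap inner) (right outer γ) ≡ right spl (right t γ)
    eqC γ = ≡-trans (right-swap inner _) (≡-trans (eq₂ γ) (cong (right spl) (left-swap t γ)))

  record EnvSpl {Θ Θ₁ Θ₂} (s : Spl Θ Θ₁ Θ₂) (Γ : Sequent) (ξ : Ix → W Θ → W Γ → Set) : Set₁ where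
    field
      {Γ₁ Γ₂} : Sequent
      {ξ₁} : Ix → W Θ₁ → W Γ₁ → Set
      {ξ₂} : Ix → W Θ₂ → W Γ₂ → Set
      spl : Spl Γ Γ₁ Γ₂
      env₁ : Env Θ₁ Γ₁ ξ₁
      env₂ : Env Θ₂ Γ₂ ξ₂
      to : ∀ i θ γ → ξ i θ γ → ξ₁ i (left s θ) (left spl γ) × ξ₂ i (right s θ) (right spl γ)
      from : ∀ i θ γ → ξ₁ i (left s θ) (left spl γ) × ξ₂ i (right s θ) (right spl γ) → ξ i θ γ

  env-spl : ∀ {Θ Θ₁ Θ₂ Γ ξ} (s : Spl Θ Θ₁ Θ₂) → Env Θ Γ ξ → EnvSpl s Γ ξ
  env-spl [] [] = record { spl = [] ; env₁ = [] ; env₂ = [] ; to = λ _ _ _ _ → tt , tt ; from = λ _ _ _ _ → tt }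
  env-spl (lft s) (cons {x = y} t Y E) = record
    { spl = outer ; env₁ = cons inner Y env₁ ; env₂ = env₂
    ; to = λ { i (b , θ) γ (p , r) → let (u , v) = to i θ (right t γ) r in
          (subst (y i b) (≡-sym (eq₁ γ)) p , subst (ξ₁ i _) (≡-sym (eq₂ γ)) u) , subst (ξ₂ i _) (≡-sym (eq₃ γ)) v }
    ; from = λ { i (b , θ) γ ((p , u) , v) →
          subst (y i b) (eq₁ γ) p , from i θ (right t γ) (subst (ξ₁ i _) (eq₂ γ) u , subst (ξ₂ i _) (eq₃ γ) v) } }
    where
    open EnvSpl (env-spl s E)
    open Assocˡ (assocˡ t spl)
  env-spl (rgt s) (cons {x = y} t Y E) = record
    { spl = outer ; env₁ = env₁ ; env₂ = cons (swap inner) Y env₂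
    ; to = λ { i (b , θ) γ (p , r) → let (u , v) = to i θ (right t γ) r in
          subst (ξ₁ i _) (≡-sym (eqA γ)) u , subst (y i b) (≡-sym (eqB γ)) p , subst (ξ₂ i _) (≡-sym (eqC γ)) v }
    ; from = λ { i (b , θ) γ (u , p , v) →
          subst (y i b) (eqB γ) p , from i θ (right t γ) (subst (ξ₁ i _) (eqA γ) u , subst (ξ₂ i _) (eqC γ) v) } }
    where
    open EnvSpl (env-spl s E)
    open Assocʳ (assocʳ (swap t) spl)
    eqA : ∀ γ → left outer γ ≡ left spl (right t γ)
    eqA γ = ≡-trans (eq₁ γ) (cong (left spl) (left-swap t γ))
    eqB : ∀ γ → left (swap inner) (right outer γ) ≡ left t γ
    eqB γ = ≡-trans (left-swap inner _) (≡-trans (eq₃ γ) (right-swap t γ))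
    eqC : ∀ γ → right (swap inner) (right outer γ) ≡ right spl (right t γ)
    eqC γ = ≡-trans (right-swap inner _) (≡-trans (eq₂ γ) (cong (right spl) (left-swap t γ)))

  _⊛_ : ∀ {Θ Γ} → (Ix → W Θ → Set) → (Ix → W Θ → W Γ → Set) → Ix → W Γ → Set
  (R ⊛ ξ) i γ = Σ _ λ θ → R i θ × ξ i θ γ

  -- Soundness of the phase model, by induction on the proof. Since the pole consists of cut-free
  -- proofs, this becomes cut elimination as soon as identity elements are put into the environment.
  sound : ∀ {Θ R Γ ξ} → K Θ R → Env Θ Γ ξ → K Γ (R ⊛ ξ)

  value-of : ∀ {A Θ R Γ ξ} → K (A ∷ Θ) R → Env Θ Γ ξ → Val A Γ (λ i a γ → Σ _ λ θ → R i (a , θ) × ξ i θ γ)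
  value-of {A} {Θ} {R} {Γ} {ξ} k E = intro λ {_} {y} Y s → perp (K-resp (e s {y}) (sound k (cons (swap s) Y E)))
    where
    e : ∀ {Ω Δ} (s : Spl Ω Γ Δ) {y : El (web A) Δ} →
      (_⊛_ {A ∷ Θ} R (λ i aθ γ → y i (proj₁ aθ) (left (swap s) γ) × ξ i (proj₂ aθ) (right (swap s) γ)))
        ≐ cut s (λ i a γ → Σ _ λ θ → R i (a , θ) × ξ i θ γ) y
    e s i ω rewrite left-swap s ω | right-swap s ω =
      (λ { ((a , θ) , r , p , q) → a , (θ , r , q) , p }) , (λ { (a , (θ , r , q) , p) → (a , θ) , r , p , q })

  sound (ax₁ {n} {R} d) (cons {x = x} s X (cons {x = y} t Y [])) with spl-nil t
  ... | refl , e = K-resp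
    (λ i γ → (λ { (a , u , v) → (a , a , tt) , proj₂ (d i _) refl , u , subst (y i a) (≡-sym (e (right s γ))) v , tt })
           , (λ { ((a , b , _) , r , u , v , _) → a , u , subst (y i a) (e (right s γ)) (subst (λ c → y i c _) (≡-sym (proj₁ (d i _) r)) v) }))
    (holds (pairing {⊕ , lit n} X Y s))
  sound (ax₂ {n} {R} d) (cons {x = x} s X (cons {x = y} t Y [])) with spl-nil t
  ... | refl , e = K-resp
    (λ i γ → (λ { (a , u , v) → (a , a , tt) , proj₂ (d i _) refl , u , subst (y i a) (≡-sym (e (right s γ))) v , tt })
           , (λ { ((a , b , _) , r , u , v , _) → a , u , subst (y i a) (e (right s γ)) (subst (λ c → y i c _) (≡-sym (proj₁ (d i _) r)) v) }))
    (holds (pairing {⊖ , lit n} X Y s))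
  sound (ten {a} {b} {S = S} {T} s q k l d) E = K-resp
    (λ i γ → (λ { ((p , p') , ((θ , r , u) , θ' , r' , u') , v) →
                 let open Point (mkPoint s q (p , p') θ θ') in fwd i γ point at-sel at-left at-right r u r' u' v })
           , (λ { (θ , r , u) →
                 let (r₁ , r₂) = proj₁ (d i θ) r
                     (v , w) = E₁.to i θ γ u
                     (u₁ , u₂) = E₂.to i _ _ w
                 in get s θ
                    , ( (left q (rem s θ) , r₁ , subst (E₂.ξ₁ i _) (cong (left E₂.spl) (≡-sym (left-swap E₁.spl γ))) u₁)
                      , (right q (rem s θ) , r₂ , subst (E₂.ξ₂ i _) (cong (right E₂.spl) (≡-sym (left-swap E₁.spl γ))) u₂))
                    , subst (E₁.x i _) (≡-sym (right-swap E₁.spl γ)) v }))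
    (holds (unpar {a} {b} E₁.value (value-of k E₂.env₁) (value-of l E₂.env₂) E₂.spl (swap E₁.spl)))
    where
    module E₁ = EnvSel (env-sel s E)
    module E₂ = EnvSpl (env-spl q E₁.env)
    fwd : ∀ i γ θ {p p' θ₁ θ₂} → get s θ ≡ (p , p') → left q (rem s θ) ≡ θ₁ → right q (rem s θ) ≡ θ₂ →
      S i (p , θ₁) → E₂.ξ₁ i θ₁ (left E₂.spl (left (swap E₁.spl) γ)) →
      T i (p' , θ₂) → E₂.ξ₂ i θ₂ (right E₂.spl (left (swap E₁.spl) γ)) →
      E₁.x i (p , p') (right (swap E₁.spl) γ) → _
    fwd i γ θ refl refl refl r u r' u' v = θ , proj₂ (d i θ) (r , r') , E₁.from i θ γ
      ( subst (E₁.x i _) (right-swap E₁.spl γ) v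
      , E₂.from i _ _ ( subst (E₂.ξ₁ i _) (cong (left E₂.spl) (left-swap E₁.spl γ)) u
                      , subst (E₂.ξ₂ i _) (cong (right E₂.spl) (left-swap E₁.spl γ)) u'))
  sound (prl {a} {b} {S = S} s k d) E = K-resp
    (λ i γ → (λ { ((p , p') , u , θ , r , v) →
                 fwd i γ (ins s (p , p') θ) (get-ins s _ _) (rem-ins s _ _) u r v })
           , (λ { (θ , r , u) → let (v , w) = E₁.to i θ γ u in get s θ , v , rem s θ , proj₁ (d i θ) r , w }))
    (holds (pairing {⊕ , tens a b} E₁.value (par z) E₁.spl))
    where
    module E₁ = EnvSel (env-sel s E)
    e : ∀ {Γ Γ₁ Γ₂ Ω} (q : Spl Γ Γ₁ Γ₂) (t : Spl Ω Γ E₁.Γ₂) {u : El (web a) Γ₁} {v : El (web b) Γ₂} →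
      let open Assocʳ (assocʳ t q) in
      (_⊛_ {dual a ∷ dual b ∷ _} S (λ i aθ γ → u i (proj₁ aθ) (left outer γ) × v i (proj₁ (proj₂ aθ)) (left inner (right outer γ)) ×
                       E₁.ξ′ i (proj₂ (proj₂ aθ)) (right inner (right outer γ))))
        ≐ cut t (pair q u v) (λ i pp γ → Σ _ λ θ → S i (proj₁ pp , proj₂ pp , θ) × E₁.ξ′ i θ γ)
    e q t i ω rewrite Assocʳ.eq₁ (assocʳ t q) ω | Assocʳ.eq₂ (assocʳ t q) ω | Assocʳ.eq₃ (assocʳ t q) ω =
      (λ { ((p , p' , θ) , r , u , v , w) → (p , p') , (u , v) , θ , r , w })
      , (λ { ((p , p') , (u , v) , θ , r , w) → (p , p' , θ) , r , u , v , w })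
    z : ∀ {Γ₁ u} → Val a Γ₁ u → ∀ {Γ₂ v} → Val b Γ₂ v → ∀ {Γ} (q : Spl Γ Γ₁ Γ₂) {Ω} (t : Spl Ω Γ E₁.Γ₂) →
      Perp t (pair q u v) (λ i pp γ → Σ _ λ θ → S i (proj₁ pp , proj₂ pp , θ) × E₁.ξ′ i θ γ)
    z {u = u} U {v = v} V q t = let open Assocʳ (assocʳ t q) in
      perp (K-resp (e q t {u} {v}) (sound k (cons outer (to-dd U) (cons inner (to-dd V) E₁.env))))
    fwd : ∀ i γ θ {pp θ'} → get s θ ≡ pp → rem s θ ≡ θ' → E₁.x i pp (left E₁.spl γ) →
      S i (proj₁ pp , proj₂ pp , θ') → E₁.ξ′ i θ' (right E₁.spl γ) → _
    fwd i γ θ refl refl u r v = θ , proj₂ (d i θ) r , E₁.from i θ γ (u , v)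
  sound (pl₁ {a} {b} {S = S} s k d) E = K-resp
    (λ i γ → (λ { (p , (θ , r , v) , u) → let θ' = ins s (inj₁ p) θ in
                 fwd i γ θ' (get-ins s _ _) (rem-ins s _ _) (subst (E₁.x i _) (right-swap E₁.spl γ) u) r (subst (E₁.ξ′ i _) (left-swap E₁.spl γ) v) })
           , (λ { (θ , r , u) → bwd i γ θ (get s θ) refl (proj₁ (d i θ) r) (E₁.to i θ γ u) }))
    (holds (pairing (value-of k E₁.env) (val (proj₁ (raw E₁.value))) (swap E₁.spl)))
    where
    module E₁ = EnvSel (env-sel s E)
    fwd : ∀ i γ θ {p θ'} → get s θ ≡ inj₁ p → rem s θ ≡ θ' → E₁.x i (inj₁ p) (left E₁.spl γ) →
      S i (p , θ') → E₁.ξ′ i θ' (right E₁.spl γ) → _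
    fwd i γ θ eq refl u r v = θ , proj₂ (d i θ) (subst (either _ _) (≡-sym eq) r)
      , E₁.from i θ γ (subst (λ c → E₁.x i c _) (≡-sym eq) u , v)
    bwd : ∀ i γ θ c → get s θ ≡ c → either (λ p → S i (p , rem s θ)) (λ _ → ⊥) (get s θ) →
      E₁.x i (get s θ) (left E₁.spl γ) × E₁.ξ′ i (rem s θ) (right E₁.spl γ) → _
    bwd i γ θ (inj₁ p) eq r (u , v) =
      p , (rem s θ , subst (either _ _) eq r , subst (E₁.ξ′ i _) (≡-sym (left-swap E₁.spl γ)) v)
        , subst₂ (E₁.x i) eq (≡-sym (right-swap E₁.spl γ)) u
    bwd i γ θ (inj₂ p) eq r (u , v) = ⊥-elim (subst (either _ _) eq r)
  sound (pl₂ {a} {b} {S = S} s k d) E = K-resp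
    (λ i γ → (λ { (p , (θ , r , v) , u) → let θ' = ins s (inj₂ p) θ in
                 fwd i γ θ' (get-ins s _ _) (rem-ins s _ _) (subst (E₁.x i _) (right-swap E₁.spl γ) u) r (subst (E₁.ξ′ i _) (left-swap E₁.spl γ) v) })
           , (λ { (θ , r , u) → bwd i γ θ (get s θ) refl (proj₁ (d i θ) r) (E₁.to i θ γ u) }))
    (holds (pairing (value-of k E₁.env) (val (proj₂ (raw E₁.value))) (swap E₁.spl)))
    where
    module E₁ = EnvSel (env-sel s E)
    fwd : ∀ i γ θ {p θ'} → get s θ ≡ inj₂ p → rem s θ ≡ θ' → E₁.x i (inj₂ p) (left E₁.spl γ) →
      S i (p , θ') → E₁.ξ′ i θ' (right E₁.spl γ) → _
    fwd i γ θ eq refl u r v = θ , proj₂ (d i θ) (subst (either _ _) (≡-sym eq) r)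
      , E₁.from i θ γ (subst (λ c → E₁.x i c _) (≡-sym eq) u , v)
    bwd : ∀ i γ θ c → get s θ ≡ c → either (λ _ → ⊥) (λ p → S i (p , rem s θ)) (get s θ) →
      E₁.x i (get s θ) (left E₁.spl γ) × E₁.ξ′ i (rem s θ) (right E₁.spl γ) → _
    bwd i γ θ (inj₂ p) eq r (u , v) =
      p , (rem s θ , subst (either _ _) eq r , subst (E₁.ξ′ i _) (≡-sym (left-swap E₁.spl γ)) v)
        , subst₂ (E₁.x i) eq (≡-sym (right-swap E₁.spl γ)) u
    bwd i γ θ (inj₁ p) eq r (u , v) = ⊥-elim (subst (either _ _) eq r)
  sound (wth {a} {b} {S = S} {T} s k l d) E = K-resp
    (λ i γ → (λ { (c , u , v) → fwd i γ c u v })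
           , (λ { (θ , r , u) → get s θ , proj₁ (E₁.to i θ γ u) , bwd i γ θ (get s θ) refl (proj₁ (d i θ) r) (proj₂ (E₁.to i θ γ u)) }))
    (holds (pairing {⊕ , plus a b} E₁.value (val {u = z} (raw (value-of k E₁.env) , raw (value-of l E₁.env))) E₁.spl))
    where
    module E₁ = EnvSel (env-sel s E)
    z : El (web a ⊎ web b) E₁.Γ₂
    z i (inj₁ p) γ = Σ _ λ θ → S i (p , θ) × E₁.ξ′ i θ γ
    z i (inj₂ p) γ = Σ _ λ θ → T i (p , θ) × E₁.ξ′ i θ γ
    fwd : ∀ i γ c → E₁.x i c (left E₁.spl γ) → z i c (right E₁.spl γ) → _
    fwd i γ (inj₁ p) u (θ , r , v) = ins s (inj₁ p) θ
      , proj₂ (d i _) (subst₂ (λ c θ → either (λ p → S i (p , θ)) (λ p → T i (p , θ)) c) (≡-sym (get-ins s _ _)) (≡-sym (rem-ins s _ _)) r)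
      , E₁.from i _ γ (subst (λ c → E₁.x i c _) (≡-sym (get-ins s _ _)) u , subst (λ c → E₁.ξ′ i c _) (≡-sym (rem-ins s _ _)) v)
    fwd i γ (inj₂ p) u (θ , r , v) = ins s (inj₂ p) θ
      , proj₂ (d i _) (subst₂ (λ c θ → either (λ p → S i (p , θ)) (λ p → T i (p , θ)) c) (≡-sym (get-ins s _ _)) (≡-sym (rem-ins s _ _)) r)
      , E₁.from i _ γ (subst (λ c → E₁.x i c _) (≡-sym (get-ins s _ _)) u , subst (λ c → E₁.ξ′ i c _) (≡-sym (rem-ins s _ _)) v)
    bwd : ∀ i γ θ c → get s θ ≡ c → either (λ p → S i (p , rem s θ)) (λ p → T i (p , rem s θ)) c →
      E₁.ξ′ i (rem s θ) (right E₁.spl γ) → z i c (right E₁.spl γ)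
    bwd i γ θ (inj₁ p) eq r v = rem s θ , r , v
    bwd i γ θ (inj₂ p) eq r v = rem s θ , r , v
  sound (uni d) (cons {x = x} s X []) with spl-nil s
  ... | refl , e = K-resp
    (λ i γ → (λ { (j , _ , u) → (j , tt) , proj₂ (d i _) tt , subst (x i j) (≡-trans (right-all _ γ) (≡-sym (e γ))) u , tt })
           , (λ { ((j , _) , _ , u , _) → j , tt , subst (x i j) (≡-trans (e γ) (≡-sym (right-all _ γ))) u }))
    (holds (raw X one (all-right _)))
  sound (bot {R = R} s k) E = K-resp
    (λ i γ → (λ { (j , u , θ , r , v) → ins s j θ , r
                 , E₁.from i _ γ (subst (λ c → E₁.x i c _) (≡-sym (get-ins s _ _)) u , subst (λ c → E₁.ξ′ i c _) (≡-sym (rem-ins s _ _)) v) })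
           , (λ { (θ , r , u) → let (v , w) = E₁.to i θ γ u in get s θ , v , rem s θ , subst (R i) (≡-sym (ins-get-rem s θ)) r , w }))
    (holds (pairing {⊕ , unit} E₁.value (val λ { one t → right-empty t (λ t → Perp t (λ _ _ _ → ⊤) z)
      (perp (K-resp (λ i γ → (λ { (θ , (j , r) , v) → j , tt , θ , r , subst (E₁.ξ′ i θ) (≡-sym (right-all _ γ)) v })
                           , (λ { (j , _ , θ , r , v) → θ , (j , r) , subst (E₁.ξ′ i θ) (right-all _ γ) v })) (sound k E₁.env))) }) E₁.spl))
    where
    module E₁ = EnvSel (env-sel s E)
    z : El Bool E₁.Γ₂
    z i j γ = Σ _ λ θ → R i (ins s j θ) × E₁.ξ′ i θ γ
  sound (top {R = R} s) E = K-resp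
    (λ i γ → (λ { (j , u , θ , r , v) → ins s j θ , r
                 , E₁.from i _ γ (subst (λ c → E₁.x i c _) (≡-sym (get-ins s _ _)) u , subst (λ c → E₁.ξ′ i c _) (≡-sym (rem-ins s _ _)) v) })
           , (λ { (θ , r , u) → let (v , w) = E₁.to i θ γ u in get s θ , v , rem s θ , subst (R i) (≡-sym (ins-get-rem s θ)) r , w }))
    (holds (pairing {⊕ , zero} E₁.value (val {u = z} λ { (lift ()) }) E₁.spl))
    where
    module E₁ = EnvSel (env-sel s E)
    z : El Bool E₁.Γ₂
    z i j γ = Σ _ λ θ → R i (ins s j θ) × E₁.ξ′ i θ γ

-- Terms and the free model

infixr 9 _∘ᵗ_
infixr 7 _⊗ᵗ_

data Term : Formula → Formula → Set where
  idᵗ : ∀ {A} → Term A A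
  _∘ᵗ_ : ∀ {A B C} → Term B C → Term A B → Term A C
  _⊗ᵗ_ : ∀ {A B C D} → Term A B → Term C D → Term (A ⊗ C) (B ⊗ D)
  αᵗ : ∀ {A B C} → Term ((A ⊗ B) ⊗ C) (A ⊗ (B ⊗ C))
  α⁻ᵗ : ∀ {A B C} → Term (A ⊗ (B ⊗ C)) ((A ⊗ B) ⊗ C)
  λᵗ : ∀ {A} → Term (𝟏 ⊗ A) A
  λ⁻ᵗ : ∀ {A} → Term A (𝟏 ⊗ A)
  ρᵗ : ∀ {A} → Term (A ⊗ 𝟏) A
  ρ⁻ᵗ : ∀ {A} → Term A (A ⊗ 𝟏)
  σᵗ : ∀ {A B} → Term (A ⊗ B) (B ⊗ A)
  evalᵗ : ∀ {A B} → Term ((A ⊸ B) ⊗ A) B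
  curᵗ : ∀ {A B C} → Term (C ⊗ A) B → Term C (A ⊸ B)
  dualᵗ : ∀ {A} → Term ((A ⊸ ⊥') ⊸ ⊥') A
  bangᵗ : ∀ {A} → Term A ⊤'
  fstᵗ : ∀ {A B} → Term (A & B) A
  sndᵗ : ∀ {A B} → Term (A & B) B
  pairᵗ : ∀ {A B C} → Term C A → Term C B → Term C (A & B)

infix 4 _≈ᵗ_

data _≈ᵗ_ : ∀ {A B} → Term A B → Term A B → Set where
  refl  : ∀ {A B} {f : Term A B} → f ≈ᵗ f
  sym   : ∀ {A B} {f g : Term A B} → f ≈ᵗ g → g ≈ᵗ f
  trans : ∀ {A B} {f g h : Term A B} → f ≈ᵗ g → g ≈ᵗ h → f ≈ᵗ h
  ∘-resp : ∀ {A B C} {f h : Term B C} {g i : Term A B} → f ≈ᵗ h → g ≈ᵗ i → f ∘ᵗ g ≈ᵗ h ∘ᵗ i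
  idˡ : ∀ {A B} {f : Term A B} → idᵗ ∘ᵗ f ≈ᵗ f
  idʳ : ∀ {A B} {f : Term A B} → f ∘ᵗ idᵗ ≈ᵗ f
  ∘-assoc : ∀ {A B C D} {f : Term A B} {g : Term B C} {h : Term C D} → (h ∘ᵗ g) ∘ᵗ f ≈ᵗ h ∘ᵗ (g ∘ᵗ f)
  ⊗-id : ∀ {A B} → idᵗ {A = A} ⊗ᵗ idᵗ {A = B} ≈ᵗ idᵗ
  ⊗-hom : ∀ {A B C D E F} {f : Term A B} {g : Term B C} {h : Term D E} {i : Term E F} →
          (g ∘ᵗ f) ⊗ᵗ (i ∘ᵗ h) ≈ᵗ (g ⊗ᵗ i) ∘ᵗ (f ⊗ᵗ h)
  ⊗-resp : ∀ {A B C D} {f f' : Term A B} {g g' : Term C D} → f ≈ᵗ f' → g ≈ᵗ g' → f ⊗ᵗ g ≈ᵗ f' ⊗ᵗ g'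
  α-isoˡ : ∀ {A B C} → α⁻ᵗ ∘ᵗ αᵗ ≈ᵗ idᵗ {A = (A ⊗ B) ⊗ C}
  α-isoʳ : ∀ {A B C} → αᵗ ∘ᵗ α⁻ᵗ ≈ᵗ idᵗ {A = A ⊗ (B ⊗ C)}
  λ-isoˡ : ∀ {A} → λ⁻ᵗ ∘ᵗ λᵗ ≈ᵗ idᵗ {A = 𝟏 ⊗ A}
  λ-isoʳ : ∀ {A} → λᵗ ∘ᵗ λ⁻ᵗ ≈ᵗ idᵗ {A = A}
  ρ-isoˡ : ∀ {A} → ρ⁻ᵗ ∘ᵗ ρᵗ ≈ᵗ idᵗ {A = A ⊗ 𝟏}
  ρ-isoʳ : ∀ {A} → ρᵗ ∘ᵗ ρ⁻ᵗ ≈ᵗ idᵗ {A = A}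
  α-nat : ∀ {A A' B B' C C'} {f : Term A A'} {g : Term B B'} {h : Term C C'} →
          αᵗ ∘ᵗ ((f ⊗ᵗ g) ⊗ᵗ h) ≈ᵗ (f ⊗ᵗ (g ⊗ᵗ h)) ∘ᵗ αᵗ
  λ-nat : ∀ {A B} {f : Term A B} → λᵗ ∘ᵗ (idᵗ ⊗ᵗ f) ≈ᵗ f ∘ᵗ λᵗ
  ρ-nat : ∀ {A B} {f : Term A B} → ρᵗ ∘ᵗ (f ⊗ᵗ idᵗ) ≈ᵗ f ∘ᵗ ρᵗ
  σ-nat : ∀ {A A' B B'} {f : Term A A'} {g : Term B B'} → σᵗ ∘ᵗ (f ⊗ᵗ g) ≈ᵗ (g ⊗ᵗ f) ∘ᵗ σᵗ
  pentagon : ∀ {A B C D} → αᵗ {A = A} {B} {C ⊗ D} ∘ᵗ αᵗ ≈ᵗ (idᵗ ⊗ᵗ αᵗ) ∘ᵗ (αᵗ ∘ᵗ (αᵗ ⊗ᵗ idᵗ))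
  triangle : ∀ {A B} → (idᵗ {A = A} ⊗ᵗ λᵗ {A = B}) ∘ᵗ αᵗ ≈ᵗ ρᵗ ⊗ᵗ idᵗ
  hexagon : ∀ {A B C} → αᵗ {A = B} {C} {A} ∘ᵗ (σᵗ ∘ᵗ αᵗ) ≈ᵗ (idᵗ ⊗ᵗ σᵗ) ∘ᵗ (αᵗ ∘ᵗ (σᵗ ⊗ᵗ idᵗ))
  σ-inv : ∀ {A B} → σᵗ ∘ᵗ σᵗ ≈ᵗ idᵗ {A = A ⊗ B}
  cur-resp : ∀ {A B C} {f g : Term (C ⊗ A) B} → f ≈ᵗ g → curᵗ f ≈ᵗ curᵗ g
  eval-β : ∀ {A B C} {f : Term (C ⊗ A) B} → evalᵗ ∘ᵗ (curᵗ f ⊗ᵗ idᵗ) ≈ᵗ f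
  eval-η : ∀ {A B C} {g : Term C (A ⊸ B)} → curᵗ (evalᵗ ∘ᵗ (g ⊗ᵗ idᵗ)) ≈ᵗ g
  dual-isoˡ : ∀ {A} → dualᵗ ∘ᵗ curᵗ (evalᵗ ∘ᵗ σᵗ) ≈ᵗ idᵗ {A = A}
  dual-isoʳ : ∀ {A} → curᵗ (evalᵗ ∘ᵗ σᵗ) ∘ᵗ dualᵗ ≈ᵗ idᵗ {A = (A ⊸ ⊥') ⊸ ⊥'}
  bang-η : ∀ {A} {f : Term A ⊤'} → bangᵗ ≈ᵗ f
  fst-β : ∀ {A B C} {f : Term C A} {g : Term C B} → fstᵗ ∘ᵗ pairᵗ f g ≈ᵗ f
  snd-β : ∀ {A B C} {f : Term C A} {g : Term C B} → sndᵗ ∘ᵗ pairᵗ f g ≈ᵗ g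
  pair-resp : ∀ {A B C} {f f' : Term C A} {g g' : Term C B} → f ≈ᵗ f' → g ≈ᵗ g' → pairᵗ f g ≈ᵗ pairᵗ f' g'
  pair-η : ∀ {A B C} {h : Term C (A & B)} → pairᵗ (fstᵗ ∘ᵗ h) (sndᵗ ∘ᵗ h) ≈ᵗ h

-- The syntactic model. Lifting makes it available at whatever universe levels validity is assumed.
Free : ∀ o ℓ e → StarAutonomousWithProducts o ℓ e
Free o ℓ e = record
  { cat = record
    { Obj = Lift o Formula ; _⇒_ = λ A B → Lift ℓ (Term (lower A) (lower B)) ; _≈_ = λ f g → Lift e (lower f ≈ᵗ lower g)
    ; id = lift idᵗ ; _∘_ = λ f g → lift (lower f ∘ᵗ lower g)
    ; ≈-equiv = record { refl = lift refl ; sym = λ p → lift (sym (lower p)) ; trans = λ p q → lift (trans (lower p) (lower q)) }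
    ; ∘-resp-≈ = λ p q → lift (∘-resp (lower p) (lower q)) ; identityˡ = lift idˡ ; identityʳ = lift idʳ ; assoc = lift ∘-assoc }
  ; _⊗₀_ = λ A B → lift (lower A ⊗ lower B) ; _⊗₁_ = λ f g → lift (lower f ⊗ᵗ lower g)
  ; ⊗-identity = lift ⊗-id ; ⊗-homomorphism = lift ⊗-hom ; ⊗-resp-≈ = λ p q → lift (⊗-resp (lower p) (lower q))
  ; I = lift 𝟏 ; α⇒ = lift αᵗ ; α⇐ = lift α⁻ᵗ ; α-isoˡ = lift α-isoˡ ; α-isoʳ = lift α-isoʳ
  ; λ⇒ = lift λᵗ ; λ⇐ = lift λ⁻ᵗ ; λ-isoˡ = lift λ-isoˡ ; λ-isoʳ = lift λ-isoʳ
  ; ρ⇒ = lift ρᵗ ; ρ⇐ = lift ρ⁻ᵗ ; ρ-isoˡ = lift ρ-isoˡ ; ρ-isoʳ = lift ρ-isoʳ ; σ = lift σᵗ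
  ; α-natural = lift α-nat ; λ-natural = lift λ-nat ; ρ-natural = lift ρ-nat ; σ-natural = lift σ-nat
  ; pentagon = lift pentagon ; triangle = lift triangle ; hexagon = lift hexagon ; σ-involutive = lift σ-inv
  ; [_,_] = λ A B → lift (lower A ⊸ lower B) ; eval = lift evalᵗ ; λ-abs = λ f → lift (curᵗ (lower f))
  ; λ-abs-resp-≈ = λ p → lift (cur-resp (lower p)) ; eval-β = lift eval-β ; eval-η = lift eval-η
  ; ⊥ = lift ⊥' ; dual⇐ = lift dualᵗ ; dual-isoˡ = lift dual-isoˡ ; dual-isoʳ = lift dual-isoʳ
  ; ⊤ = lift ⊤' ; ! = lift bangᵗ ; !-unique = λ f → lift bang-η
  ; _×_ = λ A B → lift (lower A & lower B) ; π₁ = lift fstᵗ ; π₂ = lift sndᵗ ; ⟨_,_⟩ = λ f g → lift (pairᵗ (lower f) (lower g))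
  ; project₁ = lift fst-β ; project₂ = lift snd-β
  ; ×-unique = λ p q → lift (trans (pair-resp (sym (lower p)) (sym (lower q))) pair-η) }

Free-⟦⟧ : ∀ o ℓ e F → ⟦_⟧ (Free o ℓ e) F (λ n → lift (atom n)) ≡ lift F
Free-⟦⟧ o ℓ e (atom n) = refl
Free-⟦⟧ o ℓ e (F ⊗ G) = cong₂ (λ A B → lift (lower A ⊗ lower B)) (Free-⟦⟧ o ℓ e F) (Free-⟦⟧ o ℓ e G)
Free-⟦⟧ o ℓ e 𝟏 = refl
Free-⟦⟧ o ℓ e (F ⊸ G) = cong₂ (λ A B → lift (lower A ⊸ lower B)) (Free-⟦⟧ o ℓ e F) (Free-⟦⟧ o ℓ e G)
Free-⟦⟧ o ℓ e ⊥' = refl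
Free-⟦⟧ o ℓ e (F & G) = cong₂ (λ A B → lift (lower A & lower B)) (Free-⟦⟧ o ℓ e F) (Free-⟦⟧ o ℓ e G)
Free-⟦⟧ o ℓ e ⊤' = refl

tr : Formula → Signed
tr (atom n) = ⊕ , lit n
tr (F ⊗ G) = tr F ⊗ˢ tr G
tr 𝟏 = 𝟏ˢ
tr (F ⊸ G) = tr F ⊸ˢ tr G
tr ⊥' = ⊥ˢ
tr (F & G) = tr F &ˢ tr G
tr ⊤' = ⊤ˢ

∣_∣ : Formula → Set
∣ F ∣ = web (tr F)

dflt : ∀ k → Bool → wk k
dflt (lit n) c = c
dflt unit c = c
dflt zero c = c
dflt (tens (_ , k) (_ , l)) c = dflt k c , dflt l c
dflt (plus (_ , k) _) c = inj₁ (dflt k c)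

-- pin s k p is a realiser of (s , k) that meets pin (flip s) k p, up to labels, only in p.
pin : (s : Sign) (k : Skeleton) → wk k → wk k → Set
pin ⊕ (lit n) p a = ⊤
pin ⊖ (lit n) p a = a ≡ p
pin ⊕ unit p a = ⊤
pin ⊖ unit p a = a ≡ p
pin ⊕ zero p a = a ≡ p
pin ⊖ zero p a = ⊤
pin ⊕ (tens (r , k) (t , l)) (p , q) (a , b) = pin r k p a × pin t l q b
pin ⊖ (tens (r , k) (t , l)) (p , q) (a , b) = pin (flip r) k p a × pin (flip t) l q b
pin ⊕ (plus (r , k) (t , l)) (inj₁ p) (inj₁ a) = pin r k p a
pin ⊕ (plus (r , k) (t , l)) (inj₁ p) (inj₂ b) = ⊥
pin ⊕ (plus (r , k) (t , l)) (inj₂ q) (inj₁ a) = ⊥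
pin ⊕ (plus (r , k) (t , l)) (inj₂ q) (inj₂ b) = pin t l q b
pin ⊖ (plus (r , k) (t , l)) (inj₁ p) (inj₁ a) = pin (flip r) k p a
pin ⊖ (plus (r , k) (t , l)) (inj₁ p) (inj₂ b) = pin (flip t) l (dflt l (lab k p)) b
pin ⊖ (plus (r , k) (t , l)) (inj₂ q) (inj₁ a) = pin (flip r) k (dflt k (lab l q)) a
pin ⊖ (plus (r , k) (t , l)) (inj₂ q) (inj₂ b) = pin (flip t) l q b

-- Every relation into ⊤ is realised by proofs, so the choice is governed by the other invariants: a
-- `pin` of the dual of `A` meets every value of `A` in the totality model, respects relabelling,
-- and is a clique.
bangʳ : ∀ A → web A → Bool → Set
bangʳ (s , k) a t = pin (flip s) k (dflt k t) a

⟦_⟧ᵗ : ∀ {A B} → Term A B → ∣ A ∣ → ∣ B ∣ → Set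
⟦ idᵗ ⟧ᵗ = _≡_
⟦ g ∘ᵗ f ⟧ᵗ = (con ⟦ f ⟧ᵗ ⨾ con ⟦ g ⟧ᵗ) tt
⟦ f ⊗ᵗ g ⟧ᵗ = (con ⟦ f ⟧ᵗ ⊠ con ⟦ g ⟧ᵗ) tt
⟦ αᵗ ⟧ᵗ = gr assocᶠ tt
⟦ α⁻ᵗ ⟧ᵗ = gr unassocᶠ tt
⟦ λᵗ {A} ⟧ᵗ = lam⇒ (tr A) true
⟦ λ⁻ᵗ {A} ⟧ᵗ = lam⇐ (tr A) true
⟦ ρᵗ {A} ⟧ᵗ = rho⇒ (tr A) true
⟦ ρ⁻ᵗ {A} ⟧ᵗ = rho⇐ (tr A) true
⟦ σᵗ ⟧ᵗ = gr swapᶠ tt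
⟦ evalᵗ ⟧ᵗ = evalʳ tt
⟦ curᵗ f ⟧ᵗ = curʳ (con ⟦ f ⟧ᵗ) tt
⟦ dualᵗ {A} ⟧ᵗ = dualizeʳ (tr A) true
⟦ bangᵗ {A} ⟧ᵗ = bangʳ (tr A)
⟦ fstᵗ ⟧ᵗ = π₁ʳ tt
⟦ sndᵗ ⟧ᵗ = π₂ʳ tt
⟦ pairᵗ f g ⟧ᵗ = ⟨ con ⟦ f ⟧ᵗ , con ⟦ g ⟧ᵗ ⟩ʳ tt

module Interpret
  (pole : (Γ : Sequent) → (Ix → W Γ → Set) → Set₁)
  (pole-resp : ∀ {Γ} {R S : Ix → W Γ → Set} → R ≐ S → pole Γ R → pole Γ S)
  (LitGen : ℕ → Fact Bool) (ZeroGen : Fact Bool)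
  (bang : ∀ A → Phase.Hom pole pole-resp LitGen ZeroGen A ⊤ˢ (con (bangʳ A))) where

  open Phase pole pole-resp LitGen ZeroGen

  ⟦⟧-hom : ∀ {A B} (t : Term A B) → Hom (tr A) (tr B) (con ⟦ t ⟧ᵗ)
  ⟦⟧-hom idᵗ = hom-id
  ⟦⟧-hom (g ∘ᵗ f) = hom-comp (⟦⟧-hom f) (⟦⟧-hom g)
  ⟦⟧-hom (f ⊗ᵗ g) = hom-tens (⟦⟧-hom f) (⟦⟧-hom g)
  ⟦⟧-hom αᵗ = hom-α
  ⟦⟧-hom α⁻ᵗ = hom-unα
  ⟦⟧-hom λᵗ = hom-λ⇒
  ⟦⟧-hom λ⁻ᵗ = hom-λ⇐
  ⟦⟧-hom ρᵗ = hom-ρ⇒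
  ⟦⟧-hom ρ⁻ᵗ = hom-ρ⇐
  ⟦⟧-hom σᵗ = hom-σ
  ⟦⟧-hom evalᵗ = hom-eval
  ⟦⟧-hom (curᵗ f) = hom-cur (⟦⟧-hom f)
  ⟦⟧-hom dualᵗ = hom-dualize
  ⟦⟧-hom (bangᵗ {A}) = bang (tr A)
  ⟦⟧-hom fstᵗ = hom-π₁
  ⟦⟧-hom sndᵗ = hom-π₂
  ⟦⟧-hom (pairᵗ f g) = Hom-resp
    (λ { i c (inj₁ a) → (λ r → r) , (λ r → r) ; i c (inj₂ b) → (λ r → r) , (λ r → r) }) (hom-⟨⟩ (⟦⟧-hom f) (⟦⟧-hom g))

-- Equal terms are linked by chains of jointly realised relations

pick : ∀ {X Y : Set} → (X → Y → Set) → (X → Y → Set) → Ix → X → Y → Set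
pick R S true = R
pick R S false = S

-- Since 0 has no generators here, arbitrary relations into ⊤ share a proof; uniqueness of maps into
-- ⊤ is therefore a single link.
bang-hom : ∀ A {R} → Phase.Hom K K-resp LitGen NoGen A ⊤ˢ R
bang-hom A = by-push λ U → val λ { (lift ()) }
  where open Phase K K-resp LitGen NoGen

module _ where
  open P
  open Interpret K K-resp LitGen NoGen (λ A → bang-hom A)

  Iff : Set → Set → Set
  Iff A B = (A → B) × (B → A)

  iff : ∀ {A} → Iff A A
  iff = (λ r → r) , (λ r → r)

  hom-pick : ∀ {A B R S S'} → Hom A B R → (∀ a b → Iff (R true a b) (S a b)) → (∀ a b → Iff (R false a b) (S' a b)) → Hom A B (pick S S')
  hom-pick h e e' = Hom-resp (λ { true a b → e a b ; false a b → e' a b }) h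

  record _~_ {A B : Formula} (f g : Term A B) : Set₁ where
    constructor joint
    field both : Hom (tr A) (tr B) (pick ⟦ f ⟧ᵗ ⟦ g ⟧ᵗ)
  open _~_

  exactly : ∀ {A B} (f g : Term A B) → (∀ a b → Iff (⟦ f ⟧ᵗ a b) (⟦ g ⟧ᵗ a b)) → EqClosure _~_ f g
  exactly f g e = return (joint (hom-pick (⟦⟧-hom f) (λ a b → iff) e))

  pair-~ˡ : ∀ {A B C} {f f' : Term C A} (g : Term C B) → f ~ f' → pairᵗ f g ~ pairᵗ f' g
  pair-~ˡ g s = joint (hom-pick (hom-⟨⟩ (both s) (⟦⟧-hom g)) (λ { _ (inj₁ _) → iff ; _ (inj₂ _) → iff }) (λ { _ (inj₁ _) → iff ; _ (inj₂ _) → iff }))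

  pair-~ʳ : ∀ {A B C} (f : Term C A) {g g' : Term C B} → g ~ g' → pairᵗ f g ~ pairᵗ f g'
  pair-~ʳ f s = joint (hom-pick (hom-⟨⟩ (⟦⟧-hom f) (both s)) (λ { _ (inj₁ _) → iff ; _ (inj₂ _) → iff }) (λ { _ (inj₁ _) → iff ; _ (inj₂ _) → iff }))

  ≈-chain : ∀ {A B} {f g : Term A B} → f ≈ᵗ g → EqClosure _~_ f g
  ≈-chain refl = reflexive _~_
  ≈-chain (sym p) = symmetric _~_ (≈-chain p)
  ≈-chain (trans p q) = transitive _~_ (≈-chain p) (≈-chain q)
  ≈-chain (∘-resp {f = f} {h} {g} {i} p q) = transitive _~_
    (gmap (_∘ᵗ g) (λ s → joint (hom-pick (hom-comp (⟦⟧-hom g) (both s)) (λ _ _ → iff) (λ _ _ → iff))) (≈-chain p))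
    (gmap (h ∘ᵗ_) (λ s → joint (hom-pick (hom-comp (both s) (⟦⟧-hom h)) (λ _ _ → iff) (λ _ _ → iff))) (≈-chain q))
  ≈-chain (idˡ {f = f}) = exactly _ f λ a b → (λ { (_ , r , refl) → r }) , (λ r → _ , r , refl)
  ≈-chain (idʳ {f = f}) = exactly _ f λ a b → (λ { (_ , refl , r) → r }) , (λ r → _ , refl , r)
  ≈-chain (∘-assoc {f = f} {g} {h}) = exactly ((h ∘ᵗ g) ∘ᵗ f) (h ∘ᵗ (g ∘ᵗ f)) λ a b →
    (λ { (_ , r , _ , s , t) → _ , (_ , r , s) , t }) , (λ { (_ , (_ , r , s) , t) → _ , r , _ , s , t })
  ≈-chain ⊗-id = exactly (idᵗ ⊗ᵗ idᵗ) idᵗ λ a b → (λ { (refl , refl) → refl }) , (λ { refl → refl , refl })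
  ≈-chain (⊗-hom {f = f} {g} {h} {i}) = exactly ((g ∘ᵗ f) ⊗ᵗ (i ∘ᵗ h)) ((g ⊗ᵗ i) ∘ᵗ (f ⊗ᵗ h)) λ a b →
    (λ { ((_ , r , s) , _ , t , u) → _ , (r , t) , (s , u) }) , (λ { (_ , (r , t) , (s , u)) → (_ , r , s) , _ , t , u })
  ≈-chain (⊗-resp {f = f} {f'} {g} {g'} p q) = transitive _~_
    (gmap (_⊗ᵗ g) (λ s → joint (hom-pick (hom-tens (both s) (⟦⟧-hom g)) (λ _ _ → iff) (λ _ _ → iff))) (≈-chain p))
    (gmap (f' ⊗ᵗ_) (λ s → joint (hom-pick (hom-tens (⟦⟧-hom f') (both s)) (λ _ _ → iff) (λ _ _ → iff))) (≈-chain q))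
  ≈-chain α-isoˡ = exactly (α⁻ᵗ ∘ᵗ αᵗ) idᵗ λ a b → (λ { (_ , refl , refl) → refl }) , (λ { refl → _ , refl , refl })
  ≈-chain α-isoʳ = exactly (αᵗ ∘ᵗ α⁻ᵗ) idᵗ λ a b → (λ { (_ , refl , refl) → refl }) , (λ { refl → _ , refl , refl })
  -- The two relations differ, but once the unit label of the source is projected away both become
  -- the relation of `λ⁻ᵗ`.
  ≈-chain (λ-isoˡ {A}) = return (joint (hom-pick (hom-unit {R = pick ⟦ λ⁻ᵗ {A} ∘ᵗ λᵗ ⟧ᵗ _≡_}
    (λ { true a b → (λ { refl → _ , _ , (refl , refl) , refl }) , (λ { j (_ , (refl , _) , refl) → refl })
       ; false a b → (λ { refl → _ , refl }) , (λ { j refl → refl }) }) hom-λ⇐) (λ _ _ → iff) (λ _ _ → iff)))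
  ≈-chain λ-isoʳ = exactly (λᵗ ∘ᵗ λ⁻ᵗ) idᵗ λ a b → (λ { (_ , refl , refl , _) → refl }) , (λ { refl → _ , refl , refl , refl })
  ≈-chain (ρ-isoˡ {A}) = return (joint (hom-pick (hom-unitʳ {R = pick ⟦ ρ⁻ᵗ {A} ∘ᵗ ρᵗ ⟧ᵗ _≡_}
    (λ { true a b → (λ { refl → _ , _ , (refl , refl) , refl }) , (λ { j (_ , (refl , _) , refl) → refl })
       ; false a b → (λ { refl → _ , refl }) , (λ { j refl → refl }) }) hom-ρ⇐) (λ _ _ → iff) (λ _ _ → iff)))
  ≈-chain ρ-isoʳ = exactly (ρᵗ ∘ᵗ ρ⁻ᵗ) idᵗ λ a b → (λ { (_ , refl , refl , _) → refl }) , (λ { refl → _ , refl , refl , refl })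
  ≈-chain (α-nat {f = f} {g} {h}) = exactly (αᵗ ∘ᵗ ((f ⊗ᵗ g) ⊗ᵗ h)) ((f ⊗ᵗ (g ⊗ᵗ h)) ∘ᵗ αᵗ) λ a b →
    (λ { (_ , ((r , s) , t) , refl) → _ , refl , r , s , t }) , (λ { (_ , refl , r , s , t) → _ , ((r , s) , t) , refl })
  ≈-chain (λ-nat {f = f}) = return (joint (hom-pick (hom-unit {R = pick ⟦ λᵗ ∘ᵗ (idᵗ ⊗ᵗ f) ⟧ᵗ ⟦ f ∘ᵗ λᵗ ⟧ᵗ}
    (λ { true a b → (λ r → _ , _ , (refl , r) , refl , refl) , (λ { j (_ , (_ , r) , refl , _) → r })
       ; false a b → (λ r → _ , _ , (refl , refl) , r) , (λ { j (_ , (refl , _) , r) → r }) }) (⟦⟧-hom f)) (λ _ _ → iff) (λ _ _ → iff)))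
  ≈-chain (ρ-nat {f = f}) = return (joint (hom-pick (hom-unitʳ {R = pick ⟦ ρᵗ ∘ᵗ (f ⊗ᵗ idᵗ) ⟧ᵗ ⟦ f ∘ᵗ ρᵗ ⟧ᵗ}
    (λ { true a b → (λ r → _ , _ , (r , refl) , refl , refl) , (λ { j (_ , (r , _) , refl , _) → r })
       ; false a b → (λ r → _ , _ , (refl , refl) , r) , (λ { j (_ , (refl , _) , r) → r }) }) (⟦⟧-hom f)) (λ _ _ → iff) (λ _ _ → iff)))
  ≈-chain (σ-nat {f = f} {g}) = exactly (σᵗ ∘ᵗ (f ⊗ᵗ g)) ((g ⊗ᵗ f) ∘ᵗ σᵗ) λ a b →
    (λ { (_ , (r , s) , refl) → _ , refl , s , r }) , (λ { (_ , refl , s , r) → _ , (r , s) , refl })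
  ≈-chain pentagon = exactly (αᵗ ∘ᵗ αᵗ) ((idᵗ ⊗ᵗ αᵗ) ∘ᵗ (αᵗ ∘ᵗ (αᵗ ⊗ᵗ idᵗ))) λ a b →
    (λ { (_ , refl , refl) → _ , (_ , (refl , refl) , refl) , (refl , refl) })
    , (λ { (_ , (_ , (refl , refl) , refl) , (refl , refl)) → _ , refl , refl })
  -- The left side takes the label of the vanishing unit from `b`, the right side from `a`. The unit
  -- is moved to the front, where `hom-unit` ignores the difference.
  ≈-chain (triangle {A} {B}) = return (joint (hom-pick
    (hom-comp (hom-comp (hom-tens hom-σ (hom-id {tr B})) (hom-α {𝟏ˢ} {tr A} {tr B}))
      (hom-unit {R = λ { true (j , a , b) c → (a , b) ≡ c × j ≡ lab (Signed.skel (tr B)) b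
                       ; false (j , a , b) c → (a , b) ≡ c × j ≡ lab (Signed.skel (tr A)) a }}
        (λ { true a b → (λ { refl → _ , refl , refl }) , (λ { j (refl , _) → refl })
           ; false a b → (λ { refl → _ , refl , refl }) , (λ { j (refl , _) → refl }) }) hom-id))
    (λ { ((a , j) , b) c → (λ { (_ , (_ , (refl , refl) , refl) , refl , refl) → _ , refl , refl , refl , refl })
                         , (λ { (_ , refl , refl , refl , refl) → _ , (_ , (refl , refl) , refl) , refl , refl }) })
    (λ { ((a , j) , b) c → (λ { (_ , (_ , (refl , refl) , refl) , refl , refl) → (refl , refl) , refl })
                         , (λ { ((refl , refl) , refl) → _ , (_ , (refl , refl) , refl) , refl , refl }) })))
  ≈-chain hexagon = exactly (αᵗ ∘ᵗ (σᵗ ∘ᵗ αᵗ)) ((idᵗ ⊗ᵗ σᵗ) ∘ᵗ (αᵗ ∘ᵗ (σᵗ ⊗ᵗ idᵗ))) λ a b →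
    (λ { (_ , (_ , refl , refl) , refl) → _ , (_ , (refl , refl) , refl) , (refl , refl) })
    , (λ { (_ , (_ , (refl , refl) , refl) , (refl , refl)) → _ , (_ , refl , refl) , refl })
  ≈-chain σ-inv = exactly (σᵗ ∘ᵗ σᵗ) idᵗ λ a b → (λ { (_ , refl , refl) → refl }) , (λ { refl → _ , refl , refl })
  ≈-chain (cur-resp p) = gmap curᵗ (λ s → joint (hom-pick (hom-cur (both s)) (λ { _ (_ , _) → iff }) (λ { _ (_ , _) → iff }))) (≈-chain p)
  ≈-chain (eval-β {f = f}) = exactly (evalᵗ ∘ᵗ (curᵗ f ⊗ᵗ idᵗ)) f λ a b →
    (λ { (_ , (r , refl) , refl , refl) → r }) , (λ r → _ , (r , refl) , refl , refl)
  ≈-chain (eval-η {g = g}) = exactly (curᵗ (evalᵗ ∘ᵗ (g ⊗ᵗ idᵗ))) g λ a b →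
    (λ { (_ , (r , refl) , refl , refl) → r }) , (λ r → _ , (r , refl) , refl , refl)
  ≈-chain (dual-isoˡ {A}) = exactly (dualᵗ ∘ᵗ curᵗ (evalᵗ ∘ᵗ σᵗ)) idᵗ λ a b →
    (λ { (_ , (_ , refl , refl , refl) , refl , _) → refl }) , (λ { refl → _ , (_ , refl , refl , refl) , refl , refl })
  -- The sides differ in the labels of both ⊥'s. Transposed, the map starts from a tensor with `𝟏ˢ`:
  -- the outer label is removed by `hom-unitʳ`, the inner one by another `hom-unitʳ` under
  -- `hom-dual`.
  ≈-chain (dual-isoʳ {A}) = return (joint (hom-pick
    (hom-dualˡ {A = (tr A ⊸ˢ ⊥ˢ) ⊸ˢ ⊥ˢ} {B = (tr A ⊸ˢ ⊥ˢ) ⊗ˢ 𝟏ˢ}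
      (hom-unitʳ {R = λ i x y → pick (⟦ curᵗ (evalᵗ {A = A} {B = ⊥'} ∘ᵗ σᵗ) ∘ᵗ dualᵗ {A} ⟧ᵗ) _≡_ i y x}
                 {Q = λ i x y → pick (λ { (a , i) ((a' , j) , j') → a ≡ a' × j ≡ lab (Signed.skel (tr A)) a }) (λ { x (y , _) → x ≡ y }) i x y}
        (λ { true (a , i) ((a' , j) , j') → (λ { (refl , refl) → _ , _ , (refl , refl) , _ , refl , refl , refl })
                                          , (λ { _ (_ , (refl , refl) , _ , refl , refl , refl) → refl , refl })
           ; false a b → (λ { refl → _ , refl }) , (λ { _ refl → refl }) })
        (hom-pick (hom-comp
            (hom-dual {R = pick (λ { (a , j) (a' , i) → a ≡ a' × j ≡ lab (Signed.skel (tr A)) a }) _≡_} (hom-unitʳ {tr A} {Q = λ { i a (a' , _) → a ≡ a' }}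
              (λ { true a b → (λ { refl → _ , refl , refl }) , (λ { j (refl , _) → refl }) ; false a b → (λ { refl → _ , refl }) , (λ { j refl → refl }) })
              hom-ρ⇐))
            (hom-ρ⇐ {tr A ⊸ˢ ⊥ˢ}))
          (λ { (a , i) ((a' , j) , j') → (λ { (_ , (refl , refl) , refl) → refl , refl }) , (λ { (refl , refl) → _ , (refl , refl) , refl }) })
          (λ { x y → (λ { (_ , refl , refl) → refl }) , (λ { refl → _ , refl , refl }) }))))
    (λ _ _ → iff) (λ _ _ → iff)))
  ≈-chain bang-η = return (joint (bang-hom _))
  ≈-chain (fst-β {f = f} {g}) = exactly (fstᵗ ∘ᵗ pairᵗ f g) f λ a b → (λ { (_ , r , refl) → r }) , (λ r → inj₁ b , r , refl)
  ≈-chain (snd-β {f = f} {g}) = exactly (sndᵗ ∘ᵗ pairᵗ f g) g λ a b → (λ { (_ , r , refl) → r }) , (λ r → inj₂ b , r , refl)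
  ≈-chain (pair-resp {f = f} {f'} {g} {g'} p q) = transitive _~_
    (gmap (λ f → pairᵗ f g) (pair-~ˡ g) (≈-chain p)) (gmap (pairᵗ f') (pair-~ʳ f') (≈-chain q))
  ≈-chain (pair-η {h = h}) = exactly (pairᵗ (fstᵗ ∘ᵗ h) (sndᵗ ∘ᵗ h)) h λ
    { a (inj₁ b) → (λ { (_ , r , refl) → r }) , (λ r → _ , r , refl) ; a (inj₂ b) → (λ { (_ , r , refl) → r }) , (λ r → _ , r , refl) }

-- Totality, labels and coherence

dfltᵂ : ∀ Γ → W Γ
dfltᵂ [] = tt
dfltᵂ ((s , k) ∷ Γ) = dflt k true , dfltᵂ Γ

-- In the totality model 0 is generated by its single labels, so that an element of ⊤ has to reach
-- every label. Without generators a map into ⊤ could be empty.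
data PointGen : Fact Bool where
  ptG : ∀ j → PointGen [] (λ i x _ → x ≡ j)

Inhab : (Γ : Sequent) → (Ix → W Γ → Set) → Set₁
Inhab Γ R = Lift _ (∀ i → Σ _ (R i))

Inhab-resp : ∀ {Γ} {R S : Ix → W Γ → Set} → R ≐ S → Inhab Γ R → Inhab Γ S
Inhab-resp e (lift h) = lift λ i → proj₁ (h i) , proj₁ (e i _) (proj₂ (h i))

module T = Phase Inhab Inhab-resp (λ _ → OneGen) PointGen

module _ where
  open T
  pinE : ∀ s k → wk k → El (wk k) []
  pinE s k p i a _ = pin s k p a

  -- With these memberships, a total relation on `(s , k)` must relate some point of `pin s k p` to
  -- some point of `pin (flip s) k p`.
  pinᵛ : ∀ s k p → Val (s , k) [] (pinE s k p)
  pinᵛ ⊕ (lit n) p = val (gen {G = OneGen} one)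
  pinᵛ ⊖ (lit n) p = val λ { one s → perp (lift λ i → dfltᵂ _ , p , tt , refl) }
  pinᵛ ⊕ unit p = val (gen {G = OneGen} one)
  pinᵛ ⊖ unit p = val λ { one s → perp (lift λ i → dfltᵂ _ , p , tt , refl) }
  pinᵛ ⊕ zero p = val (gen {G = PointGen} (ptG p))
  pinᵛ ⊖ zero p = val λ { (ptG j) s → perp (lift λ i → dfltᵂ _ , j , refl , tt) }
  pinᵛ ⊕ (tens (r , k) (t , l)) (p , q) = pairᵛ (pinᵛ r k p) (pinᵛ t l q) []
  -- Orthogonality only asks for a point, so the points for the two components are found separately
  -- and joined.
  pinᵛ ⊖ (tens (r , k) (t , l)) (p , q) = par {r , k} {t , l} λ {Γ₁} {u} U {Γ₂} {v} V z s →
    let h = lower (holds (pairing U (pinᵛ (flip r) k p) (all-left Γ₁)))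
        h' = lower (holds (pairing V (pinᵛ (flip t) l q) (all-left Γ₂)))
    in perp (lift λ i →
      let (γ , a , x , y) = h i
          (γ' , a' , x' , y') = h' i
          e₁ = ≡-trans (left-all Γ₁ γ) (≡-sym (≡-trans (cong (left z) (left-join s (join z γ γ') tt)) (left-join z γ γ')))
          e₂ = ≡-trans (left-all Γ₂ γ') (≡-sym (≡-trans (cong (right z) (left-join s (join z γ γ') tt)) (right-join z γ γ')))
      in join s (join z γ γ') tt , (a , a') , (subst (u i a) e₁ x , subst (v i a') e₂ x') , y , y')
  pinᵛ ⊕ (plus (r , k) (t , l)) (inj₁ p) = intro λ Y s → by
    (λ i ω → (λ { (a , x , y) → inj₁ a , x , y }) , (λ { (inj₁ a , x , y) → a , x , y ; (inj₂ a , () , y) }))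
    (pairing (pinᵛ r k p) (val (proj₁ (raw Y))) s)
  pinᵛ ⊕ (plus (r , k) (t , l)) (inj₂ q) = intro λ Y s → by
    (λ i ω → (λ { (a , x , y) → inj₂ a , x , y }) , (λ { (inj₂ a , x , y) → a , x , y ; (inj₁ a , () , y) }))
    (pairing (pinᵛ t l q) (val (proj₂ (raw Y))) s)
  pinᵛ ⊖ (plus (r , k) (t , l)) (inj₁ p) = val (raw (pinᵛ (flip r) k p) , raw (pinᵛ (flip t) l (dflt l (lab k p))))
  pinᵛ ⊖ (plus (r , k) (t , l)) (inj₂ q) = val (raw (pinᵛ (flip r) k (dflt k (lab l q))) , raw (pinᵛ (flip t) l q))

  bang-total : ∀ A → Hom A ⊤ˢ (con (bangʳ A))
  bang-total (s , k) = by-push {B = ⊤ˢ} λ {_} {u} U → val λ { (ptG j) z → perp (lift λ i →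
    let (ω , a , x , y) = lower (holds (pairing U (pinᵛ (flip s) k (dflt k j)) (swap z))) i
    in ω , j , refl , a , subst (u i a) (left-swap z ω) x , y) }

module TI = Interpret Inhab Inhab-resp (λ _ → OneGen) PointGen bang-total

-- `κ` erases the labels and keeps the additive resolution; `κ c k p ≡ κ c k q` expresses that `p`
-- and `q` have the same resolution.
κ : Bool → ∀ k → wk k → wk k
κ c (lit n) p = c
κ c unit p = c
κ c zero p = c
κ c (tens (_ , k) (_ , l)) (p , q) = κ c k p , κ c l q
κ c (plus (_ , k) _) (inj₁ p) = inj₁ (κ c k p)
κ c (plus _ (_ , l)) (inj₂ q) = inj₂ (κ c l q)

lab-κ : ∀ c k p → lab k (κ c k p) ≡ c
lab-κ c (lit n) p = refl
lab-κ c unit p = refl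
lab-κ c zero p = refl
lab-κ c (tens (_ , k) _) (p , _) = lab-κ c k p
lab-κ c (plus (_ , k) _) (inj₁ p) = lab-κ c k p
lab-κ c (plus _ (_ , l)) (inj₂ q) = lab-κ c l q

κ-dflt : ∀ c k d → κ c k (dflt k d) ≡ dflt k c
κ-dflt c (lit n) d = refl
κ-dflt c unit d = refl
κ-dflt c zero d = refl
κ-dflt c (tens (_ , k) (_ , l)) d = cong₂ _,_ (κ-dflt c k d) (κ-dflt c l d)
κ-dflt c (plus (_ , k) _) d = cong inj₁ (κ-dflt c k d)

pin-dflt : ∀ c s k d a → pin s k (κ c k (dflt k d)) a → pin s k (dflt k c) a
pin-dflt c s k d a = subst (λ p → pin s k p a) (κ-dflt c k d)

pin-κ : ∀ c s k p a → pin s k p a → pin s k (κ c k p) (κ c k a)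
pin-κ c ⊕ (lit n) p a h = tt
pin-κ c ⊖ (lit n) p a h = refl
pin-κ c ⊕ unit p a h = tt
pin-κ c ⊖ unit p a h = refl
pin-κ c ⊕ zero p a h = refl
pin-κ c ⊖ zero p a h = tt
pin-κ c ⊕ (tens (r , k) (t , l)) (p , q) (a , b) (g , h) = pin-κ c r k p a g , pin-κ c t l q b h
pin-κ c ⊖ (tens (r , k) (t , l)) (p , q) (a , b) (g , h) = pin-κ c (flip r) k p a g , pin-κ c (flip t) l q b h
pin-κ c ⊕ (plus (r , k) (t , l)) (inj₁ p) (inj₁ a) h = pin-κ c r k p a h
pin-κ c ⊕ (plus (r , k) (t , l)) (inj₂ q) (inj₂ b) h = pin-κ c t l q b h
pin-κ c ⊖ (plus (r , k) (t , l)) (inj₁ p) (inj₁ a) h = pin-κ c (flip r) k p a h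
pin-κ c ⊖ (plus (r , k) (t , l)) (inj₁ p) (inj₂ b) h rewrite lab-κ c k p =
  pin-dflt c (flip t) l (lab k p) _ (pin-κ c (flip t) l _ b h)
pin-κ c ⊖ (plus (r , k) (t , l)) (inj₂ q) (inj₁ a) h rewrite lab-κ c l q =
  pin-dflt c (flip r) k (lab l q) _ (pin-κ c (flip r) k _ a h)
pin-κ c ⊖ (plus (r , k) (t , l)) (inj₂ q) (inj₂ b) h = pin-κ c (flip t) l q b h

-- At a ⊕ the positive realiser has already committed to the branch of `p`, and the negative one
-- follows `p` in that branch; only where they meet is the resolution forced. At leaves there is
-- nothing to prove because labels are erased. The negative cases exchange `a` and `b`.
pin-meet : ∀ c s k p a b → pin s k p a → pin (flip s) k p b → κ c k a ≡ κ c k b → κ c k a ≡ κ c k p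
pin-meet c s (lit n) p a b g h e = refl
pin-meet c s unit p a b g h e = refl
pin-meet c s zero p a b g h e = refl
pin-meet c ⊕ (tens (r , k) (t , l)) (p , q) (a , a') (b , b') (g , g') (h , h') e =
  cong₂ _,_ (pin-meet c r k p a b g h (,-injˡ e)) (pin-meet c t l q a' b' g' h' (,-injʳ e))
pin-meet c ⊖ (tens (r , k) (t , l)) (p , q) (a , a') (b , b') (g , g') (h , h') e =
  cong₂ _,_ (≡-trans (,-injˡ e) (pin-meet c r k p b a h g (≡-sym (,-injˡ e))))
            (≡-trans (,-injʳ e) (pin-meet c t l q b' a' h' g' (≡-sym (,-injʳ e))))
pin-meet c ⊕ (plus (r , k) (t , l)) (inj₁ p) (inj₁ a) (inj₁ b) g h e = cong inj₁ (pin-meet c r k p a b g h (inj₁-injective e))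
pin-meet c ⊕ (plus (r , k) (t , l)) (inj₁ p) (inj₁ a) (inj₂ b) g h ()
pin-meet c ⊕ (plus (r , k) (t , l)) (inj₂ q) (inj₂ a) (inj₂ b) g h e = cong inj₂ (pin-meet c t l q a b g h (inj₂-injective e))
pin-meet c ⊕ (plus (r , k) (t , l)) (inj₂ q) (inj₂ a) (inj₁ b) g h ()
pin-meet c ⊖ (plus (r , k) (t , l)) (inj₁ p) (inj₁ a) (inj₁ b) g h e =
  ≡-trans e (cong inj₁ (pin-meet c r k p b a h g (≡-sym (inj₁-injective e))))
pin-meet c ⊖ (plus (r , k) (t , l)) (inj₁ p) (inj₂ a) (inj₁ b) g h ()
pin-meet c ⊖ (plus (r , k) (t , l)) (inj₁ p) a (inj₂ b) g () e
pin-meet c ⊖ (plus (r , k) (t , l)) (inj₂ q) (inj₂ a) (inj₂ b) g h e =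
  ≡-trans e (cong inj₂ (pin-meet c t l q b a h g (≡-sym (inj₂-injective e))))
pin-meet c ⊖ (plus (r , k) (t , l)) (inj₂ q) (inj₁ a) (inj₂ b) g h ()
pin-meet c ⊖ (plus (r , k) (t , l)) (inj₂ q) a (inj₁ b) g () e

-- Coherence-space semantics: coh k is coherence in (⊕ , k), and incoherent points of (⊕ , k) are coherent in (⊖ , k).
signed : ∀ {X : Set} → Sign → (X → X → Set) → X → X → Set
signed ⊕ C p q = C p q
signed ⊖ C p q = C p q → p ≡ q

coh : ∀ k → wk k → wk k → Set
coh (lit n) p q = ⊤
coh unit p q = ⊤
coh zero p q = p ≡ q
coh (tens (r , k) (t , l)) (p , q) (p' , q') = signed r (coh k) p p' × signed t (coh l) q q'
coh (plus (r , k) (t , l)) (inj₁ p) (inj₁ p') = signed r (coh k) p p'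
coh (plus (r , k) (t , l)) (inj₁ p) (inj₂ q') = ⊥
coh (plus (r , k) (t , l)) (inj₂ q) (inj₁ p') = ⊥
coh (plus (r , k) (t , l)) (inj₂ q) (inj₂ q') = signed t (coh l) q q'

Coh : ∀ A → web A → web A → Set
Coh (s , k) = signed s (coh k)

wk-≟ : ∀ k (p q : wk k) → Dec (p ≡ q)
wk-≟ (lit n) = _≟ᵇ_
wk-≟ unit = _≟ᵇ_
wk-≟ zero = _≟ᵇ_
wk-≟ (tens (_ , k) (_ , l)) = ×-≡-dec (wk-≟ k) (wk-≟ l)
wk-≟ (plus (_ , k) (_ , l)) = ⊎-≡-dec (wk-≟ k) (wk-≟ l)

coh? : ∀ k p q → Dec (coh k p q)
signed? : ∀ s k p q → Dec (signed s (coh k) p q)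
signed? ⊕ k p q = coh? k p q
signed? ⊖ k p q with wk-≟ k p q | coh? k p q
... | yes e | _ = yes λ _ → e
... | no ¬e | yes c = no λ h → ¬e (h c)
... | no ¬e | no ¬c = yes λ c → ⊥-elim (¬c c)
coh? (lit n) p q = yes tt
coh? unit p q = yes tt
coh? zero p q = p ≟ᵇ q
coh? (tens (r , k) (t , l)) (p , q) (p' , q') = signed? r k p p' ×-dec signed? t l q q'
coh? (plus (r , k) (t , l)) (inj₁ p) (inj₁ p') = signed? r k p p'
coh? (plus (r , k) (t , l)) (inj₁ p) (inj₂ q') = no λ ()
coh? (plus (r , k) (t , l)) (inj₂ q) (inj₁ p') = no λ ()
coh? (plus (r , k) (t , l)) (inj₂ q) (inj₂ q') = signed? t l q q'

coh-refl : ∀ k p → coh k p p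
signed-refl : ∀ s k p → signed s (coh k) p p
signed-refl ⊕ k p = coh-refl k p
signed-refl ⊖ k p = λ _ → refl
coh-refl (lit n) p = tt
coh-refl unit p = tt
coh-refl zero p = refl
coh-refl (tens (r , k) (t , l)) (p , q) = signed-refl r k p , signed-refl t l q
coh-refl (plus (r , k) (t , l)) (inj₁ p) = signed-refl r k p
coh-refl (plus (r , k) (t , l)) (inj₂ q) = signed-refl t l q

Coh-refl : ∀ A p → Coh A p p
Coh-refl (s , k) = signed-refl s k

Coh-excl : ∀ A {p q} → Coh A p q → Coh (dual A) p q → p ≡ q
Coh-excl (⊕ , k) c d = d c
Coh-excl (⊖ , k) c d = c d

Coh-dich : ∀ A p q → Coh A p q ⊎ Coh (dual A) p q
Coh-dich (s , k) p q with coh? k p q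
Coh-dich (⊕ , k) p q | yes c = inj₁ c
Coh-dich (⊖ , k) p q | yes c = inj₂ c
Coh-dich (⊕ , k) p q | no ¬c = inj₂ λ c → ⊥-elim (¬c c)
Coh-dich (⊖ , k) p q | no ¬c = inj₁ λ c → ⊥-elim (¬c c)

Coh-or : ∀ A {p q} → (Coh (dual A) p q → p ≡ q) → Coh A p q
Coh-or A {p} {q} h with Coh-dich A p q
... | inj₁ c = c
... | inj₂ d = subst (Coh A p) (h d) (Coh-refl A p)

-- Cliques of the coherence space of maps from `A` to `B`; the second clause makes the relation
-- injective on coherent points.
Clique : ∀ A B → (web A → web B → Set) → Set
Clique A B R = ∀ {a b a' b'} → R a b → R a' b' → Coh A a a' → Coh B b b' × (b ≡ b' → a ≡ a')

pin-clique : ∀ s k p {a a'} → pin s k p a → pin s k p a' → signed s (coh k) a a'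
pin-clique ⊕ (lit n) p g h = tt
pin-clique ⊖ (lit n) p g h = λ _ → ≡-trans g (≡-sym h)
pin-clique ⊕ unit p g h = tt
pin-clique ⊖ unit p g h = λ _ → ≡-trans g (≡-sym h)
pin-clique ⊕ zero p g h = ≡-trans g (≡-sym h)
pin-clique ⊖ zero p g h = λ c → c
pin-clique ⊕ (tens (r , k) (t , l)) (p , q) (g , g') (h , h') = pin-clique r k p g h , pin-clique t l q g' h'
pin-clique ⊖ (tens (r , k) (t , l)) (p , q) (g , g') (h , h') = λ { (c , d) →
  cong₂ _,_ (Coh-excl (r , k) c (pin-clique (flip r) k p g h)) (Coh-excl (t , l) d (pin-clique (flip t) l q g' h')) }
pin-clique ⊕ (plus (r , k) (t , l)) (inj₁ p) {inj₁ a} {inj₁ a'} g h = pin-clique r k p g h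
pin-clique ⊕ (plus (r , k) (t , l)) (inj₂ q) {inj₂ a} {inj₂ a'} g h = pin-clique t l q g h
pin-clique ⊖ (plus (r , k) (t , l)) (inj₁ p) {inj₁ a} {inj₁ a'} g h = λ c → cong inj₁ (Coh-excl (r , k) c (pin-clique (flip r) k p g h))
pin-clique ⊖ (plus (r , k) (t , l)) (inj₁ p) {inj₁ a} {inj₂ a'} g h = λ ()
pin-clique ⊖ (plus (r , k) (t , l)) (inj₁ p) {inj₂ a} {inj₁ a'} g h = λ ()
pin-clique ⊖ (plus (r , k) (t , l)) (inj₁ p) {inj₂ a} {inj₂ a'} g h = λ c → cong inj₂ (Coh-excl (t , l) c (pin-clique (flip t) l _ g h))
pin-clique ⊖ (plus (r , k) (t , l)) (inj₂ q) {inj₁ a} {inj₁ a'} g h = λ c → cong inj₁ (Coh-excl (r , k) c (pin-clique (flip r) k _ g h))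
pin-clique ⊖ (plus (r , k) (t , l)) (inj₂ q) {inj₁ a} {inj₂ a'} g h = λ ()
pin-clique ⊖ (plus (r , k) (t , l)) (inj₂ q) {inj₂ a} {inj₁ a'} g h = λ ()
pin-clique ⊖ (plus (r , k) (t , l)) (inj₂ q) {inj₂ a} {inj₂ a'} g h = λ c → cong inj₂ (Coh-excl (t , l) c (pin-clique (flip t) l q g h))

Uniform : ∀ A B → (web A → web B → Set) → Set
Uniform (_ , k) (_ , l) R = ∀ c a b → R a b → R (κ c k a) (κ c l b)

-- Joint realisation does not transfer totality, uniformity or coherence from one relation to
-- another; so every relation in a chain carries its own.
record Arrow (A B : Signed) : Set₁ where
  field
    rel : web A → web B → Set
    valid : P.Hom A B (con rel)
    total : T.Hom A B (con rel)
    uniform : Uniform A B rel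
    clique : Clique A B rel
open Arrow

idᵃ : ∀ {A} → Arrow A A
idᵃ = record { rel = _≡_ ; valid = P.hom-id ; total = T.hom-id ; uniform = λ { c a b refl → refl } ; clique = λ { refl refl c → c , λ e → e } }

infixl 5 _⨟_
_⨟_ : ∀ {A B C} → Arrow A B → Arrow B C → Arrow A C
_⨟_ {A} {B} {C} f g = record
  { rel = (con (rel f) ⨾ con (rel g)) tt ; valid = P.hom-comp (valid f) (valid g) ; total = T.hom-comp (total f) (total g)
  ; uniform = λ { c a b (d , r , s) → κ c _ d , uniform f c a d r , uniform g c d b s }
  ; clique = λ { (d , r , s) (d' , r' , s') c → let (c₁ , i₁) = clique f r r' c ; (c₂ , i₂) = clique g s s' c₁ in c₂ , λ e → i₁ (i₂ e) } }

_⊠ᵃ_ : ∀ {A B A' B'} → Arrow A A' → Arrow B B' → Arrow (A ⊗ˢ B) (A' ⊗ˢ B')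
f ⊠ᵃ g = record
  { rel = (con (rel f) ⊠ con (rel g)) tt ; valid = P.hom-tens (valid f) (valid g) ; total = T.hom-tens (total f) (total g)
  ; uniform = λ { c (a , b) (a' , b') (r , s) → uniform f c a a' r , uniform g c b b' s }
  ; clique = λ { (r , s) (r' , s') (c , d) → let (c₁ , i₁) = clique f r r' c ; (c₂ , i₂) = clique g s s' d
                 in (c₁ , c₂) , λ e → cong₂ _,_ (i₁ (,-injˡ e)) (i₂ (,-injʳ e)) } }

_⊞ᵃ_ : ∀ {A B A' B'} → Arrow A A' → Arrow B B' → Arrow (⊕ , plus A B) (⊕ , plus A' B')
f ⊞ᵃ g = record
  { rel = (con (rel f) ⊞ con (rel g)) tt
  ; valid = P.Hom-resp (λ { i (inj₁ _) (inj₁ _) → iff ; i (inj₁ _) (inj₂ _) → iff ; i (inj₂ _) (inj₁ _) → iff ; i (inj₂ _) (inj₂ _) → iff })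
      (P.hom-plus (valid f) (valid g))
  ; total = T.Hom-resp (λ { i (inj₁ _) (inj₁ _) → iff ; i (inj₁ _) (inj₂ _) → iff ; i (inj₂ _) (inj₁ _) → iff ; i (inj₂ _) (inj₂ _) → iff })
      (T.hom-plus (total f) (total g))
  ; uniform = λ { c (inj₁ a) (inj₁ b) r → uniform f c a b r ; c (inj₂ a) (inj₂ b) r → uniform g c a b r }
  ; clique = λ { {inj₁ a} {inj₁ b} {inj₁ a'} {inj₁ b'} r r' c → let (c₁ , i₁) = clique f r r' c in c₁ , λ e → cong inj₁ (i₁ (inj₁-injective e))
               ; {inj₂ a} {inj₂ b} {inj₂ a'} {inj₂ b'} r r' c → let (c₁ , i₁) = clique g r r' c in c₁ , λ e → cong inj₂ (i₁ (inj₂-injective e)) } }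

Coh-dd : ∀ A {p q} → Coh (dual (dual A)) p q → Coh A p q
Coh-dd (⊕ , k) c = c
Coh-dd (⊖ , k) c = c

dualᵃ : ∀ {A B} → Arrow A B → Arrow (dual B) (dual A)
dualᵃ {A} {B} f = record
  { rel = λ b a → rel f a b ; valid = P.hom-dual (valid f) ; total = T.hom-dual (total f)
  ; uniform = λ c b a r → uniform f c a b r
  ; clique = λ {b} {a} {b'} {a'} r r' c →
      let inj : Coh A a a' → a ≡ a'
          inj d = proj₂ (clique f r r' d) (Coh-excl B (proj₁ (clique f r r' d)) c)
      in Coh-or (dual A) (λ d → inj (Coh-dd A d))
       , λ e → Coh-excl B (proj₁ (clique f r r' (subst (Coh A a) e (Coh-refl A a)))) c }

ρ⇒ᵃ : ∀ {A} → Arrow (A ⊗ˢ 𝟏ˢ) A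
ρ⇒ᵃ {A} = record
  { rel = rho⇒ A true ; valid = P.hom-ρ⇒ ; total = T.hom-ρ⇒
  ; uniform = λ { c (a , j) b (refl , refl) → refl , ≡-sym (lab-κ c _ a) }
  ; clique = λ { (refl , refl) (refl , refl) (c , _) → c , λ { refl → refl } } }

ρ⇐ᵃ : ∀ {A} → Arrow A (A ⊗ˢ 𝟏ˢ)
ρ⇐ᵃ {A} = record
  { rel = rho⇐ A true ; valid = P.hom-ρ⇐ ; total = T.hom-ρ⇐
  ; uniform = λ { c a (.a , j) refl → refl }
  ; clique = λ { refl refl c → (c , tt) , λ e → ,-injˡ e } }

termᵃ : ∀ {A B} → Term A B → Arrow (tr A) (tr B)
termᵃ t = record { rel = ⟦ t ⟧ᵗ ; valid = PI.⟦⟧-hom t ; total = TI.⟦⟧-hom t ; uniform = unf t ; clique = clq t }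
  where
  module PI = Interpret K K-resp LitGen NoGen (λ A → bang-hom A)
  unf : ∀ {A B} (t : Term A B) → Uniform (tr A) (tr B) ⟦ t ⟧ᵗ
  unf idᵗ c a b refl = refl
  unf (g ∘ᵗ f) c a b (d , r , s) = κ c _ d , unf f c a d r , unf g c d b s
  unf (f ⊗ᵗ g) c (a , a') (b , b') (r , s) = unf f c a b r , unf g c a' b' s
  unf αᵗ c _ _ refl = refl
  unf α⁻ᵗ c _ _ refl = refl
  unf (λᵗ {A}) c (j , a) b (refl , refl) = refl , ≡-sym (lab-κ c _ a)
  unf λ⁻ᵗ c a (j , b) refl = refl
  unf (ρᵗ {A}) c (a , j) b (refl , refl) = refl , ≡-sym (lab-κ c _ a)
  unf ρ⁻ᵗ c a (b , j) refl = refl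
  unf σᵗ c _ _ refl = refl
  unf evalᵗ c ((a , b) , a') b' (refl , refl) = refl , refl
  unf (curᵗ f) c a (b , d) r = unf f c (a , b) d r
  unf (dualᵗ {A}) c ((a , j) , j') a' (refl , refl) = refl , ≡-sym (lab-κ c _ a)
  unf (bangᵗ {A}) c a t r = pin-dflt c (flip (Signed.sign (tr A))) (Signed.skel (tr A)) t (κ c _ a) (pin-κ c (flip (Signed.sign (tr A))) (Signed.skel (tr A)) (dflt _ t) a r)
  unf fstᵗ c _ a refl = refl
  unf sndᵗ c _ b refl = refl
  unf (pairᵗ f g) c a (inj₁ b) r = unf f c a b r
  unf (pairᵗ f g) c a (inj₂ b) r = unf g c a b r
  clq : ∀ {A B} (t : Term A B) → Clique (tr A) (tr B) ⟦ t ⟧ᵗ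
  clq idᵗ refl refl c = c , λ e → e
  clq (g ∘ᵗ f) (d , r , s) (d' , r' , s') c = let (c₁ , i₁) = clq f r r' c ; (c₂ , i₂) = clq g s s' c₁ in c₂ , λ e → i₁ (i₂ e)
  clq (f ⊗ᵗ g) (r , s) (r' , s') (c , d) = let (c₁ , i₁) = clq f r r' c ; (c₂ , i₂) = clq g s s' d
    in (c₁ , c₂) , λ e → cong₂ _,_ (i₁ (,-injˡ e)) (i₂ (,-injʳ e))
  clq αᵗ refl refl ((c , d) , e) = (c , d , e) , λ { refl → refl }
  clq α⁻ᵗ refl refl (c , d , e) = ((c , d) , e) , λ { refl → refl }
  clq λᵗ (refl , refl) (refl , refl) (_ , c) = c , λ { refl → refl }
  clq λ⁻ᵗ refl refl c = (tt , c) , λ e → ,-injʳ e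
  clq ρᵗ (refl , refl) (refl , refl) (c , _) = c , λ { refl → refl }
  clq ρ⁻ᵗ refl refl c = (c , tt) , λ e → ,-injˡ e
  clq σᵗ refl refl (c , d) = (d , c) , λ { refl → refl }
  clq (evalᵗ {A} {B}) {(a , b) , _} {_} {(a' , b') , _} (refl , refl) (refl , refl) (h , c) =
    Coh-or (tr B) (λ d → ,-injʳ (h (c , d)))
    , λ { refl → cong (λ x → x , proj₁ x) (h (c , Coh-refl (dual (tr B)) b)) }
  clq (curᵗ {A} {B} f) {c} {a , b} {c'} {a' , b'} r r' h =
    (λ { (d , e) → let (g , i) = clq f r r' (h , d) in cong₂ _,_ (,-injʳ (i (Coh-excl (tr B) g e))) (Coh-excl (tr B) g e) })
    , λ { refl → ,-injˡ (proj₂ (clq f r r' (h , Coh-refl (tr A) a)) refl) }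
  clq (dualᵗ {A}) {(a , j) , i} {_} {(a' , j') , i'} (refl , refl) (refl , refl) h =
    Coh-or (tr A) (λ d → cong (λ x → proj₁ (proj₁ x)) (h ((λ { (c , _) → cong (λ a → a , lab _ a) (Coh-excl (tr A) c d) }) , tt)))
    , λ { refl → h ((λ _ → refl) , tt) }
  clq (bangᵗ {A}) {a} {t} {a'} {t'} r r' c = (λ e → e) , λ { refl → Coh-excl (tr A) c (pin-clique (flip (Signed.sign (tr A))) (Signed.skel (tr A)) (dflt _ t) r r') }
  clq (fstᵗ {A} {B}) refl refl c = Coh-or (tr A) (λ d → inj₁-injective (c d)) , λ { refl → refl }
  clq (sndᵗ {A} {B}) refl refl c = Coh-or (tr B) (λ d → inj₂-injective (c d)) , λ { refl → refl }
  clq (pairᵗ {A} {B} f g) {a} {inj₁ b} {a'} {inj₁ b'} r r' c = let (c₁ , i₁) = clq f r r' c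
    in (λ d → cong inj₁ (Coh-excl (tr A) c₁ d)) , λ e → i₁ (inj₁-injective e)
  clq (pairᵗ {A} {B} f g) {a} {inj₁ b} {a'} {inj₂ b'} r r' c = (λ ()) , λ ()
  clq (pairᵗ {A} {B} f g) {a} {inj₂ b} {a'} {inj₁ b'} r r' c = (λ ()) , λ ()
  clq (pairᵗ {A} {B} f g) {a} {inj₂ b} {a'} {inj₂ b'} r r' c = let (c₁ , i₁) = clq g r r' c
    in (λ d → cong inj₂ (Coh-excl (tr B) c₁ d)) , λ e → i₁ (inj₂-injective e)

record _≃¹_ {A B : Signed} (f g : Arrow A B) : Set₁ where
  constructor together
  field both : P.Hom A B (pick (rel f) (rel g))
open _≃¹_

infix 4 _≃_
_≃_ : ∀ {A B} → Arrow A B → Arrow A B → Set₁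
_≃_ = EqClosure _≃¹_

term-chain : ∀ {A B} {f g : Term A B} → f ≈ᵗ g → termᵃ f ≃ termᵃ g
term-chain p = gmap termᵃ (λ s → together (_~_.both s)) (≈-chain p)

≃-exact : ∀ {A B} (f g : Arrow A B) → (∀ a b → Iff (rel f a b) (rel g a b)) → f ≃ g
≃-exact f g e = return (together (hom-pick (valid f) (λ _ _ → iff) e))

≃-comp : ∀ {A B C D} (f : Arrow A B) {g g' : Arrow B C} (h : Arrow C D) → g ≃ g' → f ⨟ g ⨟ h ≃ f ⨟ g' ⨟ h
≃-comp f h = gmap (λ g → f ⨟ g ⨟ h) (λ s → together (hom-pick (P.hom-comp (P.hom-comp (valid f) (both s)) (valid h)) (λ _ _ → iff) (λ _ _ → iff)))

-- X is N with superfluous units, whose labels are invisible from N.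
record Retract (X N : Signed) : Set₁ where
  field
    up : Arrow X N
    down : Arrow N X
    retract : ∀ a b → Iff (rel (down ⨟ up) a b) (a ≡ b)
    section : up ⨟ down ≃ idᵃ

module R = Retract

id-ret : ∀ {A} → Retract A A
id-ret = record { up = idᵃ ; down = idᵃ ; retract = λ a b → (λ { (_ , refl , refl) → refl }) , (λ { refl → _ , refl , refl })
  ; section = ≃-exact (idᵃ ⨟ idᵃ) idᵃ λ a b → (λ { (_ , refl , refl) → refl }) , (λ { refl → _ , refl , refl }) }

comp-ret : ∀ {A B C} → Retract A B → Retract B C → Retract A C
comp-ret p q = record
  { up = R.up p ⨟ R.up q ; down = R.down q ⨟ R.down p
  ; retract = λ a b → (λ { (_ , (x , r , s) , (y , t , u)) → proj₁ (R.retract q a b) (x , r , subst (λ z → rel (R.up q) z b) (≡-sym (proj₁ (R.retract p x y) (_ , s , t))) u) })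
                    , (λ e → let (x , r , u) = proj₂ (R.retract q a b) e ; (z , s , t) = proj₂ (R.retract p x x) refl in z , (x , r , s) , (x , t , u))
  ; section = transitive _≃¹_ (≃-exact _ (R.up p ⨟ (R.up q ⨟ R.down q) ⨟ R.down p)
        λ a b → (λ { (_ , (_ , r , s) , (_ , t , u)) → _ , (_ , r , _ , s , t) , u }) , (λ { (_ , (_ , r , _ , s , t) , u) → _ , (_ , r , s) , (_ , t , u) }))
      (transitive _≃¹_ (≃-comp (R.up p) (R.down p) (R.section q))
      (transitive _≃¹_ (≃-exact (R.up p ⨟ idᵃ ⨟ R.down p) (R.up p ⨟ R.down p)
        λ a b → (λ { (_ , (_ , r , refl) , s) → _ , r , s }) , (λ { (_ , r , s) → _ , (_ , r , refl) , s })) (R.section p))) }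

tens-ret : ∀ {A B A' B'} → Retract A A' → Retract B B' → Retract (A ⊗ˢ B) (A' ⊗ˢ B')
tens-ret p q = record
  { up = R.up p ⊠ᵃ R.up q ; down = R.down p ⊠ᵃ R.down q
  ; retract = λ a b → (λ { (_ , (r , s) , (t , u)) → cong₂ _,_ (proj₁ (R.retract p _ _) (_ , r , t)) (proj₁ (R.retract q _ _) (_ , s , u)) })
                    , (λ { refl → let (_ , r , t) = proj₂ (R.retract p _ _) refl ; (_ , s , u) = proj₂ (R.retract q _ _) refl in _ , (r , s) , (t , u) })
  ; section = transitive _≃¹_ (≃-exact _ ((R.up p ⨟ R.down p) ⊠ᵃ (R.up q ⨟ R.down q))
        λ a b → (λ { (_ , (r , s) , (t , u)) → (_ , r , t) , _ , s , u }) , (λ { ((_ , r , t) , _ , s , u) → _ , (r , s) , (t , u) }))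
      (transitive _≃¹_ (gmap (_⊠ᵃ (R.up q ⨟ R.down q)) (λ s → together (hom-pick (P.hom-tens (both s) (valid (R.up q ⨟ R.down q))) (λ _ _ → iff) (λ _ _ → iff))) (R.section p))
      (transitive _≃¹_ (gmap (idᵃ ⊠ᵃ_) (λ s → together (hom-pick (P.hom-tens P.hom-id (both s)) (λ _ _ → iff) (λ _ _ → iff))) (R.section q))
      (≃-exact (idᵃ ⊠ᵃ idᵃ) idᵃ λ a b → (λ { (refl , refl) → refl }) , (λ { refl → refl , refl })))) }

⊞-iff : ∀ {X Y X' Y' : Set} {R : Ix → X → Y → Set} {S : Ix → X' → Y' → Set} {i} a b →
  Iff ((R ⊞ S) i a b) ((con (R i) ⊞ con (S i)) tt a b)
⊞-iff (inj₁ a) (inj₁ b) = iff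
⊞-iff (inj₁ a) (inj₂ b) = iff
⊞-iff (inj₂ a) (inj₁ b) = iff
⊞-iff (inj₂ a) (inj₂ b) = iff

plus-ret : ∀ {A B A' B'} → Retract A A' → Retract B B' → Retract (⊕ , plus A B) (⊕ , plus A' B')
plus-ret {A} {B} p q = record
  { up = R.up p ⊞ᵃ R.up q ; down = R.down p ⊞ᵃ R.down q
  ; retract = λ { (inj₁ a) (inj₁ b) → (λ { (inj₁ _ , r , t) → cong inj₁ (proj₁ (R.retract p _ _) (_ , r , t)) })
                                   , (λ e → let (_ , r , t) = proj₂ (R.retract p a b) (inj₁-injective e) in inj₁ _ , r , t)
                ; (inj₁ a) (inj₂ b) → (λ { (inj₁ _ , r , ()) ; (inj₂ _ , () , t) }) , (λ ())
                ; (inj₂ a) (inj₁ b) → (λ { (inj₁ _ , () , t) ; (inj₂ _ , r , ()) }) , (λ ())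
                ; (inj₂ a) (inj₂ b) → (λ { (inj₂ _ , r , t) → cong inj₂ (proj₁ (R.retract q _ _) (_ , r , t)) })
                                   , (λ e → let (_ , r , t) = proj₂ (R.retract q a b) (inj₂-injective e) in inj₂ _ , r , t) }
  ; section = transitive _≃¹_ (≃-exact _ ((R.up p ⨟ R.down p) ⊞ᵃ (R.up q ⨟ R.down q))
        λ { (inj₁ a) (inj₁ b) → (λ { (inj₁ _ , r , t) → _ , r , t }) , (λ { (_ , r , t) → inj₁ _ , r , t })
          ; (inj₁ a) (inj₂ b) → (λ { (inj₁ _ , r , ()) ; (inj₂ _ , () , t) }) , (λ ())
          ; (inj₂ a) (inj₁ b) → (λ { (inj₁ _ , () , t) ; (inj₂ _ , r , ()) }) , (λ ())
          ; (inj₂ a) (inj₂ b) → (λ { (inj₂ _ , r , t) → _ , r , t }) , (λ { (_ , r , t) → inj₂ _ , r , t }) })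
      (transitive _≃¹_ (gmap (_⊞ᵃ (R.up q ⨟ R.down q)) (λ s → together (hom-pick (P.hom-plus (both s) (valid (R.up q ⨟ R.down q))) ⊞-iff ⊞-iff)) (R.section p))
      (transitive _≃¹_ (gmap (idᵃ ⊞ᵃ_) (λ s → together (hom-pick (P.hom-plus P.hom-id (both s)) ⊞-iff ⊞-iff)) (R.section q))
      (≃-exact (idᵃ {A} ⊞ᵃ idᵃ {B}) idᵃ λ
        { (inj₁ a) (inj₁ b) → cong inj₁ , inj₁-injective ; (inj₁ a) (inj₂ b) → (λ ()) , (λ ())
        ; (inj₂ a) (inj₁ b) → (λ ()) , (λ ()) ; (inj₂ a) (inj₂ b) → cong inj₂ , inj₂-injective }))) }

dual-ret : ∀ {X N} → Retract X N → Retract (dual X) (dual N)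
dual-ret p = record
  { up = dualᵃ (R.down p) ; down = dualᵃ (R.up p)
  ; retract = λ a b → (λ { (_ , r , s) → ≡-sym (proj₁ (R.retract p _ _) (_ , s , r)) }) , (λ { refl → let (_ , s , r) = proj₂ (R.retract p _ _) refl in _ , r , s })
  ; section = transitive _≃¹_ (≃-exact _ (dualᵃ (R.up p ⨟ R.down p)) λ a b → (λ { (_ , r , s) → _ , s , r }) , (λ { (_ , s , r) → _ , r , s }))
      (transitive _≃¹_ (gmap dualᵃ (λ s → together (hom-pick (P.hom-dual (both s)) (λ _ _ → iff) (λ _ _ → iff))) (R.section p))
      (≃-exact (dualᵃ idᵃ) idᵃ λ a b → ≡-sym , ≡-sym)) }

ρ-ret : ∀ {A} → Retract (A ⊗ˢ 𝟏ˢ) A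
ρ-ret {A} = record
  { up = ρ⇒ᵃ ; down = ρ⇐ᵃ
  ; retract = λ a b → (λ { (_ , refl , refl , _) → refl }) , (λ { refl → _ , refl , refl , refl })
  ; section = return (together (hom-pick (P.hom-unitʳ {R = pick (rel (ρ⇒ᵃ {A} ⨟ ρ⇐ᵃ)) _≡_}
      (λ { true a b → (λ { refl → _ , _ , (refl , refl) , refl }) , (λ { j (_ , (refl , _) , refl) → refl })
         ; false a b → (λ { refl → _ , refl }) , (λ { j refl → refl }) }) P.hom-ρ⇐) (λ _ _ → iff) (λ _ _ → iff))) }

embˢ : Sign → Skeleton → Formula
embᵏ : Skeleton → Formula
embˢ ⊕ k = embᵏ k
embˢ ⊖ k = embᵏ k ⊸ ⊥'
embᵏ (lit n) = atom n
embᵏ unit = 𝟏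
embᵏ zero = ⊤' ⊸ ⊥'
embᵏ (tens (r , k) (t , l)) = embˢ r k ⊗ embˢ t l
embᵏ (plus (r , k) (t , l)) = ((embˢ r k ⊸ ⊥') & (embˢ t l ⊸ ⊥')) ⊸ ⊥'

emb : Signed → Formula
emb (s , k) = embˢ s k

-- `F ⊸ ⊥'` translates to the dual of `tr F ⊗ˢ 𝟏ˢ`, so reading a signed formula as a formula and
-- translating back inserts one unit per negation. `ρ-ret` removes it.
emb-ret : ∀ s k → Retract (tr (embˢ s k)) (s , k)
embᵏ-ret : ∀ k → Retract (tr (embᵏ k)) (⊕ , k)
emb-ret ⊕ k = embᵏ-ret k
emb-ret ⊖ k = dual-ret (comp-ret ρ-ret (embᵏ-ret k))
embᵏ-ret (lit n) = id-ret
embᵏ-ret unit = id-ret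
embᵏ-ret zero = dual-ret (ρ-ret {⊤ˢ})
embᵏ-ret (tens (r , k) (t , l)) = tens-ret (emb-ret r k) (emb-ret t l)
embᵏ-ret (plus (r , k) (t , l)) = comp-ret (dual-ret (ρ-ret {(tr (embˢ r k) ⊸ˢ ⊥ˢ) &ˢ (tr (embˢ t l) ⊸ˢ ⊥ˢ)}))
  (plus-ret (comp-ret ρ-ret (emb-ret r k)) (comp-ret ρ-ret (emb-ret t l)))

-- Focusing

distinct : ∀ k → Σ (wk k) λ p → Σ (wk k) λ q → p ≢ q
distinct (lit n) = true , false , λ ()
distinct unit = true , false , λ ()
distinct zero = true , false , λ ()
distinct (tens (_ , k) (_ , l)) = let (p , q , n) = distinct k in (p , dflt l true) , (q , dflt l true) , λ e → n (,-injˡ e)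
distinct (plus (_ , k) (_ , l)) = inj₁ (dflt k true) , inj₂ (dflt l true) , λ ()

-- Formulas on which no rule can act but a positive rule or an axiom.
Sync : Signed → Set
Sync (⊕ , k) = ⊤
Sync (⊖ , lit n) = ⊤
Sync (⊖ , _) = ⊥

sync-sel : ∀ {a Γ Δ} → Sel a Γ Δ → All Sync Γ → Sync a
sync-sel here (p ∷ _) = p
sync-sel (there s) (_ ∷ ps) = sync-sel s ps

-- Here `Y` is the web of the context: every point of it is reached, and by `Injᵒ` it is determined
-- by the point of the principal formula.
Totalᵒ : {X Y : Set} → (X → Y → Set) → Set
Totalᵒ {X} {Y} R = ∀ y → Σ X λ x → R x y

Injᵒ : {X Y : Set} → (X → Y → Set) → Set
Injᵒ R = ∀ {x y y'} → R x y → R x y' → y ≡ y'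

data Principal : (B : Signed) (Δ : Sequent) → (Ix → web B → W Δ → Set) → Set₁ where
  lit : ∀ {n R} → (∀ i b h → Iff (R i b h) (b ≡ proj₁ h)) → Principal (⊕ , lit n) ((⊖ , lit n) ∷ []) R
  ten : ∀ {a b Δ Δ₁ Δ₂ R S T} (q : Spl Δ Δ₁ Δ₂) → K (a ∷ Δ₁) S → K (b ∷ Δ₂) T →
        (∀ i p h → Iff (R i p h) (S i (proj₁ p , left q h) × T i (proj₂ p , right q h))) → Principal (⊕ , tens a b) Δ R
  pl₁ : ∀ {a b Δ R S} → K (a ∷ Δ) S → (∀ i p h → Iff (R i p h) (either (λ p → S i (p , h)) (λ _ → ⊥) p)) → Principal (⊕ , plus a b) Δ R
  pl₂ : ∀ {a b Δ R S} → K (b ∷ Δ) S → (∀ i p h → Iff (R i p h) (either (λ _ → ⊥) (λ p → S i (p , h)) p)) → Principal (⊕ , plus a b) Δ R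
  uni : ∀ {R} → Principal (⊕ , unit) [] R

curryᴿ : ∀ {X Y : Set} → (Ix → X × Y → Set) → Ix → X → Y → Set
curryᴿ R i x y = R i (x , y)

private
  -- A premise of a ⊗-rule that does not contain B would leave a coordinate undetermined by B.
  no-side : ∀ {X : Set} {c Γ Δ} {P Q : Set} (s : Sel c Γ Δ) (f : web c → P) (g : web c → Q) (u : P → Q → web c)
    {R : X → W Γ → Set} {S : P → W Δ → Set} {T : Q → X → W Δ → Set} →
    (∀ x h → Iff (R x h) (S (f (get s h)) (rem s h) × T (g (get s h)) x (rem s h))) →
    (∀ p q → f (u p q) ≡ p) → (∀ p q → g (u p q) ≡ q) → (p p' : P) → p ≢ p' → Q → W Δ → Totalᵒ R → Injᵒ R → ⊥
  no-side s f g u {R} {S} {T} e fu gu p p' n q r tot inj =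
    let h = ins s (u p q) r
        h' = ins s (u p' q) r
        (x , ρ) = tot h
        (x' , ρ') = tot h'
        (σ , τ) = proj₁ (e x h) ρ
        (σ' , _) = proj₁ (e x' h') ρ'
        eg : g (get s h) ≡ g (get s h')
        eg = ≡-trans (cong g (get-ins s _ _)) (≡-trans (gu p q) (≡-sym (≡-trans (cong g (get-ins s _ _)) (gu p' q))))
        er : rem s h ≡ rem s h'
        er = ≡-trans (rem-ins s _ _) (≡-sym (rem-ins s _ _))
        ρ″ = proj₂ (e x h') (subst (S _) refl σ' , subst₂ (λ q r → T q x r) eg er τ)
        eh = inj ρ ρ″
    in n (≡-trans (≡-sym (≡-trans (cong f (get-ins s _ _)) (fu p q)))
         (≡-trans (cong (λ h → f (get s h)) eh) (≡-trans (cong f (get-ins s _ _)) (fu p' q))))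

-- Rules for ⅋, &, ⊥ and ⊤ find nothing to act on. A ⊕-rule in the context would miss the discarded
-- summand, against totality; a ⊗-rule in the context has a premise without the principal formula,
-- against injectivity.
focus : ∀ {k Δ R} → All Sync Δ → Totalᵒ (curryᴿ R true) → Injᵒ (curryᴿ R true) → K ((⊕ , k) ∷ Δ) R → Principal (⊕ , k) Δ (curryᴿ R)
focus sy tot inj (ax₂ d) = lit λ i b h → d i (b , h)
focus sy tot inj (ten here q k l d) = ten q k l λ i p h → d i (p , h)
focus {R = R} sy tot inj (ten {r , m} {t , l′} {Δ₁ = Δ₁} {Δ₂} {S = S} {T} (there s) (lft q) k l d) =
  let (p , p' , n) = distinct l′ in
  -- The principal formula went to the first premise, so the second component of the tensor is
  -- varied; in the next clause the roles are exchanged.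
  ⊥-elim (no-side s proj₂ proj₁ (λ p q → q , p) {R = curryᴿ R true} {S = λ p δ → T true (p , right q δ)} {T = λ c x δ → S true (c , x , left q δ)}
    (λ x h → (λ ρ → let (σ , τ) = proj₁ (d true (x , h)) ρ in τ , σ) , (λ { (τ , σ) → proj₂ (d true (x , h)) (σ , τ) }))
    (λ _ _ → refl) (λ _ _ → refl) p p' n (dflt m true) (dfltᵂ _) tot inj)
focus {R = R} sy tot inj (ten {r , m} {t , l′} {Δ₁ = Δ₁} {Δ₂} {S = S} {T} (there s) (rgt q) k l d) =
  let (p , p' , n) = distinct m in
  ⊥-elim (no-side s proj₁ proj₂ _,_ {R = curryᴿ R true} {S = λ p δ → S true (p , left q δ)} {T = λ c x δ → T true (c , x , right q δ)}
    (λ x h → d true (x , h)) (λ _ _ → refl) (λ _ _ → refl) p p' n (dflt l′ true) (dfltᵂ _) tot inj)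
focus sy tot inj (prl (there s) k d) = ⊥-elim (sync-sel s sy)
focus sy tot inj (pl₁ here k d) = pl₁ k λ i p h → d i (p , h)
focus sy tot inj (pl₁ {a} {t , l} (there s) k d) =
  -- A context point in the summand that `pl₁` discards: by totality it would be related to
  -- something.
  let (x , ρ) = tot (ins s (inj₂ (dflt l true)) (dfltᵂ _))
  in ⊥-elim (subst (either _ _) (get-ins s (inj₂ (dflt l true)) _) (proj₁ (d true _) ρ))
focus sy tot inj (pl₂ here k d) = pl₂ k λ i p h → d i (p , h)
focus sy tot inj (pl₂ {r , k′} (there s) k d) =
  let (x , ρ) = tot (ins s (inj₁ (dflt k′ true)) (dfltᵂ _))
  in ⊥-elim (subst (either _ _) (get-ins s (inj₁ (dflt k′ true)) _) (proj₁ (d true _) ρ))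
focus sy tot inj (wth (there s) k l d) = ⊥-elim (sync-sel s sy)
focus sy tot inj (uni d) = uni
focus sy tot inj (bot (there s) k) = ⊥-elim (sync-sel s sy)
focus sy tot inj (top (there s)) = ⊥-elim (sync-sel s sy)

-- Distributed normal forms

infixr 6 _⊕ᶠ_

neg : Formula → Formula
neg F = F ⊸ ⊥'

𝟎ᶠ : Formula
𝟎ᶠ = neg ⊤'

_⊕ᶠ_ : Formula → Formula → Formula
F ⊕ᶠ G = neg (neg F & neg G)

neg-cong : ∀ {F G} → F =D G → neg F =D neg G
neg-cong p = ⊸-cong p refl

⊕-cong : ∀ {F F' G G'} → F =D F' → G =D G' → (F ⊕ᶠ G) =D (F' ⊕ᶠ G')
⊕-cong p q = neg-cong (&-cong (neg-cong p) (neg-cong q))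

⊕-assoc : ∀ {F G H} → (F ⊕ᶠ (G ⊕ᶠ H)) =D ((F ⊕ᶠ G) ⊕ᶠ H)
⊕-assoc = neg-cong (trans (&-cong refl dneg) (trans &-assoc (&-cong (sym dneg) refl)))

⊕-comm : ∀ {F G} → (F ⊕ᶠ G) =D (G ⊕ᶠ F)
⊕-comm = neg-cong &-comm

⊕-unitʳ : ∀ {F} → (F ⊕ᶠ 𝟎ᶠ) =D F
⊕-unitʳ = trans (neg-cong (trans (&-cong refl dneg) &-unit)) dneg

⊕-unitˡ : ∀ {F} → (𝟎ᶠ ⊕ᶠ F) =D F
⊕-unitˡ = trans ⊕-comm ⊕-unitʳ

⊗-unitˡ : ∀ {F} → (𝟏 ⊗ F) =D F
⊗-unitˡ = trans ⊗-comm ⊗-unit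

neg-tens : ∀ {F G} → neg (F ⊗ neg G) =D (F ⊸ G)
neg-tens = trans curry (⊸-cong refl dneg)

-- The laws of ⊗ over 0 and ⊕ are not axioms of `_=D_`: under a double negation they become `⊸-⊤`
-- and, for `⊗-⊕`, `⊸-&-dist`.
⊗-𝟎 : ∀ {F} → (F ⊗ 𝟎ᶠ) =D 𝟎ᶠ
⊗-𝟎 = trans (sym dneg) (neg-cong (trans neg-tens ⊸-⊤))

⊗-⊕ : ∀ {F G H} → (F ⊗ (G ⊕ᶠ H)) =D ((F ⊗ G) ⊕ᶠ (F ⊗ H))
⊗-⊕ = trans (sym dneg) (neg-cong (trans neg-tens (trans ⊸-&-dist (&-cong (sym curry) (sym curry)))))

emb-dual : ∀ A → emb (dual A) =D neg (emb A)
emb-dual (⊕ , k) = refl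
emb-dual (⊖ , k) = sym dneg

emb-tr : ∀ F → emb (tr F) =D F
emb-tr (atom n) = refl
emb-tr (F ⊗ G) = ⊗-cong (emb-tr F) (emb-tr G)
emb-tr 𝟏 = refl
emb-tr (F ⊸ G) = trans (neg-cong (⊗-cong (emb-tr F) (trans (emb-dual (tr G)) (neg-cong (emb-tr G))))) neg-tens
emb-tr ⊥' = ⊸-unit
emb-tr (F & G) = trans dneg (&-cong (trans (neg-cong (trans (emb-dual (tr F)) (neg-cong (emb-tr F)))) dneg)
                                    (trans (neg-cong (trans (emb-dual (tr G)) (neg-cong (emb-tr G)))) dneg))
emb-tr ⊤' = dneg

0ˢ : Signed
0ˢ = ⊕ , zero

is-zero : ∀ A → Dec (A ≡ 0ˢ)
is-zero (⊕ , lit n) = no λ ()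
is-zero (⊕ , unit) = no λ ()
is-zero (⊕ , zero) = yes refl
is-zero (⊕ , tens a b) = no λ ()
is-zero (⊕ , plus a b) = no λ ()
is-zero (⊖ , k) = no λ ()

-- The formulas allowed below ⊗ in a distributed formula (below ⊕ only 0 is excluded).
Factor : Signed → Set
Factor (⊕ , unit) = ⊥
Factor (⊕ , zero) = ⊥
Factor (⊕ , plus _ _) = ⊥
Factor _ = ⊤

Normal : Skeleton → Set
Normal (lit n) = ⊤
Normal unit = ⊤
Normal zero = ⊤
Normal (tens (r , k) (t , l)) = (Factor (r , k) × Factor (t , l)) × Normal k × Normal l
Normal (plus (r , k) (t , l)) = ((r , k) ≢ 0ˢ × (t , l) ≢ 0ˢ) × Normal k × Normal l

Normalˢ : Signed → Set
Normalˢ (_ , k) = Normal k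

mk⊕ : Signed → Signed → Signed
mk⊕ a b with is-zero a | is-zero b
... | yes _ | _ = b
... | no _ | yes _ = a
... | no _ | no _ = ⊕ , plus a b

mk⊗ʳ : Signed → Sign → Skeleton → Signed
mk⊗ʳ a ⊕ unit = a
mk⊗ʳ a ⊕ zero = 0ˢ
mk⊗ʳ a ⊕ (plus (r , k) (t , l)) = mk⊕ (mk⊗ʳ a r k) (mk⊗ʳ a t l)
mk⊗ʳ a ⊕ (lit n) = ⊕ , tens a (⊕ , lit n)
mk⊗ʳ a ⊕ (tens b c) = ⊕ , tens a (⊕ , tens b c)
mk⊗ʳ a ⊖ k = ⊕ , tens a (⊖ , k)

mk⊗ : Sign → Skeleton → Signed → Signed
mk⊗ ⊕ unit (s , l) = s , l
mk⊗ ⊕ zero b = 0ˢ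
mk⊗ ⊕ (plus (r , k) (t , l)) b = mk⊕ (mk⊗ r k b) (mk⊗ t l b)
mk⊗ ⊕ (lit n) (s , l) = mk⊗ʳ (⊕ , lit n) s l
mk⊗ ⊕ (tens a b) (s , l) = mk⊗ʳ (⊕ , tens a b) s l
mk⊗ ⊖ k (s , l) = mk⊗ʳ (⊖ , k) s l

nfˢ : Sign → Skeleton → Signed
nfᵏ : Skeleton → Signed
nfˢ ⊕ k = nfᵏ k
nfˢ ⊖ k = dual (nfᵏ k)
nfᵏ (lit n) = ⊕ , lit n
nfᵏ unit = ⊕ , unit
nfᵏ zero = ⊕ , zero
nfᵏ (tens (r , k) (t , l)) = mk⊗ (Signed.sign (nfˢ r k)) (Signed.skel (nfˢ r k)) (nfˢ t l)
nfᵏ (plus (r , k) (t , l)) = mk⊕ (nfˢ r k) (nfˢ t l)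

mk⊕-normal : ∀ a b → Normalˢ a → Normalˢ b → Normalˢ (mk⊕ a b)
mk⊕-normal a b n m with is-zero a | is-zero b
... | yes _ | _ = m
... | no _ | yes _ = n
... | no p | no q = (p , q) , n , m

mk⊗ʳ-normal : ∀ a s k → Factor a → Normalˢ a → Normal k → Normalˢ (mk⊗ʳ a s k)
mk⊗ʳ-normal a ⊕ unit f n m = n
mk⊗ʳ-normal a ⊕ zero f n m = tt
mk⊗ʳ-normal a ⊕ (plus (r , k) (t , l)) f n (_ , m , m') = mk⊕-normal (mk⊗ʳ a r k) (mk⊗ʳ a t l) (mk⊗ʳ-normal a r k f n m) (mk⊗ʳ-normal a t l f n m')
mk⊗ʳ-normal a ⊕ (lit _) f n m = (f , tt) , n , m
mk⊗ʳ-normal a ⊕ (tens _ _) f n m = (f , tt) , n , m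
mk⊗ʳ-normal a ⊖ k f n m = (f , tt) , n , m

mk⊗-normal : ∀ s k b → Normal k → Normalˢ b → Normalˢ (mk⊗ s k b)
mk⊗-normal ⊕ unit b n m = m
mk⊗-normal ⊕ zero b n m = tt
mk⊗-normal ⊕ (plus (r , k) (t , l)) b (_ , n , n') m = mk⊕-normal (mk⊗ r k b) (mk⊗ t l b) (mk⊗-normal r k b n m) (mk⊗-normal t l b n' m)
mk⊗-normal ⊕ (lit _) (s , l) n m = mk⊗ʳ-normal _ s l tt n m
mk⊗-normal ⊕ (tens _ _) (s , l) n m = mk⊗ʳ-normal _ s l tt n m
mk⊗-normal ⊖ k (s , l) n m = mk⊗ʳ-normal _ s l tt n m

nf-normal : ∀ s k → Normalˢ (nfˢ s k)
nfᵏ-normal : ∀ k → Normalˢ (nfᵏ k)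
nf-normal ⊕ k = nfᵏ-normal k
nf-normal ⊖ k = nfᵏ-normal k
nfᵏ-normal (lit n) = tt
nfᵏ-normal unit = tt
nfᵏ-normal zero = tt
nfᵏ-normal (tens (r , k) (t , l)) = mk⊗-normal (Signed.sign (nfˢ r k)) _ (nfˢ t l) (nf-normal r k) (nf-normal t l)
nfᵏ-normal (plus (r , k) (t , l)) = mk⊕-normal (nfˢ r k) (nfˢ t l) (nf-normal r k) (nf-normal t l)

mk⊕-=D : ∀ a b → emb (mk⊕ a b) =D (emb a ⊕ᶠ emb b)
mk⊕-=D a b with is-zero a | is-zero b
... | yes refl | _ = sym ⊕-unitˡ
... | no _ | yes refl = sym ⊕-unitʳ
... | no _ | no _ = refl

mk⊗ʳ-=D : ∀ a s k → emb (mk⊗ʳ a s k) =D (emb a ⊗ emb (s , k))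
mk⊗ʳ-=D a ⊕ unit = sym ⊗-unit
mk⊗ʳ-=D a ⊕ zero = sym ⊗-𝟎
mk⊗ʳ-=D a ⊕ (plus (r , k) (t , l)) =
  trans (mk⊕-=D (mk⊗ʳ a r k) (mk⊗ʳ a t l)) (trans (⊕-cong (mk⊗ʳ-=D a r k) (mk⊗ʳ-=D a t l)) (sym ⊗-⊕))
mk⊗ʳ-=D a ⊕ (lit _) = refl
mk⊗ʳ-=D a ⊕ (tens _ _) = refl
mk⊗ʳ-=D a ⊖ k = refl

mk⊗-=D : ∀ s k b → emb (mk⊗ s k b) =D (emb (s , k) ⊗ emb b)
mk⊗-=D ⊕ unit b = sym ⊗-unitˡ
mk⊗-=D ⊕ zero b = trans (sym ⊗-𝟎) ⊗-comm
mk⊗-=D ⊕ (plus (r , k) (t , l)) b =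
  trans (mk⊕-=D (mk⊗ r k b) (mk⊗ t l b)) (trans (⊕-cong (trans (mk⊗-=D r k b) ⊗-comm) (trans (mk⊗-=D t l b) ⊗-comm)) (trans (sym ⊗-⊕) ⊗-comm))
mk⊗-=D ⊕ (lit _) (s , l) = mk⊗ʳ-=D _ s l
mk⊗-=D ⊕ (tens _ _) (s , l) = mk⊗ʳ-=D _ s l
mk⊗-=D ⊖ k (s , l) = mk⊗ʳ-=D _ s l

nf-=D : ∀ s k → emb (nfˢ s k) =D emb (s , k)
nfᵏ-=D : ∀ k → emb (nfᵏ k) =D embᵏ k
nf-=D ⊕ k = nfᵏ-=D k
nf-=D ⊖ k = trans (emb-dual (nfᵏ k)) (neg-cong (nfᵏ-=D k))
nfᵏ-=D (lit n) = refl
nfᵏ-=D unit = refl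
nfᵏ-=D zero = refl
nfᵏ-=D (tens (r , k) (t , l)) =
  trans (mk⊗-=D (Signed.sign (nfˢ r k)) _ (nfˢ t l)) (⊗-cong (nf-=D r k) (nf-=D t l))
nfᵏ-=D (plus (r , k) (t , l)) = trans (mk⊕-=D (nfˢ r k) (nfˢ t l)) (⊕-cong (nf-=D r k) (nf-=D t l))

nf : Formula → Signed
nf F = nfˢ (Signed.sign (tr F)) (Signed.skel (tr F))

emb-nf : ∀ F → emb (nf F) =D F
emb-nf F = trans (nf-=D (Signed.sign (tr F)) _) (emb-tr F)

⨂ : Sequent → Formula
⨂ [] = 𝟏
⨂ (H ∷ Δ) = emb (dual H) ⊗ ⨂ Δ

⨂-spl : ∀ {Δ Δ₁ Δ₂} → Spl Δ Δ₁ Δ₂ → ⨂ Δ =D (⨂ Δ₁ ⊗ ⨂ Δ₂)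
⨂-spl [] = sym ⊗-unit
⨂-spl (lft s) = trans (⊗-cong refl (⨂-spl s)) ⊗-assoc
⨂-spl (rgt s) = trans (⊗-cong refl (trans (⨂-spl s) ⊗-comm)) (trans ⊗-assoc ⊗-comm)

⨁ : Sequent → Formula
⨁ [] = 𝟎ᶠ
⨁ (A ∷ L) = emb A ⊕ᶠ ⨁ L

⨁-spl : ∀ {L L₁ L₂} → Spl L L₁ L₂ → ⨁ L =D (⨁ L₁ ⊕ᶠ ⨁ L₂)
⨁-spl [] = sym ⊕-unitʳ
⨁-spl (lft s) = trans (⊕-cong refl (⨁-spl s)) ⊕-assoc
⨁-spl (rgt s) = trans (⊕-cong refl (trans (⨁-spl s) ⊕-comm)) (trans ⊕-assoc ⊕-comm)

-- Bijections realised by proofs in both directions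

-- The sequent dual to A once its topmost ⊗'s have been decomposed.
tcd : Sign → Skeleton → Sequent
tcd ⊕ (tens (r , k) (t , l)) = tcd r k ++ tcd t l
tcd ⊕ (lit n) = (⊖ , lit n) ∷ []
tcd ⊕ unit = (⊖ , unit) ∷ []
tcd ⊕ zero = (⊖ , zero) ∷ []
tcd ⊕ (plus a b) = (⊖ , plus a b) ∷ []
tcd ⊖ k = (⊕ , k) ∷ []

pt : ∀ s k → W (tcd s k) → wk k
pt ⊕ (tens (r , k) (t , l)) w = pt r k (left (canon (tcd r k) (tcd t l)) w) , pt t l (right (canon (tcd r k) (tcd t l)) w)
pt ⊕ (lit n) (x , _) = x
pt ⊕ unit (x , _) = x
pt ⊕ zero (x , _) = x
pt ⊕ (plus a b) (x , _) = x
pt ⊖ k (x , _) = x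

unpt : ∀ s k → wk k → W (tcd s k)
unpt ⊕ (tens (r , k) (t , l)) (p , q) = join (canon (tcd r k) (tcd t l)) (unpt r k p) (unpt t l q)
unpt ⊕ (lit n) x = x , tt
unpt ⊕ unit x = x , tt
unpt ⊕ zero x = x , tt
unpt ⊕ (plus a b) x = x , tt
unpt ⊖ k x = x , tt

pt-unpt : ∀ s k p → pt s k (unpt s k p) ≡ p
pt-unpt ⊕ (tens (r , k) (t , l)) (p , q) = cong₂ _,_
  (≡-trans (cong (pt r k) (left-join (canon (tcd r k) (tcd t l)) _ _)) (pt-unpt r k p))
  (≡-trans (cong (pt t l) (right-join (canon (tcd r k) (tcd t l)) _ _)) (pt-unpt t l q))
pt-unpt ⊕ (lit n) x = refl
pt-unpt ⊕ unit x = refl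
pt-unpt ⊕ zero x = refl
pt-unpt ⊕ (plus a b) x = refl
pt-unpt ⊖ k x = refl

unpt-pt : ∀ s k w → unpt s k (pt s k w) ≡ w
unpt-pt ⊕ (tens (r , k) (t , l)) w = ≡-trans (cong₂ (join (canon (tcd r k) (tcd t l))) (unpt-pt r k _) (unpt-pt t l _))
  (join-left-right (canon (tcd r k) (tcd t l)) w)
unpt-pt ⊕ (lit n) x = refl
unpt-pt ⊕ unit x = refl
unpt-pt ⊕ zero x = refl
unpt-pt ⊕ (plus a b) x = refl
unpt-pt ⊖ k x = refl

pt-inj : ∀ s k {w w'} → pt s k w ≡ pt s k w' → w ≡ w'
pt-inj s k {w} {w'} e = ≡-trans (≡-sym (unpt-pt s k w)) (≡-trans (cong (unpt s k) e) (unpt-pt s k w'))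

-- A cut against this element replaces the dual of `(s , k)` in a sequent by the list of its
-- factors; it does the work of inverting the ⅋-rules.
tcdᵛ : ∀ s k → P.Val (s , k) (tcd s k) (λ i a w → a ≡ pt s k w)
tcdᵛ ⊕ (tens (r , k) (t , l)) = P.Val-resp (λ i a w → (λ { (e , e') → cong₂ _,_ e e' }) , (λ e → ,-injˡ e , ,-injʳ e))
  (P.pairᵛ (tcdᵛ r k) (tcdᵛ t l) (canon (tcd r k) (tcd t l)))
tcdᵛ ⊕ (lit n) = idᵛ (⊕ , lit n)
tcdᵛ ⊕ unit = idᵛ (⊕ , unit)
tcdᵛ ⊕ zero = idᵛ (⊕ , zero)
tcdᵛ ⊕ (plus a b) = idᵛ (⊕ , plus a b)
tcdᵛ ⊖ k = idᵛ (⊖ , k)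

-- `sound` in an environment that holds `x` at `N` and the identity at `Q`, which therefore stays in
-- the conclusion.
cut₁ : ∀ {N Q Γ R x} → K (N ∷ Q ∷ []) R → P.Val (dual N) Γ x →
  K (Q ∷ Γ) (λ i qγ → Σ _ λ n → R i (n , proj₁ qγ , tt) × x i n (proj₂ qγ))
cut₁ {N} {Q} {Γ} {R} {x} k X = K-resp e (sound k (cons (rgt (all-left Γ)) X (cons (lft []) (idᵛᵈ Q) [])))
  where
  e : _ ≐ (λ i qγ → Σ _ λ n → R i (n , proj₁ qγ , tt) × x i n (proj₂ qγ))
  e i (q , γ) = (λ { ((n , _ , _) , r , u , refl , _) → n , r , subst (x i n) (left-all Γ γ) u })
              , (λ { (n , r , u) → (n , q , tt) , r , subst (x i n) (≡-sym (left-all Γ γ)) u , refl , tt })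

cut₂ : ∀ {N Q Γ R x} → K (Q ∷ N ∷ []) R → P.Val (dual N) Γ x →
  K (Q ∷ Γ) (λ i qγ → Σ _ λ n → R i (proj₁ qγ , n , tt) × x i n (proj₂ qγ))
cut₂ {N} {Q} {Γ} {R} {x} k X = K-resp e (sound k (cons (lft (all-right Γ)) (idᵛᵈ Q) (cons (all-left Γ) X [])))
  where
  e : _ ≐ (λ i qγ → Σ _ λ n → R i (proj₁ qγ , n , tt) × x i n (proj₂ qγ))
  e i (q , γ) = (λ { ((_ , n , _) , r , refl , u , _) → n , r , subst (x i n) (≡-trans (left-all Γ _) (right-all Γ γ)) u })
              , (λ { (n , r , u) → (q , n , tt) , r , refl , subst (x i n) (≡-sym (≡-trans (left-all Γ _) (right-all Γ γ))) u , tt })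

-- Bijections that factor along product decompositions

record Bij {X Y : Set} (R : X → Y → Set) : Set where
  field
    tot : ∀ x → Σ Y (R x)
    sur : ∀ y → Σ X λ x → R x y
    fun : ∀ {x y y'} → R x y → R x y' → y ≡ y'
    inj : ∀ {x x' y} → R x y → R x' y → x ≡ x'
open Bij

record Fac (X X₁ X₂ : Set) : Set where
  field
    l : X → X₁
    r : X → X₂
    j : X₁ → X₂ → X
    lj : ∀ a b → l (j a b) ≡ a
    rj : ∀ a b → r (j a b) ≡ b
open Fac

spl-fac : ∀ {Γ Γ₁ Γ₂} → Spl Γ Γ₁ Γ₂ → Fac (W Γ) (W Γ₁) (W Γ₂)
spl-fac s = record { l = left s ; r = right s ; j = join s ; lj = left-join s ; rj = right-join s }

×-fac : ∀ {X Y : Set} → Fac (X × Y) X Y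
×-fac = record { l = proj₁ ; r = proj₂ ; j = _,_ ; lj = λ _ _ → refl ; rj = λ _ _ → refl }

flip-fac : ∀ {X X₁ X₂} → Fac X X₁ X₂ → Fac X X₂ X₁
flip-fac f = record { l = r f ; r = l f ; j = λ a b → j f b a ; lj = λ a b → rj f b a ; rj = λ a b → lj f b a }

module Product {X X₁ X₂ Y Y₁ Y₂ : Set} (f : Fac X X₁ X₂) (g : Fac Y Y₁ Y₂) {R : X → Y → Set} {A : X₁ → Y₁ → Set} {B : X₂ → Y₂ → Set}
  (e : ∀ x y → Iff (R x y) (A (l f x) (l g y) × B (r f x) (r g y))) where

  conjoin : ∀ {a b c d} → A a b → B c d → R (j f a c) (j g b d)
  conjoin p q = proj₂ (e _ _) (subst₂ A (≡-sym (lj f _ _)) (≡-sym (lj g _ _)) p , subst₂ B (≡-sym (rj f _ _)) (≡-sym (rj g _ _)) q)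

  -- One related pair is fixed in the second factor; completing pairs of `A` with it lifts every
  -- question about `A` to `R`.
  bijˡ : X → Bij R → Bij A
  bijˡ x₀ b = record
    { tot = λ a → let (y , ρ) = tot b (j f a (r f x₀)) in l g y , subst (λ a → A a _) (lj f _ _) (proj₁ (proj₁ (e _ _) ρ))
    ; sur = λ a → let (x , ρ) = sur b (j g a (r g y₀)) in l f x , subst (A (l f x)) (lj g _ _) (proj₁ (proj₁ (e _ _) ρ))
    ; fun = λ p p' → ≡-trans (≡-sym (lj g _ _)) (≡-trans (cong (l g) (fun b (conjoin p q₀) (conjoin p' q₀))) (lj g _ _))
    ; inj = λ p p' → ≡-trans (≡-sym (lj f _ _)) (≡-trans (cong (l f) (inj b (conjoin p q₀) (conjoin p' q₀))) (lj f _ _)) }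
    where
    y₀ = proj₁ (tot b x₀)
    q₀ = proj₂ (proj₁ (e _ _) (proj₂ (tot b x₀)))

module _ {X X₁ X₂ Y Y₁ Y₂ : Set} (f : Fac X X₁ X₂) (g : Fac Y Y₁ Y₂) {R : X → Y → Set} {A : X₁ → Y₁ → Set} {B : X₂ → Y₂ → Set}
  (e : ∀ x y → Iff (R x y) (A (l f x) (l g y) × B (r f x) (r g y))) where

  bij-left : X → Bij R → Bij A
  bij-left = Product.bijˡ f g {R} {A} {B} e

  bij-right : X → Bij R → Bij B
  bij-right = Product.bijˡ (flip-fac f) (flip-fac g) {R} {B} {A} (λ x y → let (p , q) = e x y in (λ ρ → let (a , b) = p ρ in b , a) , (λ { (b , a) → q (a , b) }))

data Clash : ∀ {Γ Γ₁ Γ₂ Δ₁ Δ₂} → Spl Γ Γ₁ Γ₂ → Spl Γ Δ₁ Δ₂ → Set where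
  lr : ∀ {a Γ Γ₁ Γ₂ Δ₁ Δ₂} {s : Spl Γ Γ₁ Γ₂} {t : Spl Γ Δ₁ Δ₂} → Clash (lft {a} s) (rgt t)
  rl : ∀ {a Γ Γ₁ Γ₂ Δ₁ Δ₂} {s : Spl Γ Γ₁ Γ₂} {t : Spl Γ Δ₁ Δ₂} → Clash (rgt {a} s) (lft t)
  ll : ∀ {a Γ Γ₁ Γ₂ Δ₁ Δ₂} {s : Spl Γ Γ₁ Γ₂} {t : Spl Γ Δ₁ Δ₂} → Clash s t → Clash (lft {a} s) (lft t)
  rr : ∀ {a Γ Γ₁ Γ₂ Δ₁ Δ₂} {s : Spl Γ Γ₁ Γ₂} {t : Spl Γ Δ₁ Δ₂} → Clash s t → Clash (rgt {a} s) (rgt t)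

record Splitting (Γ : Sequent) : Set where
  constructor splitting
  field
    {part₁ part₂} : Sequent
    spl : Spl Γ part₁ part₂

compare : ∀ {Γ Γ₁ Γ₂ Δ₁ Δ₂} (s : Spl Γ Γ₁ Γ₂) (t : Spl Γ Δ₁ Δ₂) → Clash s t ⊎ splitting s ≡ splitting t
compare [] [] = inj₂ refl
compare (lft s) (rgt t) = inj₁ lr
compare (rgt s) (lft t) = inj₁ rl
compare (lft s) (lft t) with compare s t
... | inj₁ c = inj₁ (ll c)
... | inj₂ refl = inj₂ refl
compare (rgt s) (rgt t) with compare s t
... | inj₁ c = inj₁ (rr c)
... | inj₂ refl = inj₂ refl

record Coordinate {Γ Γ₁ Γ₂} (f : W Γ → W Γ₁) (g : W Γ → W Γ₂) : Set where
  field
    shape : Skeleton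
    read₁ : W Γ₁ → wk shape
    read₂ : W Γ₂ → wk shape
    same : ∀ γ → read₁ (f γ) ≡ read₂ (g γ)
    onto : ∀ v → Σ (W Γ) λ γ → read₁ (f γ) ≡ v

clash-coordinate : ∀ {Γ Γ₁ Γ₂ Δ₁ Δ₂} {s : Spl Γ Γ₁ Γ₂} {t : Spl Γ Δ₁ Δ₂} → Clash s t →
  Coordinate {Γ} (left s) (right t) ⊎ Coordinate {Γ} (right s) (left t)
clash-coordinate (lr {r , k}) = inj₁ record { shape = k ; read₁ = proj₁ ; read₂ = proj₁ ; same = λ _ → refl ; onto = λ v → (v , dfltᵂ _) , refl }
clash-coordinate (rl {r , k}) = inj₂ record { shape = k ; read₁ = proj₁ ; read₂ = proj₁ ; same = λ _ → refl ; onto = λ v → (v , dfltᵂ _) , refl }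
clash-coordinate (ll {r , k} c) with clash-coordinate c
... | inj₁ d = inj₁ record { shape = shape ; read₁ = λ γ → read₁ (proj₂ γ) ; read₂ = read₂ ; same = λ { (_ , γ) → same γ }
                           ; onto = λ v → let (γ , e) = onto v in (dflt k true , γ) , e } where open Coordinate d
... | inj₂ d = inj₂ record { shape = shape ; read₁ = read₁ ; read₂ = λ γ → read₂ (proj₂ γ) ; same = λ { (_ , γ) → same γ }
                           ; onto = λ v → let (γ , e) = onto v in (dflt k true , γ) , e } where open Coordinate d
clash-coordinate (rr {r , k} c) with clash-coordinate c
... | inj₁ d = inj₁ record { shape = shape ; read₁ = read₁ ; read₂ = λ γ → read₂ (proj₂ γ) ; same = λ { (_ , γ) → same γ }
                           ; onto = λ v → let (γ , e) = onto v in (dflt k true , γ) , e } where open Coordinate d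
... | inj₂ d = inj₂ record { shape = shape ; read₁ = λ γ → read₁ (proj₂ γ) ; read₂ = read₂ ; same = λ { (_ , γ) → same γ }
                           ; onto = λ v → let (γ , e) = onto v in (dflt k true , γ) , e } where open Coordinate d

-- If a bijection factors along f on one side and along g and g' on the other, then a coordinate common
-- to the first part of g and the second part of g' would depend on nothing.
no-coordinate : ∀ {X X₁ X₂ Γ Γ₁ Γ₂ Δ₁ Δ₂} (f : Fac X X₁ X₂) (g : Fac (W Γ) (W Γ₁) (W Γ₂)) (g' : Fac (W Γ) (W Δ₁) (W Δ₂))
  {R : X → W Γ → Set} {A B A' B'} → X → Bij R →
  (∀ x y → Iff (R x y) (A (l f x) (l g y) × B (r f x) (r g y))) →
  (∀ x y → Iff (R x y) (A' (l f x) (l g' y) × B' (r f x) (r g' y))) →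
  Coordinate {Γ} (l g) (r g') → ⊥
no-coordinate f g g' {R} {A} {B} {A'} {B'} x₀ b e e' c =
  let open Coordinate c
      (v , v' , n) = distinct shape
      (y , oy) = onto v
      (y' , oy') = onto v'
      (x , ρ) = sur b y
      (x' , ρ') = sur b y'
      -- A hybrid of `x` and `x'`. Its image agrees with `y` on the first part of `g` and with `y'`
      -- on the second part of `g'`, so the shared coordinate would have to be both `v` and `v'`.
      x″ = j f (l f x) (r f x')
      (y″ , ρ″) = tot b x″
      el = fun (bij-left f g {R} {A} {B} e x₀ b) (proj₁ (proj₁ (e x y) ρ)) (subst (λ z → A z (l g y″)) (lj f _ _) (proj₁ (proj₁ (e x″ y″) ρ″)))
      er = fun (bij-right f g' {R} {A'} {B'} e' x₀ b) (proj₂ (proj₁ (e' x' y') ρ')) (subst (λ z → B' z (r g' y″)) (rj f _ _) (proj₂ (proj₁ (e' x″ y″) ρ″)))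
  in n (≡-trans (≡-sym oy) (≡-trans (cong read₁ el) (≡-trans (same y″) (≡-trans (cong read₂ (≡-sym er)) (≡-trans (≡-sym (same y')) oy')))))

-- Two different splittings put some formula on opposite sides, and this formula is a coordinate of
-- the kind excluded by `no-coordinate`.
unique-splitting : ∀ {X X₁ X₂ Γ Γ₁ Γ₂ Δ₁ Δ₂} (f : Fac X X₁ X₂) (s : Spl Γ Γ₁ Γ₂) (t : Spl Γ Δ₁ Δ₂)
  {R : X → W Γ → Set} {A B A' B'} → X → Bij R →
  (∀ x y → Iff (R x y) (A (l f x) (left s y) × B (r f x) (right s y))) →
  (∀ x y → Iff (R x y) (A' (l f x) (left t y) × B' (r f x) (right t y))) → splitting s ≡ splitting t
unique-splitting f s t {R} {A} {B} {A'} {B'} x₀ b e e' with compare s t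
... | inj₂ eq = eq
... | inj₁ c with clash-coordinate c
...   | inj₁ d = ⊥-elim (no-coordinate f (spl-fac s) (spl-fac t) {R} {A} {B} {A'} {B'} x₀ b e e' d)
...   | inj₂ d = ⊥-elim (no-coordinate (flip-fac f) (flip-fac (spl-fac s)) (flip-fac (spl-fac t)) {R} {B} {A} {B'} {A'} x₀ b (sw e) (sw e') d)
  where
  sw : ∀ {X Y : Set} {R A B : X → Y → Set} → (∀ x y → Iff (R x y) (A x y × B x y)) → ∀ x y → Iff (R x y) (B x y × A x y)
  sw e x y = let (p , q) = e x y in (λ ρ → let (a , b) = p ρ in b , a) , (λ { (b , a) → q (a , b) })

-- A proof of ⨂ over Δ, decomposed into one proof for each factor.
data Decomp : (Δ Γ : Sequent) → (W Δ → W Γ → Set) → Set₁ where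
  nil  : ∀ {Q} → (∀ x y → Q x y) → Decomp [] [] Q
  cons : ∀ {H Δ Γ Γ₁ Γ₂ Q B} {A : web H → W Γ₁ → Set} (s : Spl Γ Γ₁ Γ₂) → K (dual H ∷ Γ₁) (λ _ ag → A (proj₁ ag) (proj₂ ag)) → Decomp Δ Γ₂ B →
         (∀ x y → Iff (Q x y) (A (proj₁ x) (left s y) × B (proj₂ x) (right s y))) → Decomp (H ∷ Δ) Γ Q

Decomp-resp : ∀ {Δ Γ Q Q'} → (∀ x y → Iff (Q x y) (Q' x y)) → Decomp Δ Γ Q → Decomp Δ Γ Q'
Decomp-resp e (nil h) = nil λ x y → proj₁ (e x y) (h x y)
Decomp-resp e (cons s k d f) = cons s k d λ x y → (λ q → proj₁ (f x y) (proj₂ (e x y) q)) , (λ ab → proj₁ (e x y) (proj₂ (f x y) ab))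

ltr : ∀ {A B} → Iff A B → A → B
ltr = proj₁

rtl : ∀ {A B} → Iff A B → B → A
rtl = proj₂

record Restricted {Δ Δ₁ Δ₂} (q : Spl Δ Δ₁ Δ₂) (Γ : Sequent) (Q : W Δ → W Γ → Set) : Set₁ where
  field
    {Γ₁ Γ₂} : Sequent
    {Q₁} : W Δ₁ → W Γ₁ → Set
    {Q₂} : W Δ₂ → W Γ₂ → Set
    spl : Spl Γ Γ₁ Γ₂
    dec₁ : Decomp Δ₁ Γ₁ Q₁
    dec₂ : Decomp Δ₂ Γ₂ Q₂
    factor : ∀ x y → Iff (Q x y) (Q₁ (left q x) (left spl y) × Q₂ (right q x) (right spl y))

restrict : ∀ {Δ Δ₁ Δ₂ Γ Q} (q : Spl Δ Δ₁ Δ₂) → Decomp Δ Γ Q → Restricted q Γ Q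
restrict [] (nil {Q} h) = record { spl = [] ; Q₁ = Q ; Q₂ = Q ; dec₁ = nil {Q} h ; dec₂ = nil {Q} h ; factor = λ x y → (λ q → q , q) , proj₁ }
restrict (lft {H} {Γ₁ = Δ₁} q) (cons {Q = Q} {B} {A} s k d e) = record
  { spl = outer ; Q₁ = Q′ ; Q₂ = Q₂ ; dec₁ = cons {Q = Q′} {Q₁} {A} inner k dec₁ (λ x y → iff) ; dec₂ = dec₂ ; factor = fac }
  where
  open Restricted (restrict {Q = B} q d)
  open Assocˡ (assocˡ s spl)
  Q′ : W (H ∷ Δ₁) → W mid → Set
  Q′ x y = A (proj₁ x) (left inner y) × Q₁ (proj₂ x) (right inner y)
  fac : ∀ x y → Iff (Q x y) (Q′ (left (lft {H} q) x) (left outer y) × Q₂ (right (lft {H} q) x) (right outer y))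
  fac z@(a , x) y =
      (λ ρ → let (u , v) = ltr (e z y) ρ ; (v₁ , v₂) = ltr (factor x _) v in
        (subst (A a) (≡-sym (eq₁ y)) u , subst (Q₁ _) (≡-sym (eq₂ y)) v₁) , subst (Q₂ _) (≡-sym (eq₃ y)) v₂)
    , (λ { ((u , v₁) , v₂) → rtl (e z y) (subst (A a) (eq₁ y) u , rtl (factor x _) (subst (Q₁ _) (eq₂ y) v₁ , subst (Q₂ _) (eq₃ y) v₂)) })
restrict (rgt {H} {Γ₂ = Δ₂} q) (cons {Q = Q} {B} {A} s k d e) = record
  { spl = outer ; Q₁ = Q₁ ; Q₂ = Q′ ; dec₁ = dec₁ ; dec₂ = cons {Q = Q′} {Q₂} {A} (swap inner) k dec₂ (λ x y → iff) ; factor = fac }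
  where
  open Restricted (restrict {Q = B} q d)
  open Assocʳ (assocʳ (swap s) spl)
  eqA : ∀ γ → left outer γ ≡ left spl (right s γ)
  eqA γ = ≡-trans (eq₁ γ) (cong (left spl) (left-swap s γ))
  eqB : ∀ γ → left (swap inner) (right outer γ) ≡ left s γ
  eqB γ = ≡-trans (left-swap inner _) (≡-trans (eq₃ γ) (right-swap s γ))
  eqC : ∀ γ → right (swap inner) (right outer γ) ≡ right spl (right s γ)
  eqC γ = ≡-trans (right-swap inner _) (≡-trans (eq₂ γ) (cong (right spl) (left-swap s γ)))
  Q′ : W (H ∷ Δ₂) → W mid → Set
  Q′ x y = A (proj₁ x) (left (swap inner) y) × Q₂ (proj₂ x) (right (swap inner) y)
  fac : ∀ x y → Iff (Q x y) (Q₁ (left (rgt {H} q) x) (left outer y) × Q′ (right (rgt {H} q) x) (right outer y))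
  fac z@(a , x) y =
      (λ ρ → let (u , v) = ltr (e z y) ρ ; (v₁ , v₂) = ltr (factor x _) v in
        subst (Q₁ _) (≡-sym (eqA y)) v₁ , subst (A a) (≡-sym (eqB y)) u , subst (Q₂ _) (≡-sym (eqC y)) v₂)
    , (λ { (v₁ , u , v₂) → rtl (e z y) (subst (A a) (eqB y) u , rtl (factor x _) (subst (Q₁ _) (eqA y) v₁ , subst (Q₂ _) (eqC y) v₂)) })

Decomp-++ : ∀ {Δ Δ' Γ Γ₁ Γ₂ Q₁ Q₂ Q} (q : Spl Γ Γ₁ Γ₂) → Decomp Δ Γ₁ Q₁ → Decomp Δ' Γ₂ Q₂ →
  (∀ x y → Iff (Q x y) (Q₁ (left (canon Δ Δ') x) (left q y) × Q₂ (right (canon Δ Δ') x) (right q y))) → Decomp (Δ ++ Δ') Γ Q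
Decomp-++ {Δ' = Δ'} {Γ₂ = Γ₂} {Q₂ = Q₂} q (nil h) d e = right-empty q
  (λ {Γ} q → ∀ {Q : W Δ' → W Γ → Set} → (∀ x y → Iff (Q x y) (Q₂ x (right q y))) → Decomp Δ' Γ Q)
  (λ e → Decomp-resp (λ x y → (λ r → proj₂ (e x y) (subst (Q₂ x) (≡-sym (right-all Γ₂ y)) r)) , (λ r → subst (Q₂ x) (right-all Γ₂ y) (proj₁ (e x y) r))) d)
  (λ x y → (λ r → subst (λ x → Q₂ x _) (right-all Δ' x) (proj₂ (proj₁ (e x y) r))) , (λ r → proj₂ (e x y) (h _ _ , subst (λ x → Q₂ x _) (≡-sym (right-all Δ' x)) r)))
Decomp-++ {Δ' = Δ'} {Q₂ = Q₂} q (cons {H} {Δ} {Q = Q₁} {B} {A} s k d f) d' e =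
  cons {A = A} outer k (Decomp-++ {Q = λ x y → B (left (canon Δ Δ') x) (left inner y) × Q₂ (right (canon Δ Δ') x) (right inner y)} inner d d' (λ x y → iff))
    λ { z@(a , x) y →
      (λ ρ → let (u , v) = proj₁ (e z y) ρ ; (u₁ , u₂) = ltr (f _ _) u in
        subst (A a) (≡-sym (eq₁ y)) u₁ , subst (B _) (≡-sym (eq₂ y)) u₂ , subst (Q₂ _) (≡-sym (eq₃ y)) v)
    , (λ { (u₁ , u₂ , v) → proj₂ (e z y) (rtl (f _ _) (subst (A a) (eq₁ y) u₁ , subst (B _) (eq₂ y) u₂) , subst (Q₂ _) (eq₃ y) v) }) }
  where
  open Assocʳ (assocʳ q s)


κᵂ : Bool → ∀ {Γ} → W Γ → W Γ
κᵂ c {[]} γ = γ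
κᵂ c {(_ , k) ∷ Γ} (x , γ) = κ c k x , κᵂ c γ

left-κ : ∀ c {Γ Γ₁ Γ₂} (s : Spl Γ Γ₁ Γ₂) γ → left s (κᵂ c γ) ≡ κᵂ c (left s γ)
left-κ c [] γ = refl
left-κ c (lft s) (x , γ) = cong (κ c _ x ,_) (left-κ c s γ)
left-κ c (rgt s) (x , γ) = left-κ c s γ

right-κ : ∀ c {Γ Γ₁ Γ₂} (s : Spl Γ Γ₁ Γ₂) γ → right s (κᵂ c γ) ≡ κᵂ c (right s γ)
right-κ c [] γ = refl
right-κ c (lft s) (x , γ) = right-κ c s γ
right-κ c (rgt s) (x , γ) = cong (κ c _ x ,_) (right-κ c s γ)

pt-κ : ∀ c s k w → pt s k (κᵂ c w) ≡ κ c k (pt s k w)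
pt-κ c ⊕ (tens (r , k) (t , l)) w = cong₂ _,_
  (≡-trans (cong (pt r k) (left-κ c (canon (tcd r k) (tcd t l)) w)) (pt-κ c r k _))
  (≡-trans (cong (pt t l) (right-κ c (canon (tcd r k) (tcd t l)) w)) (pt-κ c t l _))
pt-κ c ⊕ (lit n) w = refl
pt-κ c ⊕ unit w = refl
pt-κ c ⊕ zero w = refl
pt-κ c ⊕ (plus a b) w = refl
pt-κ c ⊖ k w = refl

Unif : {X Y : Set} → (Bool → X → X) → (Bool → Y → Y) → (X → Y → Set) → Set
Unif f g R = ∀ c {x y} → R x y → R (f c x) (g c y)

-- Two relations realised by the same proof can only differ at points whose additive resolutions they share.
record Close {X Y : Set} (f : Bool → X → X) (g : Bool → Y → Y) (R : Ix → X → Y → Set) : Set where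
  field
    fill : ∀ {x y} → R true x y → (∀ c → R false (f c x) (g c y)) → R false x y
    shape : ∀ {x y} → R false x y → ∀ c → R true (f c x) (g c y)
open Close

tcdˢ : Signed → Sequent
tcdˢ (s , k) = tcd s k

ptˢ : ∀ A → W (tcdˢ A) → web A
ptˢ (s , k) = pt s k

κ⟨_⟩ : ∀ k → Bool → wk k → wk k
κ⟨ k ⟩ c = κ c k

κˢ : ∀ A → Bool → web A → web A
κˢ (_ , k) = κ⟨ k ⟩

-- Only the first proof carries both relations; the converse proof concerns `R true`. Closeness is
-- proved together with `=D` because both follow from the same matching of last rules. The ⊗'s of
-- the other formula are already decomposed, so that in the ⊗ case the context is synchronous.
Thm : Signed → Signed → Set₁
Thm A B = ∀ {R : Ix → web A → web B → Set} → Bij (R true) → Unif (κˢ A) (κˢ B) (R true) →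
  K (B ∷ tcdˢ A) (λ i bw → R i (ptˢ A (proj₂ bw)) (proj₁ bw)) →
  K (A ∷ tcdˢ B) (λ i aw → R true (proj₁ aw) (ptˢ B (proj₂ aw))) → emb A =D emb B × Close (κˢ A) (κˢ B) R

bij-∘ : ∀ {X X' Y : Set} {R : X → Y → Set} (f : X' → X) → (∀ x → Σ X' λ x' → f x' ≡ x) → (∀ {x x'} → f x ≡ f x' → x ≡ x') →
  Bij R → Bij (λ x y → R (f x) y)
bij-∘ {R = R} f s i b = record
  { tot = λ x → tot b (f x) ; sur = λ y → let (x , ρ) = sur b y ; (x' , e) = s x in x' , subst (λ x → R x y) (≡-sym e) ρ
  ; fun = fun b ; inj = λ p q → i (inj b p q) }

bij-flip : ∀ {X Y : Set} {R : X → Y → Set} → Bij R → Bij (λ y x → R x y)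
bij-flip b = record { tot = sur b ; sur = tot b ; fun = inj b ; inj = fun b }

bij-pt : ∀ A {Y} {R : web A → Y → Set} → Bij R → Bij (λ w y → R (ptˢ A w) y)
bij-pt (s , k) = bij-∘ (pt s k) (λ x → unpt s k x , pt-unpt s k x) (pt-inj s k)

-- Changing only the component that `Y` does not see keeps the image, against injectivity.
no-idle : ∀ {X X₁ X₂ Y : Set} (f : Fac X X₁ X₂) {R : X → Y → Set} {A : X₁ → Set} {B : X₂ → Y → Set} →
  (∀ x y → Iff (R x y) (A (l f x) × B (r f x) y)) → (Σ X₁ λ a → Σ X₁ λ a' → a ≢ a') → X₂ → Bij R → ⊥
no-idle f {R} {A} {B} e (a , a' , n) d b =
  let (y , ρ) = tot b (j f a d)
      (y' , ρ') = tot b (j f a' d)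
      α' = subst A (lj f a' d) (proj₁ (ltr (e _ _) ρ'))
      β = subst (λ d → B d y) (rj f a d) (proj₂ (ltr (e _ _) ρ))
      ρ″ = rtl (e (j f a' d) y) (subst A (≡-sym (lj f a' d)) α' , subst (λ d → B d y) (≡-sym (rj f a' d)) β)
  in n (≡-trans (≡-sym (lj f a d)) (≡-trans (cong (l f) (inj b ρ ρ″)) (lj f a' d)))

-- Matching the factors of a ⊗

all-spl : ∀ {p} {P : Signed → Set p} {Γ Γ₁ Γ₂} → Spl Γ Γ₁ Γ₂ → All P Γ → All P Γ₁ × All P Γ₂
all-spl [] [] = [] , []
all-spl (lft s) (p ∷ ps) = let (u , v) = all-spl s ps in (p ∷ u) , v
all-spl (rgt s) (p ∷ ps) = let (u , v) = all-spl s ps in u , (p ∷ v)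

factor-sync : ∀ s k → Factor (s , k) → Normal k → All Sync (tcd s k)
factor-sync ⊖ k f n = tt ∷ []
factor-sync ⊕ (lit x) f n = tt ∷ []
factor-sync ⊕ (tens (r , k) (t , l)) f ((g , h) , n , m) = ++⁺ (factor-sync r k g n) (factor-sync t l h m)

-- Both premises of the ⊗-rule found by `focus` realise bijections again, so they can be focused in
-- turn until all factors are separated.
decompose : ∀ s k {Gs} {Q : wk k → W Gs → Set} → All Sync Gs → Bij Q → K ((s , k) ∷ Gs) (λ _ aw → Q (proj₁ aw) (proj₂ aw)) →
  Decomp (tcd s k) Gs (λ w y → Q (pt s k w) y)
decompose-comp : ∀ H {Gs} {Q : web H → W Gs → Set} → K (dual H ∷ Gs) (λ _ aw → Q (proj₁ aw) (proj₂ aw)) → Decomp (H ∷ []) Gs (λ w y → Q (proj₁ w) y)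
decompose-comp H {Gs} {Q} k = cons {A = Q} (all-left Gs) k (nil λ _ _ → tt) λ x y →
  (λ q → subst (Q _) (≡-sym (left-all Gs y)) q , tt) , (λ { (q , _) → subst (Q _) (left-all Gs y) q })
decompose ⊖ k sy b π = decompose-comp (⊕ , k) π
decompose ⊕ (lit n) sy b π = decompose-comp (⊖ , lit n) π
decompose ⊕ unit sy b π = decompose-comp (⊖ , unit) π
decompose ⊕ zero sy b π = decompose-comp (⊖ , zero) π
decompose ⊕ (plus c d) sy b π = decompose-comp (⊖ , plus c d) π
decompose ⊕ (tens (r , k) (t , l)) {Gs} {Q} sy b π with focus {k = tens (r , k) (t , l)} sy (sur b) (fun b) π
... | ten {S = S} {T} q σ τ e =
  let S₁ = λ x y → S true (x , y)
      T₁ = λ x y → T true (x , y)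
      e₁ = λ x y → e true x y
      x₀ = dflt k true , dflt l true
      (sy₁ , sy₂) = all-spl q sy
  in Decomp-++ q (decompose r k {Q = S₁} sy₁ (bij-left ×-fac (spl-fac q) {Q} {S₁} {T₁} e₁ x₀ b) (K-reindex (λ _ → true) σ))
              (decompose t l {Q = T₁} sy₂ (bij-right ×-fac (spl-fac q) {Q} {S₁} {T₁} e₁ x₀ b) (K-reindex (λ _ → true) τ))
              λ x y → e true (pt ⊕ (tens (r , k) (t , l)) x) y

IH : Sequent → Sequent → Set₁
IH Δ Γ = All (λ H → All (λ G → Thm (dual H) (dual G)) Γ) Δ

-- A pair of `A` is completed to one of `R` by any pair of `B`, and then read through the other
-- factorisation.
same-factor : ∀ {X X₁ X₂ Y Y₁ Y₂ : Set} (f : Fac X X₁ X₂) (g : Fac Y Y₁ Y₂) {R : X → Y → Set} {A A' : X₁ → Y₁ → Set} {B B' : X₂ → Y₂ → Set} →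
  (∀ x y → Iff (R x y) (A (l f x) (l g y) × B (r f x) (r g y))) → (∀ x y → Iff (R x y) (A' (l f x) (l g y) × B' (r f x) (r g y))) →
  X → Bij R → ∀ {a b} → A a b → A' a b
same-factor f g {R} {A} {A'} {B} {B'} e e' x₀ b {a} {a'} p =
  subst₂ A' (lj f _ _) (lj g _ _) (proj₁ (ltr (e' _ _) (Product.conjoin f g {R} {A} {B} e p (proj₂ (ltr (e _ _) (proj₂ (tot b x₀)))))))

unif-left : ∀ {X X₁ X₂ Y Y₁ Y₂ : Set} (f : Fac X X₁ X₂) (g : Fac Y Y₁ Y₂) {R : X → Y → Set} {A : X₁ → Y₁ → Set} {B : X₂ → Y₂ → Set} →
  (∀ x y → Iff (R x y) (A (l f x) (l g y) × B (r f x) (r g y))) → {u : Bool → X → X} {u₁ : Bool → X₁ → X₁} {v : Bool → Y → Y} {v₁ : Bool → Y₁ → Y₁} →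
  (∀ c x → l f (u c x) ≡ u₁ c (l f x)) → (∀ c y → l g (v c y) ≡ v₁ c (l g y)) → X → Bij R → Unif u v R → Unif u₁ v₁ A
unif-left f g {R} {A} {B} e {u} {u₁} {v} {v₁} hu hv x₀ b un c {a} {a'} p =
  subst₂ A (≡-trans (hu c _) (cong (u₁ c) (lj f _ _))) (≡-trans (hv c _) (cong (v₁ c) (lj g _ _)))
    (proj₁ (ltr (e _ _) (un c (Product.conjoin f g {R} {A} {B} e p (proj₂ (ltr (e _ _) (proj₂ (tot b x₀))))))))

flip-iff : ∀ {R A B : Set} → Iff R (A × B) → Iff R (B × A)
flip-iff (p , q) = (λ ρ → let (a , b) = p ρ in b , a) , (λ { (b , a) → q (a , b) })

close-product : ∀ {X X₁ X₂ Y Y₁ Y₂ : Set} (f : Fac X X₁ X₂) (g : Fac Y Y₁ Y₂) {R : Ix → X → Y → Set} {A : Ix → X₁ → Y₁ → Set} {B : Ix → X₂ → Y₂ → Set} →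
  (∀ i x y → Iff (R i x y) (A i (l f x) (l g y) × B i (r f x) (r g y))) →
  {u : Bool → X → X} {u₁ : Bool → X₁ → X₁} {u₂ : Bool → X₂ → X₂} {v : Bool → Y → Y} {v₁ : Bool → Y₁ → Y₁} {v₂ : Bool → Y₂ → Y₂} →
  (∀ c x → l f (u c x) ≡ u₁ c (l f x)) → (∀ c x → r f (u c x) ≡ u₂ c (r f x)) →
  (∀ c y → l g (v c y) ≡ v₁ c (l g y)) → (∀ c y → r g (v c y) ≡ v₂ c (r g y)) →
  Close u₁ v₁ A → Close u₂ v₂ B → Close u v R
close-product f g {R} {A} {B} e h₁ h₂ h₃ h₄ C D = record
  { fill = λ {x} {y} ρ φ → let (a , b) = ltr (e true x y) ρ in rtl (e false x y)
      ( fill C a (λ c → subst₂ (A false) (h₁ c x) (h₃ c y) (proj₁ (ltr (e false _ _) (φ c))))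
      , fill D b (λ c → subst₂ (B false) (h₂ c x) (h₄ c y) (proj₂ (ltr (e false _ _) (φ c)))))
  ; shape = λ {x} {y} ρ c → let (a , b) = ltr (e false x y) ρ in rtl (e true _ _)
      ( subst₂ (A true) (≡-sym (h₁ c x)) (≡-sym (h₃ c y)) (shape C a c)
      , subst₂ (B true) (≡-sym (h₂ c x)) (≡-sym (h₄ c y)) (shape D b c)) }

TensClaim : Signed → Sequent → Set₁
TensClaim B Δ = ∀ {R : Ix → W Δ → web B → Set} → All Sync Δ → IH Δ (tcdˢ B) → Bij (R true) → Unif (λ c → κᵂ c) (κˢ B) (R true) →
  K (B ∷ Δ) (λ i bw → R i (proj₂ bw) (proj₁ bw)) → Decomp Δ (tcdˢ B) (λ h w → R true h (ptˢ B w)) →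
  ⨂ Δ =D emb B × Close (λ c → κᵂ c) (κˢ B) R

distinct-web : ∀ A → Σ (web A) λ a → Σ (web A) λ a' → a ≢ a'
distinct-web (_ , k) = distinct k

single : ∀ {H} {k} {f : Bool → wk k → wk k} {R : Ix → W (H ∷ []) → wk k → Set} → Close (κˢ H) f (λ i x y → R i (x , tt) y) → Close (λ c → κᵂ c {H ∷ []}) f R
single C = record { fill = λ { {x , _} ρ φ → fill C ρ φ } ; shape = λ { {x , _} ρ → shape C ρ } }

tens-comp : ∀ s k s' → (∀ {A} {Q : web A → wk k → Set} → K (A ∷ (s' , k) ∷ []) (λ _ aw → Q (proj₁ aw) (proj₁ (proj₂ aw))) →
    K (A ∷ tcd s k) (λ _ aw → Q (proj₁ aw) (pt s k (proj₂ aw)))) →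
  ∀ {Δ} {R : Ix → W Δ → wk k → Set} → All Sync Δ → All (λ H → Thm (dual H) (s , k)) Δ → Bij (R true) → Unif (λ c → κᵂ c) (κ⟨ k ⟩) (R true) →
  K ((s , k) ∷ Δ) (λ i bw → R i (proj₂ bw) (proj₁ bw)) → Decomp Δ ((s' , k) ∷ []) (λ h w → R true h (proj₁ w)) →
  ⨂ Δ =D emb (s , k) × Close (λ c → κᵂ c) κ⟨ k ⟩ R
tens-comp s k s' conv {(r , m) ∷ []} {R} (sy ∷ []) (th ∷ []) b u π (cons {A = A} (lft []) σ (nil {Q} h) e) =
  let (p , C) = go r m sy th b₁ u₁ π σ′ in trans ⊗-unit p , single {r , m} {k} {κ⟨ k ⟩} {R} C
  where
  R₁ : Ix → wk m → wk k → Set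
  R₁ i x y = R i (x , tt) y
  b₁ : Bij (R₁ true)
  b₁ = bij-∘ {R = R true} (λ x → x , tt) (λ { (x , _) → x , refl }) (λ e → cong proj₁ e) b
  u₁ : Unif κ⟨ m ⟩ κ⟨ k ⟩ (R₁ true)
  u₁ c = u c
  σ′ : K ((flip r , m) ∷ (s' , k) ∷ []) (λ _ aw → R₁ true (proj₁ aw) (proj₁ (proj₂ aw)))
  σ′ = K-resp (λ { _ (a , w) → (λ α → rtl (e (a , tt) w) (α , h _ _)) , (λ ρ → proj₁ (ltr (e (a , tt) w) ρ)) }) σ
  go : ∀ r m → Sync (r , m) → Thm (flip r , m) (s , k) → ∀ {R : Ix → wk m → wk k → Set} → Bij (R true) → Unif κ⟨ m ⟩ κ⟨ k ⟩ (R true) →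
    K ((s , k) ∷ (r , m) ∷ []) (λ i bw → R i (proj₁ (proj₂ bw)) (proj₁ bw)) →
    K ((flip r , m) ∷ (s' , k) ∷ []) (λ _ aw → R true (proj₁ aw) (proj₁ (proj₂ aw))) →
    emb (flip r , m) =D emb (s , k) × Close κ⟨ m ⟩ κ⟨ k ⟩ R
  go ⊕ m _ th {R} b u π σ = th {R} b u π (conv {⊖ , m} {R true} σ)
  go ⊖ (lit n) _ th {R} b u π σ = th {R} b u π (conv {⊕ , lit n} {R true} σ)
tens-comp s k s' conv {H ∷ H' ∷ Δ} {R} sy th b u π (cons {B = B} {A} (lft []) σ d e) =
  let (h , h' , n) = distinct-web H'
  in ⊥-elim (no-idle (flip-fac ×-fac) {λ x y → R true x y} {λ x → B x tt} {λ a y → A a (y , tt)} (λ { (a , x) y → flip-iff (e (a , x) (y , tt)) })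
       ((h , dfltᵂ Δ) , (h' , dfltᵂ Δ) , λ eq → n (cong proj₁ eq)) (proj₁ (distinct-web H)) b)
tens-comp s k s' conv {H ∷ H' ∷ Δ} {R} sy th b u π (cons {B = B} {A} (rgt []) σ d e) =
  ⊥-elim (no-idle ×-fac {λ x y → R true x y} {λ a → A a tt} {λ x y → B x (y , tt)} (λ { (a , x) y → e (a , x) (y , tt) }) (distinct-web H) (dfltᵂ (H' ∷ Δ)) b)

heads : ∀ {P : Signed → Signed → Set₁} {Δ G} → All (λ H → All (P H) (G ∷ [])) Δ → All (λ H → P H G) Δ
heads = mapᴬ λ { (t ∷ []) → t }

-- Focusing on the target splits `Δ`. Restricting the converse decomposition to this splitting
-- yields a splitting of the factors of the target, which `unique-splitting` identifies with the
-- canonical one. By `same-factor` the relations on each half agree, so both halves satisfy the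
-- claim's hypotheses.
tens-lemma : ∀ s k {Δ} → TensClaim (s , k) Δ
tens-lemma ⊖ k {R = R} sy ih b u π d = tens-comp ⊖ k ⊕ (λ σ → σ) {R = R} sy (heads ih) b u π d
tens-lemma ⊕ (lit n) {R = R} sy ih b u π d = tens-comp ⊕ (lit n) ⊖ (λ σ → σ) {R = R} sy (heads ih) b u π d
tens-lemma ⊕ unit {R = R} sy ih b u π d = tens-comp ⊕ unit ⊖ (λ σ → σ) {R = R} sy (heads ih) b u π d
tens-lemma ⊕ zero {R = R} sy ih b u π d = tens-comp ⊕ zero ⊖ (λ σ → σ) {R = R} sy (heads ih) b u π d
tens-lemma ⊕ (plus x y) {R = R} sy ih b u π d = tens-comp ⊕ (plus x y) ⊖ (λ σ → σ) {R = R} sy (heads ih) b u π d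
tens-lemma ⊕ (tens (s , k) (t , l)) {Δ} {R} sy ih b u π d with focus {k = tens (s , k) (t , l)} sy (tot b) (inj b) π
... | ten {Δ₁ = Δ₁} {Δ₂} {S = S} {T} q σ τ e = finish (Restricted.spl rs) (Restricted.dec₁ rs) (Restricted.dec₂ rs) (Restricted.factor rs)
    (unique-splitting (spl-fac q) (Restricted.spl rs) cn {Rw} {Restricted.Q₁ rs} {Restricted.Q₂ rs} {S′} {T′} (dfltᵂ Δ) bw (Restricted.factor rs) e′)
  where
  cn = canon (tcd s k) (tcd t l)
  Rw : W Δ → W (tcd s k ++ tcd t l) → Set
  Rw h w = R true h (pt ⊕ (tens (s , k) (t , l)) w)
  bw : Bij Rw
  bw = bij-flip (bij-pt (⊕ , tens (s , k) (t , l)) (bij-flip b))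
  rs : Restricted q (tcd s k ++ tcd t l) Rw
  rs = restrict q d
  S₁ : Ix → W Δ₁ → wk k → Set
  S₁ i x y = S i (y , x)
  T₁ : Ix → W Δ₂ → wk l → Set
  T₁ i x y = T i (y , x)
  S′ : W Δ₁ → W (tcd s k) → Set
  S′ h w = S₁ true h (pt s k w)
  T′ : W Δ₂ → W (tcd t l) → Set
  T′ h w = T₁ true h (pt t l w)
  e′ : ∀ h w → Iff (Rw h w) (S′ (left q h) (left cn w) × T′ (right q h) (right cn w))
  e′ h w = e true _ h
  e₁ : ∀ i h p → Iff (R i h p) (S₁ i (left q h) (proj₁ p) × T₁ i (right q h) (proj₂ p))
  e₁ i h p = e i p h
  finish : ∀ {Γ₁ Γ₂} (sp : Spl (tcd s k ++ tcd t l) Γ₁ Γ₂) {Q₁ : W Δ₁ → W Γ₁ → Set} {Q₂ : W Δ₂ → W Γ₂ → Set} → Decomp Δ₁ Γ₁ Q₁ → Decomp Δ₂ Γ₂ Q₂ →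
    (∀ x y → Iff (Rw x y) (Q₁ (left q x) (left sp y) × Q₂ (right q x) (right sp y))) →
    splitting sp ≡ splitting cn → ⨂ Δ =D emb (⊕ , tens (s , k) (t , l)) × Close (λ c → κᵂ c) κ⟨ tens (s , k) (t , l) ⟩ R
  finish .cn {Q₁} {Q₂} d₁ d₂ f refl =
    let (sy₁ , sy₂) = all-spl q sy
        (ih₁ , ih₂) = all-spl q ih
        (p₁ , C₁) = tens-lemma s k {R = S₁} sy₁ (mapᴬ (++⁻ˡ (tcd s k)) ih₁)
          (bij-left (spl-fac q) ×-fac {R true} {S₁ true} {T₁ true} (e₁ true) (dfltᵂ Δ) b)
          (unif-left (spl-fac q) ×-fac {R true} {S₁ true} {T₁ true} (e₁ true) {u₁ = λ c → κᵂ c} {v₁ = κ⟨ k ⟩} (λ c → left-κ c q) (λ _ _ → refl) (dfltᵂ Δ) b u)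
          σ (Decomp-resp (λ x y → same-factor (spl-fac q) (spl-fac cn) {Rw} {Q₁} {S′} {Q₂} {T′} f e′ (dfltᵂ Δ) bw
                             , same-factor (spl-fac q) (spl-fac cn) {Rw} {S′} {Q₁} {T′} {Q₂} e′ f (dfltᵂ Δ) bw) d₁)
        (p₂ , C₂) = tens-lemma t l {R = T₁} sy₂ (mapᴬ (++⁻ʳ (tcd s k)) ih₂)
          (bij-right (spl-fac q) ×-fac {R true} {S₁ true} {T₁ true} (e₁ true) (dfltᵂ Δ) b)
          (unif-left (flip-fac (spl-fac q)) (flip-fac ×-fac) {R true} {T₁ true} {S₁ true} (λ x y → flip-iff (e₁ true x y)) {u₁ = λ c → κᵂ c} {v₁ = κ⟨ l ⟩}
            (λ c → right-κ c q) (λ _ _ → refl) (dfltᵂ Δ) b u)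
          τ (Decomp-resp (λ x y → same-factor (flip-fac (spl-fac q)) (flip-fac (spl-fac cn)) {Rw} {Q₂} {T′} {Q₁} {S′} (λ x y → flip-iff (f x y)) (λ x y → flip-iff (e′ x y)) (dfltᵂ Δ) bw
                             , same-factor (flip-fac (spl-fac q)) (flip-fac (spl-fac cn)) {Rw} {T′} {Q₂} {S′} {Q₁} (λ x y → flip-iff (e′ x y)) (λ x y → flip-iff (f x y)) (dfltᵂ Δ) bw) d₂)
    in trans (⨂-spl q) (⊗-cong p₁ p₂)
     , close-product (spl-fac q) ×-fac {R} {S₁} {T₁} e₁ (λ c → left-κ c q) (λ c → right-κ c q) (λ _ _ → refl) (λ _ _ → refl) C₁ C₂


-- Matching the summands of a ⊕

Sum : Sequent → Set
Sum [] = ⊥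
Sum (c ∷ L) = web c ⊎ Sum L

ιˡ : ∀ {L L₁ L₂} → Spl L L₁ L₂ → Sum L₁ → Sum L
ιˡ (lft q) (inj₁ x) = inj₁ x
ιˡ (lft q) (inj₂ x) = inj₂ (ιˡ q x)
ιˡ (rgt q) x = inj₂ (ιˡ q x)

ιʳ : ∀ {L L₁ L₂} → Spl L L₁ L₂ → Sum L₂ → Sum L
ιʳ (lft q) x = inj₂ (ιʳ q x)
ιʳ (rgt q) (inj₁ x) = inj₁ x
ιʳ (rgt q) (inj₂ x) = inj₂ (ιʳ q x)

data Side {L L₁ L₂} (q : Spl L L₁ L₂) : Sum L → Set where
  isˡ : ∀ x → Side q (ιˡ q x)
  isʳ : ∀ x → Side q (ιʳ q x)

side : ∀ {L L₁ L₂} (q : Spl L L₁ L₂) x → Side q x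
side (lft q) (inj₁ x) = isˡ (inj₁ x)
side (lft q) (inj₂ x) with side q x
... | isˡ y = isˡ (inj₂ y)
... | isʳ y = isʳ y
side (rgt q) (inj₁ x) = isʳ (inj₁ x)
side (rgt q) (inj₂ x) with side q x
... | isˡ y = isˡ y
... | isʳ y = isʳ (inj₂ y)

fork : ∀ {L L₁ L₂} → Spl L L₁ L₂ → Sum L → Sum L₁ ⊎ Sum L₂
fork (lft q) (inj₁ x) = inj₁ (inj₁ x)
fork (lft q) (inj₂ x) = map⊎ inj₂ (λ y → y) (fork q x)
fork (rgt q) (inj₁ x) = inj₂ (inj₁ x)
fork (rgt q) (inj₂ x) = map⊎ (λ y → y) inj₂ (fork q x)

fork-ιˡ : ∀ {L L₁ L₂} (q : Spl L L₁ L₂) x → fork q (ιˡ q x) ≡ inj₁ x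
fork-ιˡ (lft q) (inj₁ x) = refl
fork-ιˡ (lft q) (inj₂ x) = cong (map⊎ inj₂ (λ y → y)) (fork-ιˡ q x)
fork-ιˡ (rgt q) x = cong (map⊎ (λ y → y) inj₂) (fork-ιˡ q x)

fork-ιʳ : ∀ {L L₁ L₂} (q : Spl L L₁ L₂) x → fork q (ιʳ q x) ≡ inj₂ x
fork-ιʳ (lft q) x = cong (map⊎ inj₂ (λ y → y)) (fork-ιʳ q x)
fork-ιʳ (rgt q) (inj₁ x) = refl
fork-ιʳ (rgt q) (inj₂ x) = cong (map⊎ (λ y → y) inj₂) (fork-ιʳ q x)

ιˡ-inj : ∀ {L L₁ L₂} (q : Spl L L₁ L₂) {x y} → ιˡ q x ≡ ιˡ q y → x ≡ y
ιˡ-inj q {x} {y} e = inj₁-injective (≡-trans (≡-sym (fork-ιˡ q x)) (≡-trans (cong (fork q) e) (fork-ιˡ q y)))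

ιʳ-inj : ∀ {L L₁ L₂} (q : Spl L L₁ L₂) {x y} → ιʳ q x ≡ ιʳ q y → x ≡ y
ιʳ-inj q {x} {y} e = inj₂-injective (≡-trans (≡-sym (fork-ιʳ q x)) (≡-trans (cong (fork q) e) (fork-ιʳ q y)))

κΣ : ∀ L → Bool → Sum L → Sum L
κΣ ((_ , k) ∷ L) c (inj₁ x) = inj₁ (κ c k x)
κΣ (_ ∷ L) c (inj₂ x) = inj₂ (κΣ L c x)

ιˡ-κ : ∀ {L L₁ L₂} (q : Spl L L₁ L₂) c x → ιˡ q (κΣ L₁ c x) ≡ κΣ L c (ιˡ q x)
ιˡ-κ (lft q) c (inj₁ x) = refl
ιˡ-κ (lft q) c (inj₂ x) = cong inj₂ (ιˡ-κ q c x)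
ιˡ-κ (rgt q) c x = cong inj₂ (ιˡ-κ q c x)

ιʳ-κ : ∀ {L L₁ L₂} (q : Spl L L₁ L₂) c x → ιʳ q (κΣ L₂ c x) ≡ κΣ L c (ιʳ q x)
ιʳ-κ (lft q) c x = cong inj₂ (ιʳ-κ q c x)
ιʳ-κ (rgt q) c (inj₁ x) = refl
ιʳ-κ (rgt q) c (inj₂ x) = cong inj₂ (ιʳ-κ q c x)

inS : ∀ {c L Δ} → Sel c L Δ → web c → Sum L
inS here x = inj₁ x
inS (there s) x = inj₂ (inS s x)

record Moved {c L L'} (j : Sum L' → Sum L) (i : web c → Sum L) : Set where
  field
    {Δ} : Sequent
    sel : Sel c L' Δ
    same : ∀ x → i x ≡ j (inS sel x)

moveˡ : ∀ {c L L₁ L₂ Δ} (q : Spl L L₁ L₂) (s : Sel c L₁ Δ) → Σ Sequent λ Δ' → Σ (Sel c L Δ') λ s' → ∀ x → inS s' x ≡ ιˡ q (inS s x)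
moveˡ (lft q) here = _ , here , λ _ → refl
moveˡ (lft q) (there s) = let (_ , s' , e) = moveˡ q s in _ , there s' , λ x → cong inj₂ (e x)
moveˡ (rgt q) s = let (_ , s' , e) = moveˡ q s in _ , there s' , λ x → cong inj₂ (e x)

moveʳ : ∀ {c L L₁ L₂ Δ} (q : Spl L L₁ L₂) (s : Sel c L₂ Δ) → Σ Sequent λ Δ' → Σ (Sel c L Δ') λ s' → ∀ x → inS s' x ≡ ιʳ q (inS s x)
moveʳ (rgt q) here = _ , here , λ _ → refl
moveʳ (rgt q) (there s) = let (_ , s' , e) = moveʳ q s in _ , there s' , λ x → cong inj₂ (e x)
moveʳ (lft q) s = let (_ , s' , e) = moveʳ q s in _ , there s' , λ x → cong inj₂ (e x)

unmove : ∀ {c L L₁ L₂ Δ} (q : Spl L L₁ L₂) (s : Sel c L Δ) → Moved {c} {L} {L₁} (ιˡ q) (inS s) ⊎ Moved {c} {L} {L₂} (ιʳ q) (inS s)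
unmove (lft q) here = inj₁ record { sel = here ; same = λ _ → refl }
unmove (rgt q) here = inj₂ record { sel = here ; same = λ _ → refl }
unmove (lft q) (there s) with unmove q s
... | inj₁ m = inj₁ record { sel = there (Moved.sel m) ; same = λ x → cong inj₂ (Moved.same m x) }
... | inj₂ m = inj₂ record { sel = Moved.sel m ; same = λ x → cong inj₂ (Moved.same m x) }
unmove (rgt q) (there s) with unmove q s
... | inj₁ m = inj₁ record { sel = Moved.sel m ; same = λ x → cong inj₂ (Moved.same m x) }
... | inj₂ m = inj₂ record { sel = there (Moved.sel m) ; same = λ x → cong inj₂ (Moved.same m x) }

-- The premises of the iterated &-rule: one proof of `B` from each summand, each realising its part
-- of `Q`.
data Prem (B : Signed) : (L : Sequent) → (Ix → Sum L → web B → Set) → Set₁ where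
  []  : ∀ {Q} → Prem B [] Q
  _∷_ : ∀ {c L Q} → K (B ∷ tcdˢ c) (λ i bw → Q i (inj₁ (ptˢ c (proj₂ bw))) (proj₁ bw)) → Prem B L (λ i x → Q i (inj₂ x)) → Prem B (c ∷ L) Q

Prem-resp : ∀ {B L Q Q'} → (∀ i x b → Iff (Q i x b) (Q' i x b)) → Prem B L Q → Prem B L Q'
Prem-resp e [] = []
Prem-resp e (k ∷ p) = K-resp (λ i _ → e i _ _) k ∷ Prem-resp (λ i x → e i (inj₂ x)) p

Prem-++ : ∀ {B L L₁ L₂ Q} (q : Spl L L₁ L₂) → Prem B L₁ (λ i x → Q i (ιˡ q x)) → Prem B L₂ (λ i x → Q i (ιʳ q x)) → Prem B L Q
Prem-++ [] p p' = []
Prem-++ (lft q) (k ∷ p) p' = k ∷ Prem-++ q p p'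
Prem-++ (rgt q) p (k ∷ p') = k ∷ Prem-++ q p p'

-- `𝟏ˢ` needs a clause of its own: its sequent is ⊥, which is not synchronous, yet nothing but the
-- ⊥-rule can precede the choice of a summand.
Committing : Signed → Set
Committing c = All Sync (tcdˢ c) ⊎ c ≡ 𝟏ˢ

data Commit (a b : Signed) (Δ : Sequent) (Q : Ix → web a ⊎ web b → W Δ → Set) : Set₁ where
  fst : K (a ∷ Δ) (λ i xw → Q i (inj₁ (proj₁ xw)) (proj₂ xw)) → (∀ i y w → ¬ Q i (inj₂ y) w) → Commit a b Δ Q
  snd : K (b ∷ Δ) (λ i xw → Q i (inj₂ (proj₁ xw)) (proj₂ xw)) → (∀ i y w → ¬ Q i (inj₁ y) w) → Commit a b Δ Q

commit : ∀ c {a b} {Q : Ix → web a ⊎ web b → W (tcdˢ c) → Set} → Committing c → Totalᵒ (Q true) → Injᵒ (Q true) →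
  K ((⊕ , plus a b) ∷ tcdˢ c) (λ i xw → Q i (proj₁ xw) (proj₂ xw)) → Commit a b (tcdˢ c) Q
commit c {a} {b} (inj₁ sy) tt' in' π with focus {k = plus a b} sy tt' in' π
... | pl₁ k e = fst (K-resp (λ i xw → let (f , g) = e i (inj₁ (proj₁ xw)) (proj₂ xw) in g , f) k) λ i y w → proj₁ (e i (inj₂ y) w)
... | pl₂ k e = snd (K-resp (λ i xw → let (f , g) = e i (inj₂ (proj₁ xw)) (proj₂ xw) in g , f) k) λ i y w → proj₁ (e i (inj₁ y) w)
commit c (inj₂ refl) _ _ (pl₁ here k e) =
  fst (K-resp (λ i xw → let (f , g) = e i (inj₁ (proj₁ xw) , proj₂ xw) in g , f) k) λ i y w → proj₁ (e i (inj₂ y , w))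
commit c (inj₂ refl) _ _ (pl₂ here k e) =
  snd (K-resp (λ i xw → let (f , g) = e i (inj₂ (proj₁ xw) , proj₂ xw) in g , f) k) λ i y w → proj₁ (e i (inj₁ y , w))
-- The choice sits above the ⊥-rule; it is removed and the ⊥-rule kept. No label of ⊥ can bring back
-- the discarded summand.
commit c (inj₂ refl) _ _ (bot (there here) (pl₁ here k e)) =
  fst (bot (there here) (K-resp (λ i xw → let (f , g) = e i (inj₁ (proj₁ xw) , tt) in g , f) k)) λ { i y (j , _) q → proj₁ (e i (inj₂ y , tt)) (j , q) }
commit c (inj₂ refl) _ _ (bot (there here) (pl₂ here k e)) =
  snd (bot (there here) (K-resp (λ i xw → let (f , g) = e i (inj₂ (proj₁ xw) , tt) in g , f) k)) λ { i y (j , _) q → proj₁ (e i (inj₁ y , tt)) (j , q) }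

commit c (inj₂ refl) _ _ (ten (there (there ())) q k k' e)
commit c (inj₂ refl) _ _ (prl (there (there ())) k e)
commit c (inj₂ refl) _ _ (pl₁ (there (there ())) k e)
commit c (inj₂ refl) _ _ (pl₂ (there (there ())) k e)
commit c (inj₂ refl) _ _ (wth (there (there ())) k k' e)
commit c (inj₂ refl) _ _ (top (there (there ())))
commit c (inj₂ refl) _ _ (bot (there here) (ten (there ()) q k k' e))
commit c (inj₂ refl) _ _ (bot (there here) (prl (there ()) k e))
commit c (inj₂ refl) _ _ (bot (there here) (wth (there ()) k k' e))
commit c (inj₂ refl) _ _ (bot (there here) (bot (there ()) k))
commit c (inj₂ refl) _ _ (bot (there here) (top (there ())))

record Parted (a b : Signed) (L : Sequent) (Q : Ix → Sum L → web a ⊎ web b → Set) : Set₁ where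
  field
    {L₁ L₂} : Sequent
    q : Spl L L₁ L₂
    prem₁ : Prem a L₁ (λ i x y → Q i (ιˡ q x) (inj₁ y))
    prem₂ : Prem b L₂ (λ i x y → Q i (ιʳ q x) (inj₂ y))
    no₁ : ∀ i x y → ¬ Q i (ιˡ q x) (inj₂ y)
    no₂ : ∀ i x y → ¬ Q i (ιʳ q x) (inj₁ y)

-- Each summand of the source commits to one side of the ⊕, and these commitments sort the source
-- into two parts with no relation across.
part : ∀ {a b L Q} → All Committing L → (∀ x → Σ _ (Q true x)) → (∀ {x x' y} → Q true x y → Q true x' y → x ≡ x') →
  Prem (⊕ , plus a b) L Q → Parted a b L Q
part [] t i [] = record { q = [] ; prem₁ = [] ; prem₂ = [] ; no₁ = λ _ () ; no₂ = λ _ () }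
part {a} {b} {c ∷ L} {Q} (cm ∷ cms) t i (k ∷ p)
  with commit c {a} {b} {λ i b w → Q i (inj₁ (ptˢ c w)) b} cm (λ w → t _) (λ r s → pt-inj (Signed.sign c) (Signed.skel c) (inj₁-injective (i r s))) k
     | part {Q = λ i x → Q i (inj₂ x)} cms (λ x → t (inj₂ x)) (λ r s → inj₂-injective (i r s)) p
... | fst k' n | ps = record { q = lft q ; prem₁ = k' ∷ prem₁ ; prem₂ = prem₂
      ; no₁ = λ { i (inj₁ x) y r → n i y (unpt (Signed.sign c) (Signed.skel c) x) (subst (λ x → Q i (inj₁ x) (inj₂ y)) (≡-sym (pt-unpt (Signed.sign c) _ x)) r) ; i (inj₂ x) → no₁ i x } ; no₂ = no₂ } where open Parted ps
... | snd k' n | ps = record { q = rgt q ; prem₁ = prem₁ ; prem₂ = k' ∷ prem₂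
      ; no₁ = no₁ ; no₂ = λ { i (inj₁ x) y r → n i y (unpt (Signed.sign c) (Signed.skel c) x) (subst (λ x → Q i (inj₁ x) (inj₁ y)) (≡-sym (pt-unpt (Signed.sign c) _ x)) r) ; i (inj₂ x) → no₂ i x } } where open Parted ps

comps : Sign → Skeleton → Sequent
comps ⊕ (plus (r , k) (t , l)) = comps r k ++ comps t l
comps ⊕ (lit n) = (⊕ , lit n) ∷ []
comps ⊕ unit = (⊕ , unit) ∷ []
comps ⊕ zero = (⊕ , zero) ∷ []
comps ⊕ (tens a b) = (⊕ , tens a b) ∷ []
comps ⊖ k = (⊖ , k) ∷ []

-- In the converse proof the component `d` commits to one summand `c` of the source; `covers` says
-- that all points of `d` are matched within it.
record Origin (L : Sequent) (d : Signed) (Q : Sum L → web d → Set) : Set₁ where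
  field
    {c} : Signed
    {Δ} : Sequent
    sel : Sel c L Δ
    proof : K (c ∷ tcdˢ d) (λ _ aw → Q (inS sel (proj₁ aw)) (ptˢ d (proj₂ aw)))
    covers : ∀ y → Σ (web c) λ x → Q (inS sel x) y

Src : ∀ (s : Sign) k (L : Sequent) → (Sum L → wk k → Set) → Set₁
Src ⊕ (plus (r , k) (t , l)) L Q = Src r k L (λ x y → Q x (inj₁ y)) × Src t l L (λ x y → Q x (inj₂ y))
Src ⊕ (lit n) L Q = Origin L (⊕ , lit n) Q
Src ⊕ unit L Q = Origin L (⊕ , unit) Q
Src ⊕ zero L Q = Origin L (⊕ , zero) Q
Src ⊕ (tens a b) L Q = Origin L (⊕ , tens a b) Q
Src ⊖ k L Q = Origin L (⊖ , k) Q

Lands : ∀ {L L' Y} → (Sum L' → Sum L) → (Sum L → Y → Set) → Set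
Lands {L} {L'} {Y} j Q = ∀ {c Δ} (s : Sel c L Δ) → Moved {c} {L} {L'} j (inS s) ⊎ (∀ x y → ¬ Q (inS s x) y)

-- An origin cannot lie among the summands unrelated to `Q`: it covers every point of `d`, and webs
-- are inhabited.
origin-restrict : ∀ {L L' d} {Q : Sum L → web d → Set} (j : Sum L' → Sum L) → Lands {L} {L'} j Q → Origin L d Q → Origin L' d (λ x y → Q (j x) y)
origin-restrict {d = d} {Q} j f o with f (Origin.sel o)
... | inj₁ m = record { sel = Moved.sel m
                      ; proof = K-resp (λ _ aw → subst (λ z → Q z (ptˢ d (proj₂ aw))) (Moved.same m _) , subst (λ z → Q z (ptˢ d (proj₂ aw))) (≡-sym (Moved.same m _))) (Origin.proof o)
                      ; covers = λ y → let (x , r) = Origin.covers o y in x , subst (λ z → Q z y) (Moved.same m x) r }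
... | inj₂ n = let (_ , k) = d ; (x , r) = Origin.covers o (dflt k true) in ⊥-elim (n x _ r)

src-restrict : ∀ (s : Sign) k {L L'} {Q : Sum L → wk k → Set} (j : Sum L' → Sum L) → Lands {L} {L'} j Q → Src s k L Q → Src s k L' (λ x y → Q (j x) y)
src-restrict ⊕ (plus (r , k) (t , l)) {L} {L'} {Q} j f (u , v) =
  src-restrict r k {Q = λ x y → Q x (inj₁ y)} j (λ s → map⊎ (λ m → m) (λ n x y → n x (inj₁ y)) (f s)) u
  , src-restrict t l {Q = λ x y → Q x (inj₂ y)} j (λ s → map⊎ (λ m → m) (λ n x y → n x (inj₂ y)) (f s)) v
src-restrict ⊕ (lit n) j = origin-restrict j
src-restrict ⊕ unit j = origin-restrict j
src-restrict ⊕ zero j = origin-restrict j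
src-restrict ⊕ (tens a b) j = origin-restrict j
src-restrict ⊖ k j = origin-restrict j

at : ∀ s k → Sum (comps s k) → wk k
at ⊕ (plus (r , k) (t , l)) x = map⊎ (at r k) (at t l) (fork (canon (comps r k) (comps t l)) x)
at ⊕ (lit n) (inj₁ x) = x
at ⊕ unit (inj₁ x) = x
at ⊕ zero (inj₁ x) = x
at ⊕ (tens a b) (inj₁ x) = x
at ⊖ k (inj₁ x) = x

at-ιˡ : ∀ r k t l x → at ⊕ (plus (r , k) (t , l)) (ιˡ (canon (comps r k) (comps t l)) x) ≡ inj₁ (at r k x)
at-ιˡ r k t l x = cong (map⊎ (at r k) (at t l)) (fork-ιˡ (canon (comps r k) (comps t l)) x)

at-ιʳ : ∀ r k t l x → at ⊕ (plus (r , k) (t , l)) (ιʳ (canon (comps r k) (comps t l)) x) ≡ inj₂ (at t l x)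
at-ιʳ r k t l x = cong (map⊎ (at r k) (at t l)) (fork-ιʳ (canon (comps r k) (comps t l)) x)

un : ∀ s k → wk k → Sum (comps s k)
un ⊕ (plus (r , k) (t , l)) (inj₁ x) = ιˡ (canon (comps r k) (comps t l)) (un r k x)
un ⊕ (plus (r , k) (t , l)) (inj₂ x) = ιʳ (canon (comps r k) (comps t l)) (un t l x)
un ⊕ (lit n) x = inj₁ x
un ⊕ unit x = inj₁ x
un ⊕ zero x = inj₁ x
un ⊕ (tens a b) x = inj₁ x
un ⊖ k x = inj₁ x

at-un : ∀ s k x → at s k (un s k x) ≡ x
at-un ⊕ (plus (r , k) (t , l)) (inj₁ x) = ≡-trans (at-ιˡ r k t l _) (cong inj₁ (at-un r k x))
at-un ⊕ (plus (r , k) (t , l)) (inj₂ x) = ≡-trans (at-ιʳ r k t l _) (cong inj₂ (at-un t l x))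
at-un ⊕ (lit n) x = refl
at-un ⊕ unit x = refl
at-un ⊕ zero x = refl
at-un ⊕ (tens a b) x = refl
at-un ⊖ k x = refl

un-at : ∀ s k x → un s k (at s k x) ≡ x
un-at ⊕ (plus (r , k) (t , l)) x with side (canon (comps r k) (comps t l)) x
... | isˡ y = ≡-trans (cong (un ⊕ (plus (r , k) (t , l))) (at-ιˡ r k t l y)) (cong (ιˡ (canon (comps r k) (comps t l))) (un-at r k y))
... | isʳ y = ≡-trans (cong (un ⊕ (plus (r , k) (t , l))) (at-ιʳ r k t l y)) (cong (ιʳ (canon (comps r k) (comps t l))) (un-at t l y))
un-at ⊕ (lit n) (inj₁ x) = refl
un-at ⊕ unit (inj₁ x) = refl
un-at ⊕ zero (inj₁ x) = refl
un-at ⊕ (tens a b) (inj₁ x) = refl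
un-at ⊖ k (inj₁ x) = refl

un-κ : ∀ s k c x → un s k (κ c k x) ≡ κΣ (comps s k) c (un s k x)
un-κ ⊕ (plus (r , k) (t , l)) c (inj₁ x) = ≡-trans (cong (ιˡ (canon (comps r k) (comps t l))) (un-κ r k c x)) (ιˡ-κ (canon (comps r k) (comps t l)) c _)
un-κ ⊕ (plus (r , k) (t , l)) c (inj₂ x) = ≡-trans (cong (ιʳ (canon (comps r k) (comps t l))) (un-κ t l c x)) (ιʳ-κ (canon (comps r k) (comps t l)) c _)
un-κ ⊕ (lit n) c x = refl
un-κ ⊕ unit c x = refl
un-κ ⊕ zero c x = refl
un-κ ⊕ (tens a b) c x = refl
un-κ ⊖ k c x = refl

at-κ : ∀ s k c x → at s k (κΣ (comps s k) c x) ≡ κ c k (at s k x)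
at-κ s k c x = ≡-trans (cong (λ x → at s k (κΣ (comps s k) c x)) (≡-sym (un-at s k x)))
  (≡-trans (cong (at s k) (≡-sym (un-κ s k c (at s k x)))) (at-un s k _))

⨁-comps : ∀ s k → ⨁ (comps s k) =D emb (s , k)
⨁-comps ⊕ (plus (r , k) (t , l)) = trans (⨁-spl (canon (comps r k) (comps t l))) (⊕-cong (⨁-comps r k) (⨁-comps t l))
⨁-comps ⊕ (lit n) = ⊕-unitʳ
⨁-comps ⊕ unit = ⊕-unitʳ
⨁-comps ⊕ zero = ⊕-unitʳ
⨁-comps ⊕ (tens a b) = ⊕-unitʳ
⨁-comps ⊖ k = ⊕-unitʳ

toPrem : ∀ {B} s k {R : Ix → wk k → web B → Set} → K (B ∷ dual (s , k) ∷ []) (λ i bx → R i (proj₁ (proj₂ bx)) (proj₁ bx)) →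
  Prem B (comps s k) (λ i x b → R i (at s k x) b)
toPrem-comp : ∀ {B} c {R : Ix → web c → web B → Set} → K (B ∷ dual c ∷ []) (λ i bx → R i (proj₁ (proj₂ bx)) (proj₁ bx)) →
  K (B ∷ tcdˢ c) (λ i bw → R i (ptˢ c (proj₂ bw)) (proj₁ bw))
toPrem-comp c {R} π = K-resp (λ { i (b , w) → (λ { (n , r , refl) → r }) , (λ r → _ , r , refl) })
  (cut₂ {x = λ i a w → a ≡ ptˢ c w} π (P.to-dd (tcdᵛ (Signed.sign c) (Signed.skel c))))
inlᵛ : ∀ a b → P.Val (⊕ , plus a b) (dual a ∷ []) (λ i n x → n ≡ inj₁ (proj₁ x))
inlᵛ a b = P.intro λ Y s → P.by (λ i ω → (λ { (x , refl , y) → inj₁ x , refl , y }) , (λ { (inj₁ x , refl , y) → x , refl , y }))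
  (P.pairing (idᵛ a) (P.val (proj₁ (P.raw Y))) s)
inrᵛ : ∀ a b → P.Val (⊕ , plus a b) (dual b ∷ []) (λ i n x → n ≡ inj₂ (proj₁ x))
inrᵛ a b = P.intro λ Y s → P.by (λ i ω → (λ { (x , refl , y) → inj₂ x , refl , y }) , (λ { (inj₂ x , refl , y) → x , refl , y }))
  (P.pairing (idᵛ b) (P.val (proj₂ (P.raw Y))) s)
choose₁ : ∀ {B a b} {R : Ix → web a ⊎ web b → web B → Set} → K (B ∷ (⊖ , plus a b) ∷ []) (λ i bx → R i (proj₁ (proj₂ bx)) (proj₁ bx)) →
  K (B ∷ dual a ∷ []) (λ i bx → R i (inj₁ (proj₁ (proj₂ bx))) (proj₁ bx))
choose₁ {a = a} {b} π = K-resp (λ { i (b , w) → (λ { (n , r , refl) → r }) , (λ r → _ , r , refl) }) (cut₂ {x = λ i n x → n ≡ inj₁ (proj₁ x)} π (inlᵛ a b))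
choose₂ : ∀ {B a b} {R : Ix → web a ⊎ web b → web B → Set} → K (B ∷ (⊖ , plus a b) ∷ []) (λ i bx → R i (proj₁ (proj₂ bx)) (proj₁ bx)) →
  K (B ∷ dual b ∷ []) (λ i bx → R i (inj₂ (proj₁ (proj₂ bx))) (proj₁ bx))
choose₂ {a = a} {b} π = K-resp (λ { i (b , w) → (λ { (n , r , refl) → r }) , (λ r → _ , r , refl) }) (cut₂ {x = λ i n x → n ≡ inj₂ (proj₁ x)} π (inrᵛ a b))
toPrem ⊕ (plus (r , k) (t , l)) {R} π = Prem-++ (canon (comps r k) (comps t l))
  (Prem-resp (λ i x b → subst (λ z → R i z b) (≡-sym (at-ιˡ r k t l x)) , subst (λ z → R i z b) (at-ιˡ r k t l x)) (toPrem r k (choose₁ {R = R} π)))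
  (Prem-resp (λ i x b → subst (λ z → R i z b) (≡-sym (at-ιʳ r k t l x)) , subst (λ z → R i z b) (at-ιʳ r k t l x)) (toPrem t l (choose₂ {R = R} π)))
toPrem ⊕ (lit n) {R} π = toPrem-comp (⊕ , lit n) {R} π ∷ []
toPrem ⊕ unit {R} π = toPrem-comp (⊕ , unit) {R} π ∷ []
toPrem ⊕ zero {R} π = toPrem-comp (⊕ , zero) {R} π ∷ []
toPrem ⊕ (tens a b) {R} π = toPrem-comp (⊕ , tens a b) {R} π ∷ []
toPrem ⊖ k {R} π = toPrem-comp (⊖ , k) {R} π ∷ []

-- Descent along the ⊕'s of the source: at each one `commit` selects a side, and this side still
-- reaches every point of `d` because the other one is unrelated to it.
locate : ∀ s k d {Q : wk k → web d → Set} → Committing d → Totalᵒ Q → Injᵒ Q → K ((s , k) ∷ tcdˢ d) (λ _ aw → Q (proj₁ aw) (ptˢ d (proj₂ aw))) →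
  Origin (comps s k) d (λ x y → Q (at s k x) y)
locate-comp : ∀ c d {Q : web c → web d → Set} (f : Sum (c ∷ []) → web c) → (∀ x → f (inj₁ x) ≡ x) → Totalᵒ Q → K (c ∷ tcdˢ d) (λ _ aw → Q (proj₁ aw) (ptˢ d (proj₂ aw))) →
  Origin (c ∷ []) d (λ x y → Q (f x) y)
locate-comp c d {Q} f e t π = record { sel = here
  ; proof = K-resp (λ _ aw → subst (λ x → Q x (ptˢ d (proj₂ aw))) (≡-sym (e _)) , subst (λ x → Q x (ptˢ d (proj₂ aw))) (e _)) π
  ; covers = λ y → let (x , r) = t y in x , subst (λ x → Q x y) (≡-sym (e x)) r }
locate ⊕ (plus (r , k) (t , l)) d@(u , m) {Q} cm tt' in' π
  with commit d {r , k} {t , l} {λ i x w → Q x (ptˢ d w)} cm (λ w → tt' (ptˢ d w)) (λ p q → pt-inj u m (in' p q)) π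
... | fst κ₁ n = record { sel = proj₁ (proj₂ mv)
      ; proof = K-resp (λ _ aw → subst (λ x → Q x (ptˢ d (proj₂ aw))) (≡-sym (e (proj₁ aw))) , subst (λ x → Q x (ptˢ d (proj₂ aw))) (e (proj₁ aw))) proof
      ; covers = λ y → let (x , ρ) = covers y in x , subst (λ x → Q x y) (≡-sym (e x)) ρ }
      where
      tot₁ : Totalᵒ (λ x → Q (inj₁ x))
      tot₁ y with tt' y
      ... | inj₁ x , ρ = x , ρ
      ... | inj₂ x , ρ = ⊥-elim (n true x (unpt u m y) (subst (Q (inj₂ x)) (≡-sym (pt-unpt u m y)) ρ))
      open Origin (locate r k d {λ x → Q (inj₁ x)} cm tot₁ in' κ₁)
      mv = moveˡ (canon (comps r k) (comps t l)) sel
      e : ∀ x → at ⊕ (plus (r , k) (t , l)) (inS (proj₁ (proj₂ mv)) x) ≡ inj₁ (at r k (inS sel x))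
      e x = ≡-trans (cong (at ⊕ (plus (r , k) (t , l))) (proj₂ (proj₂ mv) x)) (at-ιˡ r k t l _)
... | snd κ₁ n = record { sel = proj₁ (proj₂ mv)
      ; proof = K-resp (λ _ aw → subst (λ x → Q x (ptˢ d (proj₂ aw))) (≡-sym (e (proj₁ aw))) , subst (λ x → Q x (ptˢ d (proj₂ aw))) (e (proj₁ aw))) proof
      ; covers = λ y → let (x , ρ) = covers y in x , subst (λ x → Q x y) (≡-sym (e x)) ρ }
      where
      tot₁ : Totalᵒ (λ x → Q (inj₂ x))
      tot₁ y with tt' y
      ... | inj₂ x , ρ = x , ρ
      ... | inj₁ x , ρ = ⊥-elim (n true x (unpt u m y) (subst (Q (inj₁ x)) (≡-sym (pt-unpt u m y)) ρ))
      open Origin (locate t l d {λ x → Q (inj₂ x)} cm tot₁ in' κ₁)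
      mv = moveʳ (canon (comps r k) (comps t l)) sel
      e : ∀ x → at ⊕ (plus (r , k) (t , l)) (inS (proj₁ (proj₂ mv)) x) ≡ inj₂ (at t l (inS sel x))
      e x = ≡-trans (cong (at ⊕ (plus (r , k) (t , l))) (proj₂ (proj₂ mv) x)) (at-ιʳ r k t l _)
locate ⊕ (lit n) d cm t i = locate-comp (⊕ , lit n) d (at ⊕ (lit n)) (λ _ → refl) t
locate ⊕ unit d cm t i = locate-comp (⊕ , unit) d (at ⊕ unit) (λ _ → refl) t
locate ⊕ zero d cm t i = locate-comp (⊕ , zero) d (at ⊕ zero) (λ _ → refl) t
locate ⊕ (tens a b) d cm t i = locate-comp (⊕ , tens a b) d (at ⊕ (tens a b)) (λ _ → refl) t
locate ⊖ k d cm t i = locate-comp (⊖ , k) d (at ⊖ k) (λ _ → refl) t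

toSrc : ∀ s k A {Q : web A → wk k → Set} → All Committing (comps s k) → Totalᵒ Q → Injᵒ Q →
  K (A ∷ dual (s , k) ∷ []) (λ _ ax → Q (proj₁ ax) (proj₁ (proj₂ ax))) → Src s k (comps (Signed.sign A) (Signed.skel A)) (λ x y → Q (at (Signed.sign A) (Signed.skel A) x) y)
toSrc-comp : ∀ d A {Q : web A → web d → Set} → Committing d → Totalᵒ Q → Injᵒ Q →
  K (A ∷ dual d ∷ []) (λ _ ax → Q (proj₁ ax) (proj₁ (proj₂ ax))) → Origin (comps (Signed.sign A) (Signed.skel A)) d (λ x y → Q (at (Signed.sign A) (Signed.skel A) x) y)
toSrc-comp d (s , k) {Q} cm t i π = locate s k d {Q} cm t i (toPrem-comp d {λ _ y x → Q x y} π)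
toSrc ⊕ (plus (r , k) (t , l)) A {Q} cm tot in' π =
  toSrc r k A {λ x y → Q x (inj₁ y)} (++⁻ˡ (comps r k) cm) (λ y → tot (inj₁ y)) (λ p q → inj₁-injective (in' p q)) (choose₁ {R = λ _ y x → Q x y} π)
  , toSrc t l A {λ x y → Q x (inj₂ y)} (++⁻ʳ (comps r k) cm) (λ y → tot (inj₂ y)) (λ p q → inj₂-injective (in' p q)) (choose₂ {R = λ _ y x → Q x y} π)
toSrc ⊕ (lit n) A {Q} (cm ∷ _) t i π = toSrc-comp (⊕ , lit n) A {Q} cm t i π
toSrc ⊕ unit A {Q} (cm ∷ _) t i π = toSrc-comp (⊕ , unit) A {Q} cm t i π
toSrc ⊕ zero A {Q} (cm ∷ _) t i π = toSrc-comp (⊕ , zero) A {Q} cm t i π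
toSrc ⊕ (tens a b) A {Q} (cm ∷ _) t i π = toSrc-comp (⊕ , tens a b) A {Q} cm t i π
toSrc ⊖ k A {Q} (cm ∷ _) t i π = toSrc-comp (⊖ , k) A {Q} cm t i π

IH⁺ : Sequent → Sequent → Set₁
IH⁺ L M = All (λ c → All (λ d → Thm c d) M) L

bij-part : ∀ {X X' Y Y' : Set} {Q : X → Y → Set} (j : X' → X) (h : Y' → Y) → (∀ {x x'} → j x ≡ j x' → x ≡ x') → (∀ {y y'} → h y ≡ h y' → y ≡ y') →
  (∀ {x y} → Q (j x) y → Σ Y' λ y' → y ≡ h y') → (∀ {x y} → Q x (h y) → Σ X' λ x' → x ≡ j x') → Bij Q → Bij (λ x y → Q (j x) (h y))
bij-part {Q = Q} j h ji hi t s b = record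
  { tot = λ x → let (y , ρ) = tot b (j x) ; (y' , e) = t ρ in y' , subst (Q _) e ρ
  ; sur = λ y → let (x , ρ) = sur b (h y) ; (x' , e) = s ρ in x' , subst (λ x → Q x _) e ρ
  ; fun = λ p q → hi (fun b p q) ; inj = λ p q → ji (inj b p q) }

-- A further summand would have a point, and the image of that point is already the image of a point
-- of the origin, against injectivity. So the source is a single summand.
plus-comp : ∀ L d {Q : Ix → Sum L → web d → Set} → All (λ c → Thm c d) L → Bij (Q true) → Unif (κΣ L) (κˢ d) (Q true) →
  Prem d L Q → Origin L d (Q true) → ⨁ L =D emb d × Close (κΣ L) (κˢ d) Q
plus-comp (c ∷ []) d {Q} (th ∷ []) b u (π ∷ []) record { sel = here ; proof = π' } =
  let (p , C) = th {λ i x y → Q i (inj₁ x) y} (bij-part {Q = Q true} inj₁ (λ y → y) inj₁-injective (λ e → e) (λ _ → _ , refl) (λ { {inj₁ x} _ → x , refl }) b)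
                  (λ z → u z) π π'
  in trans ⊕-unitʳ p , record { fill = λ { {inj₁ x} ρ φ → fill C ρ φ } ; shape = λ { {inj₁ x} ρ → shape C ρ } }
plus-comp (c ∷ (s , k) ∷ L) d {Q} th b u π record { sel = here ; covers = cov }
  with proj₁ (cov (proj₁ (tot b (inj₂ (inj₁ (dflt k true)))))) | inj b (proj₂ (cov _)) (proj₂ (tot b (inj₂ (inj₁ (dflt k true)))))
... | _ | ()
plus-comp ((s , k) ∷ L) d {Q} th b u π record { sel = there sl ; covers = cov }
  with inj b (proj₂ (cov _)) (proj₂ (tot b (inj₁ (dflt k true))))
... | ()

PlusClaim : Sign → Skeleton → Sequent → Set₁
PlusClaim s k L = ∀ {Q : Ix → Sum L → wk k → Set} → All Committing L → IH⁺ L (comps s k) → Bij (Q true) → Unif (κΣ L) κ⟨ k ⟩ (Q true) →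
  Prem (s , k) L Q → Src s k L (Q true) → ⨁ L =D emb (s , k) × Close (κΣ L) κ⟨ k ⟩ Q

-- `part` sorts the source by the chosen side of the target. Nothing is related across the two
-- parts, so bijectivity and the origins restrict to each of them.
plus-lemma : ∀ s k {L} → PlusClaim s k L
plus-lemma ⊕ (lit n) {L} {Q} cm ih b u π ω = plus-comp L (⊕ , lit n) {Q} (heads ih) b u π ω
plus-lemma ⊕ unit {L} {Q} cm ih b u π ω = plus-comp L (⊕ , unit) {Q} (heads ih) b u π ω
plus-lemma ⊕ zero {L} {Q} cm ih b u π ω = plus-comp L (⊕ , zero) {Q} (heads ih) b u π ω
plus-lemma ⊕ (tens x y) {L} {Q} cm ih b u π ω = plus-comp L (⊕ , tens x y) {Q} (heads ih) b u π ω
plus-lemma ⊖ k {L} {Q} cm ih b u π ω = plus-comp L (⊖ , k) {Q} (heads ih) b u π ω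
plus-lemma ⊕ (plus (r , k) (t , l)) {L} {Q} cm ih b u π (ω₁ , ω₂) =
  let (cm₁ , cm₂) = all-spl q cm
      (ih₁ , ih₂) = all-spl q ih
      (p₁ , C₁) = plus-lemma r k {Q = Q₁} cm₁ (mapᴬ (++⁻ˡ (comps r k)) ih₁)
        (bij-part {Q = Q true} (ιˡ q) inj₁ (ιˡ-inj q) inj₁-injective (λ { {y = inj₁ y} ρ → y , refl ; {y = inj₂ y} ρ → ⊥-elim (no₁ true _ y ρ) })
          (λ {x} {y} ρ → from₁ x y ρ) b)
        (λ c {x} {y} ρ → subst (λ z → Q true z _) (≡-sym (ιˡ-κ q c x)) (u c ρ)) prem₁ (src-restrict r k (ιˡ q) lands₁ ω₁)
      (p₂ , C₂) = plus-lemma t l {Q = Q₂} cm₂ (mapᴬ (++⁻ʳ (comps r k)) ih₂)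
        (bij-part {Q = Q true} (ιʳ q) inj₂ (ιʳ-inj q) inj₂-injective (λ { {y = inj₂ y} ρ → y , refl ; {y = inj₁ y} ρ → ⊥-elim (no₂ true _ y ρ) })
          (λ {x} {y} ρ → from₂ x y ρ) b)
        (λ c {x} {y} ρ → subst (λ z → Q true z _) (≡-sym (ιʳ-κ q c x)) (u c ρ)) prem₂ (src-restrict t l (ιʳ q) lands₂ ω₂)
  in trans (⨁-spl q) (⊕-cong p₁ p₂)
   , record { fill = λ {x} {y} → fill′ C₁ C₂ x y ; shape = λ {x} {y} → shape′ C₁ C₂ x y }
  where
  open Parted (part {Q = Q} cm (tot b) (inj b) π)
  Q₁ : Ix → Sum L₁ → wk k → Set
  Q₁ i x y = Q i (ιˡ q x) (inj₁ y)
  Q₂ : Ix → Sum L₂ → wk l → Set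
  Q₂ i x y = Q i (ιʳ q x) (inj₂ y)
  from₁ : ∀ x y → Q true x (inj₁ y) → Σ (Sum L₁) λ x' → x ≡ ιˡ q x'
  from₁ x y ρ with side q x
  ... | isˡ x' = x' , refl
  ... | isʳ x' = ⊥-elim (no₂ true x' y ρ)
  from₂ : ∀ x y → Q true x (inj₂ y) → Σ (Sum L₂) λ x' → x ≡ ιʳ q x'
  from₂ x y ρ with side q x
  ... | isˡ x' = ⊥-elim (no₁ true x' y ρ)
  ... | isʳ x' = x' , refl
  lands₁ : Lands {L} {L₁} (ιˡ q) (λ x y → Q true x (inj₁ y))
  lands₁ s = map⊎ (λ m → m) (λ m x y ρ → no₂ true _ y (subst (λ z → Q true z (inj₁ y)) (Moved.same m x) ρ)) (unmove q s)
  lands₂ : Lands {L} {L₂} (ιʳ q) (λ x y → Q true x (inj₂ y))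
  lands₂ s with unmove q s
  ... | inj₁ m = inj₂ λ x y ρ → no₁ true _ y (subst (λ z → Q true z (inj₂ y)) (Moved.same m x) ρ)
  ... | inj₂ m = inj₁ m
  module _ (C₁ : Close (κΣ L₁) κ⟨ k ⟩ Q₁) (C₂ : Close (κΣ L₂) κ⟨ l ⟩ Q₂) where
    fill′ : ∀ x y → Q true x y → (∀ c → Q false (κΣ L c x) (κ⟨ plus (r , k) (t , l) ⟩ c y)) → Q false x y
    fill′ x (inj₁ y) ρ φ with side q x
    ... | isˡ x' = fill C₁ ρ (λ c → subst (λ z → Q false z _) (≡-sym (ιˡ-κ q c x')) (φ c))
    ... | isʳ x' = ⊥-elim (no₂ true x' y ρ)
    fill′ x (inj₂ y) ρ φ with side q x
    ... | isʳ x' = fill C₂ ρ (λ c → subst (λ z → Q false z _) (≡-sym (ιʳ-κ q c x')) (φ c))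
    ... | isˡ x' = ⊥-elim (no₁ true x' y ρ)
    shape′ : ∀ x y → Q false x y → ∀ c → Q true (κΣ L c x) (κ⟨ plus (r , k) (t , l) ⟩ c y)
    shape′ x (inj₁ y) ρ c with side q x
    ... | isˡ x' = subst (λ z → Q true z _) (ιˡ-κ q c x') (shape C₁ ρ c)
    ... | isʳ x' = ⊥-elim (no₂ false x' y ρ)
    shape′ x (inj₂ y) ρ c with side q x
    ... | isʳ x' = subst (λ z → Q true z _) (ιʳ-κ q c x') (shape C₂ ρ c)
    ... | isˡ x' = ⊥-elim (no₁ false x' y ρ)


-- The induction on pairs of normal forms

⨂-tcd : ∀ s k → ⨂ (tcd s k) =D emb (s , k)
⨂-tcd ⊕ (tens (r , k) (t , l)) = trans (⨂-spl (canon (tcd r k) (tcd t l))) (⊗-cong (⨂-tcd r k) (⨂-tcd t l))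
⨂-tcd ⊕ (lit n) = ⊗-unit
⨂-tcd ⊕ unit = ⊗-unit
⨂-tcd ⊕ zero = ⊗-unit
⨂-tcd ⊕ (plus a b) = ⊗-unit
⨂-tcd ⊖ k = ⊗-unit

close-∘ : ∀ {X X' Y : Set} {u : Bool → X → X} {u' : Bool → X' → X'} {v : Bool → Y → Y} {R : Ix → X → Y → Set} (f : X' → X) (g : X → X') →
  (∀ x → f (g x) ≡ x) → (∀ c x → f (u' c x) ≡ u c (f x)) → Close u' v (λ i x y → R i (f x) y) → Close u v R
close-∘ {u = u} {u'} {v} {R} f g e h C = record
  { fill = λ {x} {y} ρ φ → subst (λ x → R false x y) (e x) (fill C (subst (λ x → R true x y) (≡-sym (e x)) ρ)
      (λ c → subst (λ x → R false x (v c y)) (≡-sym (≡-trans (h c (g x)) (cong (u c) (e x)))) (φ c)))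
  ; shape = λ {x} {y} ρ c → subst (λ x → R true x (v c y)) (≡-trans (h c (g x)) (cong (u c) (e x))) (shape C (subst (λ x → R false x y) (≡-sym (e x)) ρ) c) }

close-flip : ∀ {X Y : Set} {u : Bool → X → X} {v : Bool → Y → Y} {R : Ix → X → Y → Set} → Close v u (λ i y x → R i x y) → Close u v R
close-flip C = record { fill = λ ρ φ → fill C ρ φ ; shape = λ ρ c → shape C ρ c }

-- By uniformity the bijection relates each label to itself, hence it is the identity. At a leaf
-- every point is a constant labelling, so `fill` has its conclusion among its hypotheses.
leaf-close : ∀ {R : Ix → Bool → Bool → Set} → Bij (R true) → Unif (λ c _ → c) (λ c _ → c) (R true) → Close (λ c _ → c) (λ c _ → c) R
leaf-close {R} b u = record
  { fill = λ {x} {y} ρ φ → subst (R false x) (fun b (diag x) ρ) (φ x)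
  ; shape = λ _ → diag }
  where
  diag : ∀ c → R true c c
  diag c = u c (proj₂ (tot b c))

-- Three points tell compound formulas from leaves, whose webs have only two.
record Big (X : Set) : Set where
  field
    {x y z} : X
    x≢y : x ≢ y
    x≢z : x ≢ z
    y≢z : y ≢ z

pigeonhole : ∀ {X} {R : X → Bool → Set} → Big X → Bij R → ⊥
pigeonhole g b = case (tot b x) (tot b y) (tot b z)
  where
  open Big g
  case : Σ Bool _ → Σ Bool _ → Σ Bool _ → ⊥
  case (true , p) (true , q) _ = x≢y (inj b p q)
  case (false , p) (false , q) _ = x≢y (inj b p q)
  case (true , p) (false , q) (true , r) = x≢z (inj b p r)
  case (true , p) (false , q) (false , r) = y≢z (inj b q r)
  case (false , p) (true , q) (true , r) = y≢z (inj b q r)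
  case (false , p) (true , q) (false , r) = x≢z (inj b p r)

big-tens : ∀ a b → Big (wk (tens a b))
big-tens a b = let (p , p' , n) = distinct-web a ; (q , q' , m) = distinct-web b in
  record { x = p , q ; y = p' , q ; z = p , q' ; x≢y = λ e → n (,-injˡ e) ; x≢z = λ e → m (,-injʳ e) ; y≢z = λ e → n (≡-sym (,-injˡ e)) }

big-plus : ∀ a b → Big (wk (plus a b))
big-plus a b = let (p , p' , n) = distinct-web a ; (q , _) = distinct-web b in
  record { x = inj₁ p ; y = inj₁ p' ; z = inj₂ q ; x≢y = λ e → n (inj₁-injective e) ; x≢z = λ () ; y≢z = λ () }

no-plus : ∀ {a b Δ Q} → Principal (⊕ , plus a b) Δ Q → (∀ x → Σ _ (Q true x)) → ⊥
no-plus {b = b} (pl₁ k e) s = let (_ , ρ) = s (inj₂ (proj₁ (distinct-web b))) in proj₁ (e true _ _) ρ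
no-plus {a} (pl₂ k e) s = let (_ , ρ) = s (inj₁ (proj₁ (distinct-web a))) in proj₁ (e true _ _) ρ

-- The only context formula goes to one premise of a ⊗-rule and leaves the other component idle,
-- while a ⊕-rule misses a summand.
no-two : ∀ {k l} {Q : Ix → wk k → W ((⊕ , l) ∷ []) → Set} → Principal (⊕ , k) ((⊕ , l) ∷ []) Q → Bij (λ x y → Q true x (y , tt)) → ⊥
no-two {Q = Q} (ten {a} {b} {S = S} {T} (lft []) σ τ e) bij = no-idle (flip-fac ×-fac) {λ x y → Q true x (y , tt)} {λ y → T true (y , tt)} {λ x y → S true (x , y , tt)}
  (λ x y → flip-iff (e true x (y , tt))) (distinct-web b) (proj₁ (distinct-web a)) bij
no-two {Q = Q} (ten {a} {b} {S = S} {T} (rgt []) σ τ e) bij = no-idle ×-fac {λ x y → Q true x (y , tt)} {λ y → S true (y , tt)} {λ x y → T true (x , y , tt)}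
  (λ x y → e true x (y , tt)) (distinct-web a) (proj₁ (distinct-web b)) bij
no-two p@(pl₁ k e) b = no-plus p λ x → let (y , ρ) = tot b x in _ , ρ
no-two p@(pl₂ k e) b = no-plus p λ x → let (y , ρ) = tot b x in _ , ρ

-- ⊥ is not synchronous, so `focus` does not apply; but only the ⊥-rule could be last, and it leaves
-- 0 alone, for which there is no rule.
no-zero-bot : ∀ {R} → K ((⊕ , zero) ∷ (⊖ , unit) ∷ []) R → ⊥
no-zero-bot (ten (there (there ())) q k k' e)
no-zero-bot (prl (there (there ())) k e)
no-zero-bot (pl₁ (there (there ())) k e)
no-zero-bot (pl₂ (there (there ())) k e)
no-zero-bot (wth (there (there ())) k k' e)
no-zero-bot (top (there (there ())))
no-zero-bot (bot (there here) (ten (there ()) q k k' e))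
no-zero-bot (bot (there here) (prl (there ()) k e))
no-zero-bot (bot (there here) (pl₁ (there ()) k e))
no-zero-bot (bot (there here) (pl₂ (there ()) k e))
no-zero-bot (bot (there here) (wth (there ()) k k' e))
no-zero-bot (bot (there here) (bot (there ()) k))
no-zero-bot (bot (there here) (top (there ())))

comps-commit : ∀ s k → (s , k) ≢ 0ˢ → Normal k → All Committing (comps s k)
comps-commit ⊖ k z n = inj₁ (tt ∷ []) ∷ []
comps-commit ⊕ (lit x) z n = inj₁ (tt ∷ []) ∷ []
comps-commit ⊕ unit z n = inj₂ refl ∷ []
comps-commit ⊕ zero z n = ⊥-elim (z refl)
comps-commit ⊕ (tens a b) z n = inj₁ (factor-sync ⊕ (tens a b) tt n) ∷ []
comps-commit ⊕ (plus (r , k) (t , l)) _ ((z , z') , n , m) = ++⁺ (comps-commit r k z n) (comps-commit t l z' m)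

thm : ∀ s k t l → Normal k → Normal l → Thm (s , k) (t , l)
thm⁺ : ∀ k l → Normal k → Normal l → Thm (⊕ , k) (⊕ , l)
factors : ∀ s k t l → Normal k → Normal l → IH (tcd s k) (tcd t l)
factors₁ : ∀ s k t l → Normal k → Normal l → All (λ G → Thm (s , k) (dual G)) (tcd t l)
summands : ∀ s k t l → Normal k → Normal l → IH⁺ (comps s k) (comps t l)
summands₁ : ∀ s k t l → Normal k → Normal l → All (Thm (s , k)) (comps t l)

factors₁ s k ⊖ l n m = thm s k ⊖ l n m ∷ []
factors₁ s k ⊕ (lit x) n m = thm s k ⊕ (lit x) n m ∷ []
factors₁ s k ⊕ unit n m = thm s k ⊕ unit n m ∷ []
factors₁ s k ⊕ zero n m = thm s k ⊕ zero n m ∷ []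
factors₁ s k ⊕ (plus a b) n m = thm s k ⊕ (plus a b) n m ∷ []
factors₁ s k ⊕ (tens (r , x) (t , y)) n (_ , m , m') = ++⁺ (factors₁ s k r x n m) (factors₁ s k t y n m')

factors ⊖ k t l n m = factors₁ ⊖ k t l n m ∷ []
factors ⊕ (lit x) t l n m = factors₁ ⊕ (lit x) t l n m ∷ []
factors ⊕ unit t l n m = factors₁ ⊕ unit t l n m ∷ []
factors ⊕ zero t l n m = factors₁ ⊕ zero t l n m ∷ []
factors ⊕ (plus a b) t l n m = factors₁ ⊕ (plus a b) t l n m ∷ []
factors ⊕ (tens (r , x) (r' , y)) t l (_ , n , n') m = ++⁺ (factors r x t l n m) (factors r' y t l n' m)

summands₁ s k ⊖ l n m = thm s k ⊖ l n m ∷ []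
summands₁ s k ⊕ (lit x) n m = thm s k ⊕ (lit x) n m ∷ []
summands₁ s k ⊕ unit n m = thm s k ⊕ unit n m ∷ []
summands₁ s k ⊕ zero n m = thm s k ⊕ zero n m ∷ []
summands₁ s k ⊕ (tens a b) n m = thm s k ⊕ (tens a b) n m ∷ []
summands₁ s k ⊕ (plus (r , x) (t , y)) n (_ , m , m') = ++⁺ (summands₁ s k r x n m) (summands₁ s k t y n m')

summands ⊖ k t l n m = summands₁ ⊖ k t l n m ∷ []
summands ⊕ (lit x) t l n m = summands₁ ⊕ (lit x) t l n m ∷ []
summands ⊕ unit t l n m = summands₁ ⊕ unit t l n m ∷ []
summands ⊕ zero t l n m = summands₁ ⊕ zero t l n m ∷ []
summands ⊕ (tens a b) t l n m = summands₁ ⊕ (tens a b) t l n m ∷ []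
summands ⊕ (plus (r , x) (r' , y)) t l (_ , n , n') m = ++⁺ (summands r x t l n m) (summands r' y t l n' m)

thm ⊕ k ⊕ l n m = thm⁺ k l n m
-- Negation exchanges source and target, so `π`, which carries both relations, keeps its role; the
-- cuts with `tcdᵛ` decompose the ⊗'s of the positive formulas.
thm ⊖ k ⊖ l n m {R} b u π π' =
  let (p , C) = thm⁺ l k m n {λ i y x → R i x y} (bij-flip b) (λ c ρ → u c ρ)
        (K-resp (λ { i (x , w) → (λ { (y , ρ , refl) → ρ }) , (λ ρ → _ , ρ , refl) }) (cut₁ {x = λ i y w → y ≡ pt ⊕ l w} π (tcdᵛ ⊕ l)))
        (K-resp (λ { i (y , w) → (λ { (x , ρ , refl) → ρ }) , (λ ρ → _ , ρ , refl) }) (cut₁ {x = λ i x w → x ≡ pt ⊕ k w} π' (tcdᵛ ⊕ k)))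
  in neg-cong (sym p) , close-flip C
-- Opposite signs: the proof of the positive formula has one synchronous context formula, which
-- `no-two` excludes.
thm ⊕ k ⊖ l n m {R} b u π π' = ⊥-elim (no-two {Q = λ i x h → R true x (proj₁ h)}
  (focus {R = λ i aw → R true (proj₁ aw) (proj₁ (proj₂ aw))} (tt ∷ []) (λ y → sur b (proj₁ y)) (λ ρ ρ' → cong (_, tt) (fun b ρ ρ')) π') b)
thm ⊖ k ⊕ l n m {R} b u π π' = ⊥-elim (no-two {Q = λ i y h → R i (proj₁ h) y}
  (focus {R = λ i aw → R i (proj₁ (proj₂ aw)) (proj₁ aw)} (tt ∷ []) (λ y → tot b (proj₁ y)) (λ ρ ρ' → cong (_, tt) (inj b ρ ρ')) π) (bij-flip b))

thm⁺ (tens a b) (lit n) _ _ β = ⊥-elim (pigeonhole (big-tens a b) β)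
thm⁺ (tens a b) unit _ _ β = ⊥-elim (pigeonhole (big-tens a b) β)
thm⁺ (tens a b) zero _ _ β = ⊥-elim (pigeonhole (big-tens a b) β)
thm⁺ (plus a b) (lit n) _ _ β = ⊥-elim (pigeonhole (big-plus a b) β)
thm⁺ (plus a b) unit _ _ β = ⊥-elim (pigeonhole (big-plus a b) β)
thm⁺ (plus a b) zero _ _ β = ⊥-elim (pigeonhole (big-plus a b) β)
thm⁺ (lit n) (tens a b) _ _ β = ⊥-elim (pigeonhole (big-tens a b) (bij-flip β))
thm⁺ unit (tens a b) _ _ β = ⊥-elim (pigeonhole (big-tens a b) (bij-flip β))
thm⁺ zero (tens a b) _ _ β = ⊥-elim (pigeonhole (big-tens a b) (bij-flip β))
thm⁺ (lit n) (plus a b) _ _ β = ⊥-elim (pigeonhole (big-plus a b) (bij-flip β))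
thm⁺ unit (plus a b) _ _ β = ⊥-elim (pigeonhole (big-plus a b) (bij-flip β))
thm⁺ zero (plus a b) _ _ β = ⊥-elim (pigeonhole (big-plus a b) (bij-flip β))
thm⁺ unit unit _ _ {R} b u π π' = refl , leaf-close b u
thm⁺ zero zero _ _ {R} b u π π' = refl , leaf-close b u
thm⁺ unit zero _ _ b u π π' = ⊥-elim (no-zero-bot π)
thm⁺ zero unit _ _ b u π π' = ⊥-elim (no-zero-bot π')
thm⁺ (lit n) unit _ _ {R} b u π π'
  with focus {k = unit} (tt ∷ []) (λ y → tot b (proj₁ y)) (λ ρ ρ' → cong (_, tt) (inj b ρ ρ')) π
... | ()
thm⁺ (lit n) zero _ _ {R} b u π π'
  with focus {k = zero} (tt ∷ []) (λ y → tot b (proj₁ y)) (λ ρ ρ' → cong (_, tt) (inj b ρ ρ')) π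
... | ()
thm⁺ unit (lit n) _ _ {R} b u π π'
  with focus {k = unit} (tt ∷ []) (λ y → sur b (proj₁ y)) (λ ρ ρ' → cong (_, tt) (fun b ρ ρ')) π'
... | ()
thm⁺ zero (lit n) _ _ {R} b u π π'
  with focus {k = zero} (tt ∷ []) (λ y → sur b (proj₁ y)) (λ ρ ρ' → cong (_, tt) (fun b ρ ρ')) π'
... | ()
-- An axiom must be the last rule, and it identifies the two atoms.
thm⁺ (lit n) (lit m) _ _ {R} b u π π'
  with focus {k = lit m} (tt ∷ []) (λ y → tot b (proj₁ y)) (λ ρ ρ' → cong (_, tt) (inj b ρ ρ')) π
... | lit _ = refl , leaf-close b u
-- The factors of a normal ⊗ form a synchronous context, so the choice of a summand comes last and
-- the other summand is missed.
thm⁺ k@(tens _ _) (plus c d) n _ {R} b u π π' =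
  ⊥-elim (no-plus (focus {k = plus c d} (factor-sync ⊕ k tt n) (λ w → tot b (pt ⊕ k w)) (λ ρ ρ' → pt-inj ⊕ k (inj b ρ ρ')) π)
    λ y → let (x , ρ) = sur b y in unpt ⊕ k x , subst (λ x → R true x y) (≡-sym (pt-unpt ⊕ k x)) ρ)
thm⁺ (plus c d) l@(tens _ _) _ m {R} b u π π' =
  ⊥-elim (no-plus (focus {k = plus c d} (factor-sync ⊕ l tt m) (λ w → sur b (pt ⊕ l w)) (λ ρ ρ' → pt-inj ⊕ l (fun b ρ ρ')) π')
    λ x → let (y , ρ) = tot b x in unpt ⊕ l y , subst (R true x) (≡-sym (pt-unpt ⊕ l y)) ρ)
thm⁺ k@(tens (r , x) (r' , y)) l@(tens _ _) n@(_ , nx , ny) m {R} b u π π' =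
  let (p , C) = tens-lemma ⊕ l {tcd ⊕ k} {λ i w y → R i (pt ⊕ k w) y} (factor-sync ⊕ k tt n)
        (++⁺ (factors r x ⊕ l nx m) (factors r' y ⊕ l ny m)) (bij-pt (⊕ , k) b)
        (λ c {w} ρ → subst (λ x → R true x _) (≡-sym (pt-κ c ⊕ k w)) (u c ρ)) π
        (decompose ⊕ k {Q = λ x w → R true x (pt ⊕ l w)} (factor-sync ⊕ l tt m) (bij-flip (bij-pt (⊕ , l) (bij-flip b))) π')
  in trans (sym (⨂-tcd ⊕ k)) p , close-∘ {R = R} (pt ⊕ k) (unpt ⊕ k) (pt-unpt ⊕ k) (λ c w → pt-κ c ⊕ k w) C
thm⁺ k@(plus (r , x) (r' , y)) l@(plus _ _) n@(_ , nx , ny) m {R} b u π π' =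
  let (p , C) = plus-lemma ⊕ l {comps ⊕ k} {λ i z y → R i (at ⊕ k z) y} (comps-commit ⊕ k (λ ()) n)
        (++⁺ (summands r x ⊕ l nx m) (summands r' y ⊕ l ny m))
        (bij-∘ {R = R true} (at ⊕ k) (λ x → un ⊕ k x , at-un ⊕ k x) (λ {z} {z'} e → ≡-trans (≡-sym (un-at ⊕ k z)) (≡-trans (cong (un ⊕ k) e) (un-at ⊕ k z'))) b)
        (λ c {z} ρ → subst (λ x → R true x _) (≡-sym (at-κ ⊕ k c z)) (u c ρ))
        (toPrem ⊕ k {R} π) (toSrc ⊕ l (⊕ , k) {R true} (comps-commit ⊕ l (λ ()) m) (sur b) (fun b) π')
  in trans (sym (⨁-comps ⊕ k)) p , close-∘ {R = R} (at ⊕ k) (un ⊕ k) (at-un ⊕ k) (λ c z → at-κ ⊕ k c z) C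

-- Completeness


K-of-hom : ∀ s k {B R} → P.Hom (s , k) B R → K (B ∷ tcd s k) (λ i bw → R i (pt s k (proj₂ bw)) (proj₁ bw))
K-of-hom s k h = K-resp (λ i bw → (λ { (_ , refl , r) → r }) , (λ r → _ , refl , r)) (K-of′ (P.push h (tcdᵛ s k)))

IsId : ∀ {X : Set} → (X → X → Set) → Set
IsId R = ∀ a b → Iff (R a b) (a ≡ b)

-- The main induction is applied to `(s , k)` on both sides, with the identity as `R true`; it makes
-- `g` close to the identity, and the invariants of `g` do the rest.
isolated : ∀ s k → Normal k → {R : Ix → wk k → wk k → Set} (g : Arrow (s , k) (s , k)) → (∀ a b → Iff (R false a b) (rel g a b)) → IsId (R true) →
  K ((s , k) ∷ tcd s k) (λ i bw → R i (pt s k (proj₂ bw)) (proj₁ bw)) → IsId (rel g)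
-- Once the diagonal is contained in `g`, coherence of `a` with itself makes `a` and `b` coherent,
-- and injectivity on coherent points gives `a ≡ b`.
isolated s k n {R} g e h π = λ a b → (λ r → proj₂ (clique g r (id⊆ b) (proj₁ (clique g (id⊆ a) r (Coh-refl (s , k) a)))) refl) , (λ { refl → id⊆ a })
  where
  bij : Bij (R true)
  bij = record
    { tot = λ a → a , proj₂ (h a a) refl ; sur = λ a → a , proj₂ (h a a) refl
    ; fun = λ p q → ≡-trans (≡-sym (proj₁ (h _ _) p)) (proj₁ (h _ _) q) ; inj = λ p q → ≡-trans (proj₁ (h _ _) p) (≡-sym (proj₁ (h _ _) q)) }
  close : Close κ⟨ k ⟩ κ⟨ k ⟩ R
  close = proj₂ (thm s k s k n n {R} bij (λ c {x} {y} r → proj₂ (h _ _) (cong (κ c k) (proj₁ (h x y) r))) π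
    (K-resp (λ i aw → (λ r → proj₂ (h _ _) r) , (λ r → proj₁ (h _ _) r)) (K-of′ (tcdᵛ s k))))
  id⊆ : ∀ p → rel g p p
  id⊆ p =
    -- Totality against the two opposite realisers of `p` yields a related pair. By `shape` its
    -- members have the same resolution, and by `pin-meet` this is the resolution of `p`.
    let (_ , a , α , b , r , β) = lower (T.Perp.holds (T.Hom.app (total g) (pinᵛ s k p) (pinᵛ (flip s) k p) [])) true
        e-ab c = proj₁ (h _ _) (shape close (proj₂ (e a b) r) c)
        e-a c = pin-meet c s k p a b α β (e-ab c)
    -- Uniformity relates the constant labellings of `p` to themselves, and `fill` recovers the
    -- actual labels.
    in proj₁ (e p p) (fill close (proj₂ (h p p) refl) λ c →
         proj₂ (e _ _) (subst₂ (rel g) (e-a c) (≡-trans (≡-sym (e-ab c)) (e-a c)) (uniform g c a b r)))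

isolated-chain : ∀ s k → Normal k → {f g : Arrow (s , k) (s , k)} → f ≃ g → IsId (rel f) → IsId (rel g)
isolated-chain s k n ε h = h
isolated-chain s k n {f} (_◅_ {j = g} (onward p) ps) h = isolated-chain s k n ps (isolated s k n {pick (rel f) (rel g)} g (λ _ _ → iff) h (K-of-hom s k (both p)))
-- A link traversed backwards: reindexing with `not` puts the relation already known to be the
-- identity at `true`.
isolated-chain s k n {f} (_◅_ {j = g} (backward p) ps) h = isolated-chain s k n ps
  (isolated s k n {pick (rel f) (rel g)} g (λ _ _ → iff) h
    (K-resp (λ { true _ → iff ; false _ → iff }) (K-reindex not (K-of-hom s k (both p)))))

module _ {X Y : Signed} {N M : Signed} (rN : Retract X N) (rM : Retract Y M) where

  between : Arrow X Y → Arrow N M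
  between f = R.down rN ⨟ f ⨟ R.up rM

-- The hypothesis and `section` only provide chains; a chain ending at the identity of a normal form
-- collapses to equality of relations.
between-inverse : ∀ {X Y s k M} (n : Normal k) (rN : Retract X (s , k)) (rM : Retract Y M) (f : Arrow X Y) (g : Arrow Y X) →
  f ⨟ g ≃ idᵃ → IsId (rel (between rN rM f ⨟ between rM rN g))
between-inverse {s = s} {k} n rN rM f g e = isolated-chain s k n (symmetric _≃¹_ chain) λ a b → iff
  where
  dN = R.down rN
  uN = R.up rN
  dM = R.down rM
  uM = R.up rM
  chain : between rN rM f ⨟ between rM rN g ≃ idᵃ
  chain = transitive _≃¹_ (≃-exact _ ((dN ⨟ f) ⨟ (uM ⨟ dM) ⨟ (g ⨟ uN)) λ a b →
            (λ { (_ , (_ , (_ , p , q) , r) , (_ , (_ , s , t) , u)) → _ , (_ , (_ , p , q) , (_ , r , s)) , (_ , t , u) })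
          , (λ { (_ , (_ , (_ , p , q) , (_ , r , s)) , (_ , t , u)) → _ , (_ , (_ , p , q) , r) , (_ , (_ , s , t) , u) }))
    (transitive _≃¹_ (≃-comp (dN ⨟ f) (g ⨟ uN) (R.section rM))
    (transitive _≃¹_ (≃-exact ((dN ⨟ f) ⨟ idᵃ ⨟ (g ⨟ uN)) (dN ⨟ (f ⨟ g) ⨟ uN) λ a b →
            (λ { (_ , (_ , (_ , p , q) , refl) , (_ , t , u)) → _ , (_ , p , (_ , q , t)) , u })
          , (λ { (_ , (_ , p , (_ , q , t)) , u) → _ , (_ , (_ , p , q) , refl) , (_ , t , u) }))
    (transitive _≃¹_ (≃-comp dN uN e)
    (≃-exact (dN ⨟ idᵃ ⨟ uN) idᵃ λ a b →
            (λ { (_ , (_ , p , refl) , u) → proj₁ (R.retract rN a b) (_ , p , u) })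
          , (λ h → let (_ , p , u) = proj₂ (R.retract rN a b) h in _ , (_ , p , refl) , u)))))

-- If both composites are identities, the two relations are converse bijections; the proof realising
-- `g` is then a converse proof for the relation of `f`.
inverse-arrows : ∀ s k t l → Normal k → Normal l → (f : Arrow (s , k) (t , l)) (g : Arrow (t , l) (s , k)) →
  IsId (rel (f ⨟ g)) → IsId (rel (g ⨟ f)) → emb (s , k) =D emb (t , l)
inverse-arrows s k t l n m f g fg gf = proj₁ (thm s k t l n m {con (rel f)} bij (λ c {a} {b} r → uniform f c a b r)
  (K-of-hom s k (valid f)) (K-resp (λ i aw → g⊆f , f⊆g) (K-of-hom t l (valid g))))
  where
  f⊆g : ∀ {a b} → rel f a b → rel g b a
  f⊆g {a} {b} r = let (x , p , q) = proj₂ (gf b b) refl in subst (rel g b) (≡-sym (proj₁ (fg a x) (b , r , p))) p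
  g⊆f : ∀ {a b} → rel g b a → rel f a b
  g⊆f {a} {b} r = let (y , p , q) = proj₂ (fg a a) refl in subst (rel f a) (≡-sym (proj₁ (gf b y) (a , r , p))) p
  bij : Bij (rel f)
  bij = record
    { tot = λ a → let (b , p , _) = proj₂ (fg a a) refl in b , p
    ; sur = λ b → let (a , _ , q) = proj₂ (gf b b) refl in a , q
    ; fun = λ {a} p q → proj₁ (gf _ _) (a , f⊆g p , q)
    ; inj = λ {_} {_} {b} p q → proj₁ (fg _ _) (b , p , f⊆g q) }

term-iso : ∀ s k t l → Normal k → Normal l → (f : Term (emb (s , k)) (emb (t , l))) (g : Term (emb (t , l)) (emb (s , k))) →
  g ∘ᵗ f ≈ᵗ idᵗ → f ∘ᵗ g ≈ᵗ idᵗ → emb (s , k) =D emb (t , l)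
term-iso s k t l n m f g gf fg = inverse-arrows s k t l n m (between rN rM (termᵃ f)) (between rM rN (termᵃ g))
  (between-inverse n rN rM (termᵃ f) (termᵃ g) (toId f g gf)) (between-inverse m rM rN (termᵃ g) (termᵃ f) (toId g f fg))
  where
  rN = emb-ret s k
  rM = emb-ret t l
  toId : ∀ {A B} (f : Term A B) (g : Term B A) → g ∘ᵗ f ≈ᵗ idᵗ → termᵃ f ⨟ termᵃ g ≃ idᵃ
  toId f g e = transitive _≃¹_ (≃-exact (termᵃ f ⨟ termᵃ g) (termᵃ (g ∘ᵗ f)) λ a b → iff)
    (transitive _≃¹_ (term-chain e) (≃-exact (termᵃ idᵗ) idᵃ λ a b → iff))

free-iso : ∀ {o ℓ e} s k t l → Normal k → Normal l → ValidIso o ℓ e (emb (s , k)) (emb (t , l)) → emb (s , k) =D emb (t , l)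
free-iso {o} {ℓ} {e} s k t l n m v = term-iso s k t l n m (lower from) (lower to) (lower isoˡ) (lower isoʳ)
  where
  open Iso (subst₂ (Iso (StarAutonomousWithProducts.cat (Free o ℓ e))) (Free-⟦⟧ o ℓ e (emb (s , k))) (Free-⟦⟧ o ℓ e (emb (t , l)))
    (v (Free o ℓ e) (λ n → lift (atom n))))

theorem9p2 : ∀ {o ℓ e : Level} (F G : Formula) →
    (F =D G → ValidIso o ℓ e F G) × (ValidIso o ℓ e F G → F =D G)
theorem9p2 {o} {ℓ} {e} F G = sound-iso , λ v →
  -- Soundness makes `F` and `G` isomorphic to their normal forms in every model, so the validity of
  -- the isomorphism passes to the normal forms.
  trans (sym (emb-nf F)) (trans (free-iso (Signed.sign (nf F)) _ (Signed.sign (nf G)) _ (nf-normal (Signed.sign (tr F)) _) (nf-normal (Signed.sign (tr G)) _)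
    λ 𝒞 ρ → let open Soundness 𝒞 in iso-trans (sound-D (emb-nf F) ρ) (iso-trans (v 𝒞 ρ) (iso-sym (sound-D (emb-nf G) ρ)))) (emb-nf G))
  where
  sound-iso : F =D G → ValidIso o ℓ e F G
  sound-iso p 𝒞 = Soundness.sound-D 𝒞 p
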